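{- Let $t,s$ be integers with $t>s>2$. If $\gcd(s,t)=1$, then \[ \mathrm{wsat}(s+t+1, K_{s,t})=\binom{s+t+1}{2}-(2s+2t-2). \] Otherwise (if $\gcd(s,t)>1$), \[ 2s+2t-3\le \binom{s+t+1}{2}-\mathrm{wsat}(s+t+1,K_{s,t})\le 2s+2t-2. \]
   Context: For a fixed graph $F$, an $n$-vertex graph $G$ is called weakly $F$-saturated if $G$ contains no copy of $F$ and there exists an ordering $e_1,\dots,e_m$ of the edges of $E(K_n)\setminus E(G)$ such that for each $i\in\{1,\dots,m\}$ the graph $G\cup\{e_1,\dots,e_i\}$ contains a copy $F_i$ of $F$ with $e_i\in E(F_i)$. The weak saturation number $\mathrm{wsat}(n,F)$ is the minimum number of edges of a weakly $F$-saturated $n$-vertex graph. $K_{s,t}$ denotes the complete bipartite graph with parts of sizes $s$ and $t$. -}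

module Defs where

open import Data.Nat using (ℕ; zero; suc; _+_; _<_; _≤_; _<ᵇ_)
open import Data.Bool using (Bool; true; false; _∨_; _∧_; _xor_; if_then_else_)
open import Data.Fin using (Fin; toℕ)
open import Data.Fin.Properties using () renaming (_≟_ to _≟ᶠ_)
open import Data.List using (List; []; _∷_; map; allFin)
open import Data.Nat.ListAction using (sum)
open import Data.List.Membership.Propositional using (_∈_)
open import Data.List.Relation.Unary.All using (All)
open import Data.List.Relation.Unary.Unique.Propositional using (Unique)
open import Data.Product using (Σ; ∃; ∃-syntax; _×_; _,_)
open import Data.Unit using (⊤)
open import Relation.Nullary using (¬_; does)
open import Relation.Binary.PropositionalEquality using (_≡_)
open import Function.Bundles using (_⇔_)
open import Function.Definitions using (Injective)

Graph : ℕ → Set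
Graph n = Fin n → Fin n → Bool

IsSimple : ∀ {n} → Graph n → Set
IsSimple {n} G = (∀ (x y : Fin n) → G x y ≡ G y x) × (∀ (x : Fin n) → G x x ≡ false)

edgeCount : ∀ {n} → Graph n → ℕ
edgeCount {n} G =
  sum (map (λ x → sum (map (λ y → if (toℕ x <ᵇ toℕ y) ∧ G x y then 1 else 0) (allFin n))) (allFin n))

Embedding : ∀ {k n} → Graph k → Graph n → Set
Embedding {k} {n} F G =
  Σ (Fin k → Fin n) λ φ → Injective _≡_ _≡_ φ × (∀ u v → F u v ≡ true → G (φ u) (φ v) ≡ true)

Contains : ∀ {k n} → Graph k → Graph n → Set
Contains F G = Embedding F G

ContainsWithEdge : ∀ {k n} → Graph k → Graph n → Fin n → Fin n → Set
ContainsWithEdge {k} {n} F G a b =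
  Σ (Fin k → Fin n) λ φ → Injective _≡_ _≡_ φ × (∀ u v → F u v ≡ true → G (φ u) (φ v) ≡ true)
    × ∃[ u ] ∃[ v ] (F u v ≡ true × φ u ≡ a × φ v ≡ b)

addEdge : ∀ {n} → Fin n → Fin n → Graph n → Graph n
addEdge a b G x y =
  G x y ∨ (does (x ≟ᶠ a) ∧ does (y ≟ᶠ b)) ∨ (does (x ≟ᶠ b) ∧ does (y ≟ᶠ a))

SaturatingSeq : ∀ {k n} → Graph k → Graph n → List (Fin n × Fin n) → Set
SaturatingSeq F G [] = ⊤
SaturatingSeq F G ((a , b) ∷ es) =
  ContainsWithEdge F (addEdge a b G) a b × SaturatingSeq F (addEdge a b G) es

EnumeratesNonEdges : ∀ {n} → Graph n → List (Fin n × Fin n) → Set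
EnumeratesNonEdges {n} G es =
  Unique es
  × All (λ e → toℕ (Data.Product.proj₁ e) < toℕ (Data.Product.proj₂ e)) es
  × (∀ (a b : Fin n) → toℕ a < toℕ b → ((G a b ≡ false) ⇔ ((a , b) ∈ es)))

WeaklySaturated : ∀ {k} n → Graph k → Graph n → Set
WeaklySaturated n F G =
  IsSimple G × ¬ Contains F G
  × ∃[ es ] (EnumeratesNonEdges G es × SaturatingSeq F G es)

IsWsat : ∀ {k} → ℕ → Graph k → ℕ → Set
IsWsat n F w =
  (∃[ G ] (WeaklySaturated n F G × edgeCount G ≡ w))
  × (∀ G → WeaklySaturated n F G → w ≤ edgeCount G)

K : (s t : ℕ) → Graph (s + t)
K s t x y = (toℕ x <ᵇ s) xor (toℕ y <ᵇ s)

{-# OPTIONS --safe #-}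
-- Pass to the complement H of the graph on n = s + t + 1 vertices.  An edge ab of H may be deleted exactly
-- when some vertex v and some partition S ⊎ T of the remaining vertices with ∣ S ∣ = s and ∣ T ∣ = t separate
-- a from b, ab being the only edge of H between S and T.  One asks for the largest H that can be dismantled.
--
-- Upper bound on H.  A dismantlable H satisfies Laman's condition: W spans at most 2 ∣ W ∣ - 3 edges.  Suppose
-- H has 2 n - 3 edges.  Whenever an edge of a tight set W with at least three vertices is deleted, v lies in W
-- and W falls apart into two tight sets that share v.  Hence H falls apart like a tree of tight blocks, and
-- the sizes s and t are so restrictive that it always has one of three shapes, none of which is edgeless:  a core with
-- blocks of s + 1 vertices hanging on it;  blocks of at most s + 1 vertices, all through one vertex, where they
-- are stuck once they are single edges;  two vertices p, q carrying blocks of s + 1 vertices, only one at p.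
--
-- Construction.  Join s vertices spanning 2 s - 3 edges by two edges to the fan over a path with t vertices.
-- Once the two edges are gone, deleting the hub of the fan allows to cut the path at the positions
-- s, 2 s, 3 s, … modulo t, which are all positions if gcd s t = 1.  If the first edge of the path is left out,
-- then the other positions can be cut for every s < t.  The spokes and then the s vertices are easy.
--
-- K s t is not contained in the complement of a largest H, since an edge between its classes could be added to H.
module Submission where

open import Defs
open import Data.Nat using (ℕ; _+_; _*_; _∸_; _<_; _≤_)
open import Data.Nat.GCD using (gcd)
open import Data.Nat.Combinatorics using (_C_)
open import Data.Product using (_×_; ∃-syntax)
open import Relation.Binary.PropositionalEquality using (_≡_)

open import Data.Bool using (true; false; not; _∧_; if_then_else_) renaming (T to IsTrue)
open import Data.Bool.Properties using (∨-zeroʳ)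
open import Data.Empty using (⊥-elim) renaming (⊥ to False)
open import Data.Fin using (Fin; zero; suc; toℕ; fromℕ<; _↑ˡ_; _↑ʳ_; splitAt)
open import Data.Fin.Properties
  using (_≟_; any?; all?; toℕ-fromℕ<; toℕ-injective; toℕ-↑ˡ; toℕ-↑ʳ; toℕ<n; join-splitAt;
    splitAt-↑ˡ; splitAt-↑ʳ; ↑ˡ-injective; ↑ʳ-injective)
  renaming (suc-injective to fsuc-injective)
open import Data.Fin.Subset
open import Data.Fin.Subset.Properties
open import Data.List using (List; []; _∷_; length; map; allFin; tabulate)
open import Data.List.Membership.Propositional using () renaming (_∈_ to _∈ˡ_; _∉_ to _∉ˡ_)
open import Data.List.Membership.Propositional.Properties using (∈-map⁻)
open import Data.List.Properties using (length-map; map-tabulate)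
open import Data.List.Relation.Unary.All using (All; []; _∷_; lookup) renaming (tabulate to tabulateᴬ)
import Data.List.Relation.Unary.All as All
open import Data.List.Relation.Unary.AllPairs using ([]; _∷_)
open import Data.List.Relation.Unary.Any using (here; there)
open import Data.List.Relation.Unary.Unique.Propositional using (Unique)
open import Data.Nat hiding (_≟_)
open import Data.Nat.Combinatorics using (nCk+nC[k+1]≡[n+1]C[k+1]; nC1≡n)
open import Data.Nat.Coprimality using (Coprime; coprime-divisor; gcd≡1⇒coprime) renaming (sym to coprime-sym)
open import Data.Nat.DivMod using (_mod_; m<n⇒m%n≡m)
open import Data.Nat.Divisibility using (_∣_; divides; ∣⇒≤)
open import Data.Nat.ListAction using (sum)
open import Data.Nat.Properties hiding (_≟_)
open import Data.Nat.Properties using () renaming (_≟_ to _≟ⁿ_)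
open import Data.Nat.Tactic.RingSolver using (solve-∀)
open import Data.Product using (Σ; _,_; proj₁; proj₂)
open import Data.Product.Properties using (≡-dec)
open import Data.Sum using (_⊎_; inj₁; inj₂; [_,_]′; swap)
open import Data.Unit using (tt) renaming (⊤ to Unit)
open import Data.Vec using ([]; _∷_; here; there)
open import Function using (_∘_; id)
open import Function.Bundles using (mk⇔; Equivalence)
open import Function.Definitions using (Injective)
open import Relation.Nullary using (¬_; Dec; yes; no; does; contradiction)
open import Relation.Nullary.Decidable using (decidable-stable; ¬?; _×-dec_; _⊎-dec_; map′; dec-true; dec-false; does-⇔)
open import Relation.Unary using (Decidable)
open import Relation.Binary.PropositionalEquality

private variable
  n : ℕ

Edge : ℕ → Set
Edge n = Fin n × Fin n

-- Cardinalities of vertex sets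

x∈p─q⇒x∈p∧x∉q : ∀ {x : Fin n} (p q : Subset n) → x ∈ p ─ q → x ∈ p × x ∉ q
x∈p─q⇒x∈p∧x∉q p q x∈ = p─q⊆p p q x∈ , λ x∈q → go p q x∈ x∈q
  where
  go : ∀ {n} {x : Fin n} (p q : Subset n) → x ∈ p ─ q → x ∉ q
  go (_ ∷ p) (inside ∷ q) () here
  go (_ ∷ p) (_ ∷ q) (there x∈) (there x∈q) = go p q x∈ x∈q

∣p∪q∣+∣p∩q∣≡∣p∣+∣q∣ : ∀ (p q : Subset n) → ∣ p ∪ q ∣ + ∣ p ∩ q ∣ ≡ ∣ p ∣ + ∣ q ∣
∣p∪q∣+∣p∩q∣≡∣p∣+∣q∣ []            []            = refl
∣p∪q∣+∣p∩q∣≡∣p∣+∣q∣ (inside ∷ p)  (inside ∷ q)  =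
  cong suc (trans (+-suc _ _) (trans (cong suc (∣p∪q∣+∣p∩q∣≡∣p∣+∣q∣ p q)) (sym (+-suc _ _))))
∣p∪q∣+∣p∩q∣≡∣p∣+∣q∣ (inside ∷ p)  (outside ∷ q) = cong suc (∣p∪q∣+∣p∩q∣≡∣p∣+∣q∣ p q)
∣p∪q∣+∣p∩q∣≡∣p∣+∣q∣ (outside ∷ p) (inside ∷ q)  =
  trans (cong suc (∣p∪q∣+∣p∩q∣≡∣p∣+∣q∣ p q)) (sym (+-suc _ _))
∣p∪q∣+∣p∩q∣≡∣p∣+∣q∣ (outside ∷ p) (outside ∷ q) = ∣p∪q∣+∣p∩q∣≡∣p∣+∣q∣ p q

∣p⊎q∣≡∣p∣+∣q∣ : ∀ (p q : Subset n) → (∀ {x} → x ∈ p → x ∉ q) → ∣ p ∪ q ∣ ≡ ∣ p ∣ + ∣ q ∣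
∣p⊎q∣≡∣p∣+∣q∣ {n} p q disjoint = begin
  ∣ p ∪ q ∣                  ≡⟨ +-identityʳ _ ⟨
  ∣ p ∪ q ∣ + 0              ≡⟨ cong (∣ p ∪ q ∣ +_) (∣⊥∣≡0 n) ⟨
  ∣ p ∪ q ∣ + ∣ ⊥ {n} ∣      ≡⟨ cong (λ r → ∣ p ∪ q ∣ + ∣ r ∣) (Empty-unique empty) ⟨
  ∣ p ∪ q ∣ + ∣ p ∩ q ∣      ≡⟨ ∣p∪q∣+∣p∩q∣≡∣p∣+∣q∣ p q ⟩
  ∣ p ∣ + ∣ q ∣              ∎
  where
  open ≡-Reasoning
  empty : Empty (p ∩ q)
  empty (x , x∈) = let x∈p , x∈q = x∈p∩q⁻ p q x∈ in disjoint x∈p x∈q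

∣p∪⁅x⁆∣≡1+∣p∣ : ∀ {p : Subset n} {x} → x ∉ p → ∣ p ∪ ⁅ x ⁆ ∣ ≡ suc ∣ p ∣
∣p∪⁅x⁆∣≡1+∣p∣ {p = p} {x} x∉p = begin
  ∣ p ∪ ⁅ x ⁆ ∣      ≡⟨ ∣p⊎q∣≡∣p∣+∣q∣ p ⁅ x ⁆ (λ y∈p y∈x → x∉p (subst (_∈ p) (x∈⁅y⁆⇒x≡y x y∈x) y∈p)) ⟩
  ∣ p ∣ + ∣ ⁅ x ⁆ ∣  ≡⟨ cong (∣ p ∣ +_) (∣⁅x⁆∣≡1 x) ⟩
  ∣ p ∣ + 1          ≡⟨ +-comm _ 1 ⟩
  suc ∣ p ∣          ∎
  where open ≡-Reasoning

∈-∪⁅⁆ : ∀ {p : Subset n} {x} → x ∈ p ∪ ⁅ x ⁆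
∈-∪⁅⁆ {p = p} {x} = x∈p∪q⁺ {p = p} (inj₂ (x∈⁅x⁆ x))

∈-∪⁅⁆⁻ : ∀ {p : Subset n} {x y} → y ∈ p ∪ ⁅ x ⁆ → y ∈ p ⊎ y ≡ x
∈-∪⁅⁆⁻ {p = p} {x} y∈ with x∈p∪q⁻ p ⁅ x ⁆ y∈
... | inj₁ y∈p = inj₁ y∈p
... | inj₂ y∈x = inj₂ (x∈⁅y⁆⇒x≡y x y∈x)

∈-∪ˡ : ∀ {p q : Subset n} {y} → y ∈ p → y ∈ p ∪ q
∈-∪ˡ y∈p = x∈p∪q⁺ (inj₁ y∈p)

x∈p⇒1≤∣p∣ : ∀ {p : Subset n} {x} → x ∈ p → 1 ≤ ∣ p ∣
x∈p⇒1≤∣p∣ {p = p} {x} x∈p = subst (_≤ ∣ p ∣) (∣⁅x⁆∣≡1 x)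
  (p⊆q⇒∣p∣≤∣q∣ (λ y∈ → subst (_∈ p) (sym (x∈⁅y⁆⇒x≡y x y∈)) x∈p))

distinct⇒2≤∣p∣ : ∀ {p : Subset n} {x y} → x ∈ p → y ∈ p → x ≢ y → 2 ≤ ∣ p ∣
distinct⇒2≤∣p∣ {p = p} {x} {y} x∈p y∈p x≢y = subst (λ k → suc k ≤ ∣ p ∣) (∣⁅x⁆∣≡1 x)
  (p⊂q⇒∣p∣<∣q∣ ((λ z∈ → subst (_∈ p) (sym (x∈⁅y⁆⇒x≡y x z∈)) x∈p) , y , y∈p , λ y∈ → x≢y (sym (x∈⁅y⁆⇒x≡y x y∈))))

2≤∣p∣⇒other : ∀ (p : Subset n) x → 2 ≤ ∣ p ∣ → ∃[ y ] (y ∈ p × y ≢ x)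
2≤∣p∣⇒other p x 2≤ with nonempty? (p ─ ⁅ x ⁆)
... | yes (y , y∈) = let y∈p , y∉ = x∈p─q⇒x∈p∧x∉q p ⁅ x ⁆ y∈ in y , y∈p , x∉⁅y⁆⇒x≢y y∉
... | no empty = contradiction (≤-trans 2≤ (subst (∣ p ∣ ≤_) (∣⁅x⁆∣≡1 x) (p⊆q⇒∣p∣≤∣q∣ p⊆x))) (λ { (s≤s ()) })
  where
  p⊆x : p ⊆ ⁅ x ⁆
  p⊆x {y} y∈p with y ∈? ⁅ x ⁆
  ... | yes y∈ = y∈
  ... | no y∉ = contradiction (y , x∈p∧x∉q⇒x∈p─q y∈p y∉) empty

-- Edges spanned by a vertex set

inside? : (W : Subset n) → Decidable (λ ((a , b) : Edge n) → a ∈ W × b ∈ W)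
inside? W (a , b) = (a ∈? W) ×-dec (b ∈? W)

#_ : ∀ {A : Set} → Dec A → ℕ
# yes _ = 1
# no _  = 0

-- Repeated pairs count separately, so the Laman bound on two-element sets also excludes double
-- edges.
e[_] : Subset n → List (Edge n) → ℕ
e[ W ] []       = 0
e[ W ] (x ∷ es) = # inside? W x + e[ W ] es

e-in : ∀ {W : Subset n} {a b} es → a ∈ W → b ∈ W → e[ W ] ((a , b) ∷ es) ≡ suc (e[ W ] es)
e-in {W = W} {a} {b} es a∈W b∈W with inside? W (a , b)
... | yes _ = refl
... | no ¬in = contradiction (a∈W , b∈W) ¬in

e-out : ∀ {W : Subset n} {a b} es → ¬ (a ∈ W × b ∈ W) → e[ W ] ((a , b) ∷ es) ≡ e[ W ] es
e-out {W = W} {a} {b} es ¬in with inside? W (a , b)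
... | yes in′ = contradiction in′ ¬in
... | no _ = refl

e-mem : ∀ {W : Subset n} {a b} {es} → (a , b) ∈ˡ es → a ∈ W → b ∈ W → 1 ≤ e[ W ] es
e-mem {W = W} {es = x ∷ es} (here refl) a∈W b∈W = ≤-trans (s≤s z≤n) (≤-reflexive (sym (e-in es a∈W b∈W)))
e-mem {W = W} {es = x ∷ es} (there e∈) a∈W b∈W = ≤-trans (e-mem e∈ a∈W b∈W) (m≤n+m _ (# inside? W x))

-- Laman sparsity

-- This is a copy of a complete bipartite graph in the complement of `es`, with classes `P` and `Q`
-- and one vertex left over. The sizes are left out, so that a fact proved for one side transfers to
-- the other by `flip-sep`.
record Separation (v : Fin n) (P Q : Subset n) (es : List (Edge n)) : Set where
  field
    v∉P      : v ∉ P
    v∉Q      : v ∉ Q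
    disjoint : ∀ {x} → x ∈ P → x ∉ Q
    cover    : ∀ {x} → x ≢ v → x ∈ P ⊎ x ∈ Q
    free     : ∀ {x y} → (x , y) ∈ˡ es → ¬ (x ∈ P × y ∈ Q ⊎ x ∈ Q × y ∈ P)
open Separation

Crosses : Subset n → Subset n → Fin n → Fin n → Set
Crosses P Q a b = a ∈ P × b ∈ Q ⊎ a ∈ Q × b ∈ P

ends : ∀ {P Q W : Subset n} {a b} → Crosses P Q a b → a ∈ W → b ∈ W →
       ∃[ x ] ∃[ y ] (x ∈ W × x ∈ P × y ∈ W × y ∈ Q)
ends {a = a} {b} (inj₁ (a∈P , b∈Q)) a∈W b∈W = a , b , a∈W , a∈P , b∈W , b∈Q
ends {a = a} {b} (inj₂ (a∈Q , b∈P)) a∈W b∈W = b , a , b∈W , b∈P , a∈W , a∈Q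

flip-sep : ∀ {v} {P Q : Subset n} {es} → Separation v P Q es → Separation v Q P es
flip-sep sep = record
  { v∉P = sep .v∉Q ; v∉Q = sep .v∉P ; disjoint = λ x∈Q x∈P → sep .disjoint x∈P x∈Q
  ; cover = swap ∘ sep .cover ; free = λ e∈ → sep .free e∈ ∘ swap }

swap-crosses : ∀ {P Q : Subset n} {a b} → Crosses P Q a b → Crosses P Q b a
swap-crosses (inj₁ (p , q)) = inj₂ (q , p)
swap-crosses (inj₂ (q , p)) = inj₁ (p , q)

crosses⇒≢ : ∀ {v} {P Q : Subset n} {es a b} → Separation v P Q es → Crosses P Q a b → a ≢ b
crosses⇒≢ sep (inj₁ (a∈P , a∈Q)) refl = sep .disjoint a∈P a∈Q
crosses⇒≢ sep (inj₂ (a∈Q , a∈P)) refl = sep .disjoint a∈P a∈Q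

tail-sep : ∀ {v} {P Q : Subset n} {e es} → Separation v P Q (e ∷ es) → Separation v P Q es
tail-sep sep = record
  { v∉P = sep .v∉P ; v∉Q = sep .v∉Q ; disjoint = sep .disjoint
  ; cover = sep .cover ; free = sep .free ∘ there }

≢v : ∀ {v} {P Q : Subset n} {es} → Separation v P Q es → ∀ {x} → x ∈ P → x ≢ v
≢v sep x∈P refl = sep .v∉P x∈P

part : Subset n → Subset n → Fin n → Subset n
part W P v = W ∩ (P ∪ ⁅ v ⁆)

part⁺ : ∀ {W P : Subset n} {v x} → x ∈ W → x ∈ P ⊎ x ≡ v → x ∈ part W P v
part⁺ {P = P} {v} x∈W h = x∈p∩q⁺ (x∈W , x∈p∪q⁺ {p = P} (Data.Sum.map₂ (λ { refl → x∈⁅x⁆ v }) h))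

part⁻ : ∀ {W P : Subset n} {v x} → x ∈ part W P v → x ∈ W × (x ∈ P ⊎ x ≡ v)
part⁻ {W = W} {P} {v} x∈ = let x∈W , h = x∈p∩q⁻ W (P ∪ ⁅ v ⁆) x∈ in x∈W , ∈-∪⁅⁆⁻ h

module _ {v : Fin n} {P Q : Subset n} where

  classify : ∀ {es} → Separation v P Q es → ∀ x → x ≡ v ⊎ x ∈ P ⊎ x ∈ Q
  classify sep x with x ≟ v
  ... | yes x≡v = inj₁ x≡v
  ... | no x≢v = inj₂ (sep .cover x≢v)

  -- `P`, `Q` and `v` partition the vertices, so the two parts have union `W` and meet in
  -- `W ∩ ⁅ v ⁆`; inclusion-exclusion does the rest.
  ∣parts∣ : ∀ {es} → Separation v P Q es → (W : Subset n) →
            ∣ part W P v ∣ + ∣ part W Q v ∣ ≡ ∣ W ∣ + ∣ W ∩ ⁅ v ⁆ ∣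
  ∣parts∣ sep W = trans (sym (∣p∪q∣+∣p∩q∣≡∣p∣+∣q∣ (part W P v) (part W Q v)))
                        (cong₂ (λ p q → ∣ p ∣ + ∣ q ∣) (⊆-antisym ∪⊆ ⊆∪) (⊆-antisym ∩⊆ ⊆∩))
    where
    ∪⊆ : part W P v ∪ part W Q v ⊆ W
    ∪⊆ x∈ with x∈p∪q⁻ (part W P v) (part W Q v) x∈
    ... | inj₁ h = proj₁ (part⁻ {P = P} h)
    ... | inj₂ h = proj₁ (part⁻ {P = Q} h)
    ⊆∪ : W ⊆ part W P v ∪ part W Q v
    ⊆∪ {x} x∈W with classify sep x
    ... | inj₁ x≡v = ∈-∪ˡ (part⁺ x∈W (inj₂ x≡v))
    ... | inj₂ (inj₁ x∈P) = ∈-∪ˡ (part⁺ x∈W (inj₁ x∈P))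
    ... | inj₂ (inj₂ x∈Q) = x∈p∪q⁺ {p = part W P v} (inj₂ (part⁺ x∈W (inj₁ x∈Q)))
    ∩⊆ : part W P v ∩ part W Q v ⊆ W ∩ ⁅ v ⁆
    ∩⊆ x∈ with x∈p∩q⁻ (part W P v) (part W Q v) x∈
    ... | hP , hQ with part⁻ {P = P} hP | part⁻ {P = Q} hQ
    ... | x∈W , inj₂ refl | _ = x∈p∩q⁺ (x∈W , x∈⁅x⁆ v)
    ... | x∈W , inj₁ _ | _ , inj₂ refl = x∈p∩q⁺ (x∈W , x∈⁅x⁆ v)
    ... | x∈W , inj₁ x∈P | _ , inj₁ x∈Q = contradiction x∈Q (sep .disjoint x∈P)
    ⊆∩ : W ∩ ⁅ v ⁆ ⊆ part W P v ∩ part W Q v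
    ⊆∩ x∈ = let x∈W , x∈v = x∈p∩q⁻ W ⁅ v ⁆ x∈ ; x≡v = x∈⁅y⁆⇒x≡y v x∈v in
             x∈p∩q⁺ (part⁺ x∈W (inj₂ x≡v) , part⁺ x∈W (inj₂ x≡v))

  ∣parts∣-v∈ : ∀ {es} → Separation v P Q es → ∀ {W} → v ∈ W →
              ∣ part W P v ∣ + ∣ part W Q v ∣ ≡ suc ∣ W ∣
  ∣parts∣-v∈ sep {W} v∈W = trans (∣parts∣ sep W) (trans (cong (∣ W ∣ +_)
    (trans (cong ∣_∣ (⊆-antisym (proj₂ ∘ x∈p∩q⁻ W ⁅ v ⁆)
      (λ x∈ → x∈p∩q⁺ (subst (_∈ W) (sym (x∈⁅y⁆⇒x≡y v x∈)) v∈W , x∈)))) (∣⁅x⁆∣≡1 v))) (+-comm _ 1))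

  ∣parts∣-v∉ : ∀ {es} → Separation v P Q es → ∀ {W} → v ∉ W →
              ∣ part W P v ∣ + ∣ part W Q v ∣ ≡ ∣ W ∣
  ∣parts∣-v∉ sep {W} v∉W = trans (∣parts∣ sep W) (trans (cong (∣ W ∣ +_)
    (trans (cong ∣_∣ (Empty-unique λ (x , x∈) → let x∈W , x∈v = x∈p∩q⁻ W ⁅ v ⁆ x∈ in
      v∉W (subst (_∈ W) (x∈⁅y⁆⇒x≡y v x∈v) x∈W))) (∣⊥∣≡0 n))) (+-identityʳ _))

  -- An edge inside `W` but inside neither part would join `P` to `Q`, against `free`. Equality may
  -- fail for loops at `v`, which both parts count.
  e-parts : ∀ {es} → Separation v P Q es → ∀ W → e[ W ] es ≤ e[ part W P v ] es + e[ part W Q v ] es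
  e-parts {[]} sep W = z≤n
  e-parts {(a , b) ∷ es} sep W
    with ih ← e-parts (tail-sep sep) W | inside? W (a , b) | inside? (part W P v) (a , b) | inside? (part W Q v) (a , b)
  ... | no _ | no _ | no _ = ih
  ... | no _ | yes _ | no _ = m≤n⇒m≤1+n ih
  ... | no _ | no _ | yes _ = ≤-trans ih (+-monoʳ-≤ _ (n≤1+n _))
  ... | no _ | yes _ | yes _ = m≤n⇒m≤1+n (≤-trans ih (+-monoʳ-≤ _ (n≤1+n _)))
  ... | yes _ | yes _ | no _ = s≤s ih
  ... | yes _ | no _ | yes _ = ≤-trans (s≤s ih) (≤-reflexive (sym (+-suc _ _)))
  ... | yes _ | yes _ | yes _ = s≤s (≤-trans ih (+-monoʳ-≤ _ (n≤1+n _)))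
  ... | yes (a∈W , b∈W) | no ¬P | no ¬Q with classify sep a | classify sep b
  ... | inj₁ a≡v | inj₁ b≡v = contradiction (part⁺ a∈W (inj₂ a≡v) , part⁺ b∈W (inj₂ b≡v)) ¬P
  ... | inj₁ a≡v | inj₂ (inj₁ b∈) = contradiction (part⁺ a∈W (inj₂ a≡v) , part⁺ b∈W (inj₁ b∈)) ¬P
  ... | inj₁ a≡v | inj₂ (inj₂ b∈) = contradiction (part⁺ a∈W (inj₂ a≡v) , part⁺ b∈W (inj₁ b∈)) ¬Q
  ... | inj₂ (inj₁ a∈) | inj₁ b≡v = contradiction (part⁺ a∈W (inj₁ a∈) , part⁺ b∈W (inj₂ b≡v)) ¬P
  ... | inj₂ (inj₂ a∈) | inj₁ b≡v = contradiction (part⁺ a∈W (inj₁ a∈) , part⁺ b∈W (inj₂ b≡v)) ¬Q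
  ... | inj₂ (inj₁ a∈) | inj₂ (inj₁ b∈) = contradiction (part⁺ a∈W (inj₁ a∈) , part⁺ b∈W (inj₁ b∈)) ¬P
  ... | inj₂ (inj₂ a∈) | inj₂ (inj₂ b∈) = contradiction (part⁺ a∈W (inj₁ a∈) , part⁺ b∈W (inj₁ b∈)) ¬Q
  ... | inj₂ (inj₁ a∈) | inj₂ (inj₂ b∈) = contradiction (inj₁ (a∈ , b∈)) (sep .free (here refl))
  ... | inj₂ (inj₂ a∈) | inj₂ (inj₁ b∈) = contradiction (inj₂ (a∈ , b∈)) (sep .free (here refl))

private
  -- The two Laman bounds lose 3 + 3; counting `v` in both parts gives back 2, which leaves a
  -- deficit of 4.
  bound-v∈ : ∀ {e e₁ e₂ p q w} → e ≤ e₁ + e₂ → 3 + e₁ ≤ 2 * p → 3 + e₂ ≤ 2 * q →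
             p + q ≡ suc w → 4 + e ≤ 2 * w
  bound-v∈ {e} {e₁} {e₂} {p} {q} {w} e≤ h₁ h₂ eq = +-cancelˡ-≤ 2 _ _ (begin
    6 + e                  ≤⟨ +-monoʳ-≤ 6 e≤ ⟩
    6 + (e₁ + e₂)          ≡⟨ lhs e₁ e₂ ⟩
    (3 + e₁) + (3 + e₂)    ≤⟨ +-mono-≤ h₁ h₂ ⟩
    2 * p + 2 * q          ≡⟨ *-distribˡ-+ 2 p q ⟨
    2 * (p + q)            ≡⟨ cong (2 *_) eq ⟩
    2 * suc w              ≡⟨ *-suc 2 w ⟩
    2 + 2 * w              ∎)
    where
    open ≤-Reasoning
    lhs : ∀ x y → 6 + (x + y) ≡ (3 + x) + (3 + y)
    lhs = solve-∀

  -- The deficits `k` and `l` add up: 2 for a nonempty set, 3 for a set of at least two vertices, 4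
  -- if such a set is not tight.
  bound-v∉ : ∀ {e e₁ e₂ p q w} k l → e ≤ e₁ + e₂ → k + e₁ ≤ 2 * p → l + e₂ ≤ 2 * q →
             p + q ≡ w → k + l + e ≤ 2 * w
  bound-v∉ {e} {e₁} {e₂} {p} {q} {w} k l e≤ h₁ h₂ eq = begin
    k + l + e              ≤⟨ +-monoʳ-≤ (k + l) e≤ ⟩
    k + l + (e₁ + e₂)      ≡⟨ lhs k l e₁ e₂ ⟩
    (k + e₁) + (l + e₂)    ≤⟨ +-mono-≤ h₁ h₂ ⟩
    2 * p + 2 * q          ≡⟨ *-distribˡ-+ 2 p q ⟨
    2 * (p + q)            ≡⟨ cong (2 *_) eq ⟩
    2 * w                  ∎
    where
    open ≤-Reasoning
    lhs : ∀ k l x y → k + l + (x + y) ≡ (k + x) + (l + y)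
    lhs = solve-∀

-- Laman's condition; the bound for one-element sets excludes loops and spares a case distinction.
Sparse : List (Edge n) → Set
Sparse es = ∀ W → (1 ≤ ∣ W ∣ → 2 + e[ W ] es ≤ 2 * ∣ W ∣) × (2 ≤ ∣ W ∣ → 3 + e[ W ] es ≤ 2 * ∣ W ∣)

Tight : List (Edge n) → Subset n → Set
Tight es W = 2 ≤ ∣ W ∣ × 3 + e[ W ] es ≡ 2 * ∣ W ∣

Sparse-[] : Sparse {n} []
Sparse-[] W = *-monoʳ-≤ 2 , λ 2≤ → ≤-trans (n≤1+n 3) (*-monoʳ-≤ 2 2≤)

sparse⇒no-loop : ∀ {es : List (Edge n)} {x y} → Sparse es → (x , y) ∈ˡ es → x ≢ y
sparse⇒no-loop {es = es} {x} sparse e∈ refl = <-irrefl refl (≤-trans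
  (+-monoʳ-≤ 2 (e-mem e∈ (x∈⁅x⁆ x) (x∈⁅x⁆ x)))
  (subst (λ k → 2 + e[ ⁅ x ⁆ ] es ≤ 2 * k) (∣⁅x⁆∣≡1 x) (proj₁ (sparse ⁅ x ⁆) (≤-reflexive (sym (∣⁅x⁆∣≡1 x))))))

tight-tail : ∀ {es : List (Edge n)} {W a b} → ¬ (a ∈ W × b ∈ W) → Tight ((a , b) ∷ es) W → Tight es W
tight-tail {es = es} ¬in (2≤ , eq) = 2≤ , trans (cong (3 +_) (sym (e-out es ¬in))) eq

module _ {v : Fin n} {P Q : Subset n} {es : List (Edge n)} (sparse : Sparse es) (sep : Separation v P Q es) where

  -- If `v ∈ W`, both parts have at least two vertices and the bound with 3 applies to them;
  -- otherwise both are nonempty and the bound with 2 does. Either way `W` misses tightness by at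
  -- least one edge.
  separated-bound : ∀ {W x y} → x ∈ W → x ∈ P → y ∈ W → y ∈ Q → 4 + e[ W ] es ≤ 2 * ∣ W ∣
  separated-bound {W} {x} {y} x∈W x∈P y∈W y∈Q with v ∈? W
  ... | yes v∈W = bound-v∈ {p = ∣ part W P v ∣} (e-parts sep W)
    (proj₂ (sparse (part W P v)) (distinct⇒2≤∣p∣ (part⁺ x∈W (inj₁ x∈P)) (part⁺ v∈W (inj₂ refl)) (≢v sep x∈P)))
    (proj₂ (sparse (part W Q v)) (distinct⇒2≤∣p∣ (part⁺ y∈W (inj₁ y∈Q)) (part⁺ v∈W (inj₂ refl)) (≢v (flip-sep sep) y∈Q)))
    (∣parts∣-v∈ sep v∈W)
  ... | no v∉W = bound-v∉ {p = ∣ part W P v ∣} 2 2 (e-parts sep W)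
    (proj₁ (sparse (part W P v)) (x∈p⇒1≤∣p∣ (part⁺ x∈W (inj₁ x∈P))))
    (proj₁ (sparse (part W Q v)) (x∈p⇒1≤∣p∣ (part⁺ y∈W (inj₁ y∈Q))))
    (∣parts∣-v∉ sep v∉W)

  tight⇒one-sided : ∀ {W x y} → Tight es W → x ∈ W → x ∈ P → y ∈ W → y ∉ Q
  tight⇒one-sided {W} (_ , eq) x∈W x∈P y∈W y∈Q =
    <-irrefl refl (subst (4 + e[ W ] es ≤_) (sym eq) (separated-bound x∈W x∈P y∈W y∈Q))

  tight⇒follows : ∀ {W x y} → Tight es W → x ∈ W → x ∈ P → y ∈ W → y ≢ v → y ∈ P
  tight⇒follows tight x∈W x∈P y∈W y≢v with sep .cover y≢v
  ... | inj₁ y∈P = y∈P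
  ... | inj₂ y∈Q = contradiction y∈Q (tight⇒one-sided tight x∈W x∈P y∈W)

  module _ {a b} (cross : Crosses P Q a b) where

    crosses-bound : ∀ {W} → a ∈ W → b ∈ W → 4 + e[ W ] es ≤ 2 * ∣ W ∣
    crosses-bound a∈W b∈W = let _ , _ , x∈W , x∈P , y∈W , y∈Q = ends cross a∈W b∈W in
      separated-bound x∈W x∈P y∈W y∈Q

    -- Only sets containing both `a` and `b` gain an edge, and by `crosses-bound` these had room for
    -- it. Thus Laman's condition builds up from the end of a dismantling.
    Sparse-∷ : Sparse ((a , b) ∷ es)
    Sparse-∷ W with inside? W (a , b)
    ... | no _ = sparse W
    ... | yes (a∈W , b∈W) = (λ _ → ≤-trans (n≤1+n _) bound) , λ _ → bound
      where
      bound : 4 + e[ W ] es ≤ 2 * ∣ W ∣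
      bound = crosses-bound a∈W b∈W

    module _ {W} (a∈W : a ∈ W) (b∈W : b ∈ W) (tight : Tight ((a , b) ∷ es) W) where

      private
        -- So `W` attains `separated-bound` with equality, and any further deficit is a
        -- contradiction.
        eq : 4 + e[ W ] es ≡ 2 * ∣ W ∣
        eq = trans (cong (3 +_) (sym (e-in es a∈W b∈W))) (proj₂ tight)

        end : ∃[ x ] ∃[ y ] (x ∈ W × x ∈ P × y ∈ W × y ∈ Q)
        end = ends cross a∈W b∈W

      -- If `v ∉ W`, the parts partition `W`, so one of them has at least two vertices and
      -- contributes 3 instead of 2: a deficit of 5.
      tight⇒v∈ : 3 ≤ ∣ W ∣ → v ∈ W
      tight⇒v∈ 3≤ with v ∈? W
      ... | yes v∈W = v∈W
      ... | no v∉W = ⊥-elim (<-irrefl refl (subst (5 + e[ W ] es ≤_) (sym eq) bound))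
        where
        p = ∣ part W P v ∣
        q = ∣ part W Q v ∣
        p+q≡ : p + q ≡ ∣ W ∣
        p+q≡ = ∣parts∣-v∉ sep v∉W
        1≤p : 1 ≤ p
        1≤p = let _ , _ , x∈W , x∈P , _ = end in x∈p⇒1≤∣p∣ (part⁺ x∈W (inj₁ x∈P))
        1≤q : 1 ≤ q
        1≤q = let _ , _ , _ , _ , y∈W , y∈Q = end in x∈p⇒1≤∣p∣ (part⁺ y∈W (inj₁ y∈Q))
        bound : 5 + e[ W ] es ≤ 2 * ∣ W ∣
        bound with 2 ≤? p
        ... | yes 2≤p = bound-v∉ {p = p} 3 2 (e-parts sep W) (proj₂ (sparse _) 2≤p) (proj₁ (sparse _) 1≤q) p+q≡
        ... | no 2≰p = bound-v∉ {p = p} 2 3 (e-parts sep W) (proj₁ (sparse _) 1≤p)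
          (proj₂ (sparse _) (+-cancelˡ-≤ 1 _ _ (≤-trans 3≤ (≤-trans (≤-reflexive (sym p+q≡)) (+-monoˡ-≤ q (≤-pred (≰⇒> 2≰p)))))))
          p+q≡

      -- A part that is not tight would contribute 4; with 3 from the other part and 2 given back
      -- for the shared `v`, the deficit would be 5.
      tight-part : v ∈ W → Tight es (part W P v)
      tight-part v∈W with 3 + e[ part W P v ] es ≟ⁿ 2 * ∣ part W P v ∣
      ... | yes eq-P = 2≤p , eq-P
        where
        2≤p : 2 ≤ ∣ part W P v ∣
        2≤p = let _ , _ , x∈W , x∈P , _ = end in distinct⇒2≤∣p∣ (part⁺ x∈W (inj₁ x∈P)) (part⁺ v∈W (inj₂ refl)) (≢v sep x∈P)
      ... | no neq = ⊥-elim (<-irrefl refl (subst (5 + e[ W ] es ≤_) (sym eq) bound))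
        where
        bound : 5 + e[ W ] es ≤ 2 * ∣ W ∣
        bound = let x , y , x∈W , x∈P , y∈W , y∈Q = end in
          +-cancelˡ-≤ 2 _ _ (≤-trans (bound-v∉ {p = ∣ part W P v ∣} 4 3 (e-parts sep W)
            (≤∧≢⇒< (proj₂ (sparse _) (distinct⇒2≤∣p∣ (part⁺ x∈W (inj₁ x∈P)) (part⁺ v∈W (inj₂ refl)) (≢v sep x∈P))) neq)
            (proj₂ (sparse _) (distinct⇒2≤∣p∣ (part⁺ y∈W (inj₁ y∈Q)) (part⁺ v∈W (inj₂ refl)) (≢v (flip-sep sep) y∈Q)))
            (∣parts∣-v∈ sep v∈W)) (≤-reflexive (*-suc 2 _)))

-- A tree of tight blocks: the vertices outside Core are partitioned into leaves, Λ x being the leaf of x ∉ Core,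
-- and Λ x is completed to a block by its hinge η x ∈ Core.  Λ and η are junk on Core.
record Leaves {n} (es : List (Edge n)) (Core : Subset n) : Set where
  field
    Λ        : Fin n → Subset n
    η        : Fin n → Fin n
    self     : ∀ {x} → x ∉ Core → x ∈ Λ x
    off      : ∀ {x y} → x ∉ Core → y ∈ Λ x → y ∉ Core
    same     : ∀ {x y} → x ∉ Core → y ∈ Λ x → Λ y ≡ Λ x
    η-same   : ∀ {x y} → x ∉ Core → y ∈ Λ x → η y ≡ η x
    η∈       : ∀ {x} → x ∉ Core → η x ∈ Core

  Λ⁺ : Fin n → Subset n
  Λ⁺ x = Λ x ∪ ⁅ η x ⁆

  field
    tight    : ∀ {x} → x ∉ Core → Tight es (Λ⁺ x)
    covers   : ∀ {a b} → (a , b) ∈ˡ es → (a ∈ Core × b ∈ Core) ⊎ ∃[ x ] (x ∉ Core × a ∈ Λ⁺ x × b ∈ Λ⁺ x)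

  η∉Λ : ∀ {x} → x ∉ Core → η x ∉ Λ x
  η∉Λ x∉ η∈Λ = off x∉ η∈Λ (η∈ x∉)

  ∣Λ⁺∣ : ∀ {x} → x ∉ Core → ∣ Λ⁺ x ∣ ≡ suc ∣ Λ x ∣
  ∣Λ⁺∣ x∉ = ∣p∪⁅x⁆∣≡1+∣p∣ (η∉Λ x∉)

  -- The leaves partition the vertices off the core, and `a` is off the core, hence no hinge.
  meet : ∀ {x y a} → x ∉ Core → y ∉ Core → a ∈ Λ x → a ∈ Λ⁺ y → Λ y ≡ Λ x
  meet {a = a} x∉ y∉ a∈x a∈y⁺ with ∈-∪⁅⁆⁻ a∈y⁺
  ... | inj₁ a∈y = trans (sym (same y∉ a∈y)) (same x∉ a∈x)
  ... | inj₂ refl = contradiction (η∈ y∉) (off x∉ a∈x)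

  -- One of two distinct vertices is not the hinge, and `meet` applies to it.
  leaf-unique : ∀ {x y a b} → x ∉ Core → y ∉ Core → a ≢ b → a ∈ Λ⁺ x → b ∈ Λ⁺ x → a ∈ Λ⁺ y → b ∈ Λ⁺ y → Λ y ≡ Λ x
  leaf-unique x∉ y∉ a≢b a∈x b∈x a∈y b∈y with ∈-∪⁅⁆⁻ a∈x | ∈-∪⁅⁆⁻ b∈x
  ... | inj₁ a∈ | _ = meet x∉ y∉ a∈ a∈y
  ... | inj₂ _ | inj₁ b∈ = meet x∉ y∉ b∈ b∈y
  ... | inj₂ refl | inj₂ refl = contradiction refl a≢b

  leaf∩core : ∀ {x a b} → x ∉ Core → a ≢ b → a ∈ Λ⁺ x → b ∈ Λ⁺ x → a ∈ Core → b ∉ Core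
  leaf∩core x∉ a≢b a∈x b∈x a∈C b∈C with ∈-∪⁅⁆⁻ a∈x | ∈-∪⁅⁆⁻ b∈x
  ... | inj₁ a∈ | _ = off x∉ a∈ a∈C
  ... | inj₂ _ | inj₁ b∈ = off x∉ b∈ b∈C
  ... | inj₂ refl | inj₂ refl = a≢b refl

open Leaves

-- Deleting an edge from a tree of tight blocks

module LeafStep {v P Q a b Core} {es : List (Edge n)} (sparse : Sparse es)
  (sep : Separation v P Q es) (cross : Crosses P Q a b) (L : Leaves ((a , b) ∷ es) Core) where

  a≢b : a ≢ b
  a≢b = crosses⇒≢ sep cross

  core-edge⇒tight : ∀ {x} → a ∈ Core → b ∈ Core → x ∉ Core → Tight es (Λ⁺ L x)
  core-edge⇒tight a∈C b∈C x∉ = tight-tail {es = es} (λ (a∈ , b∈) → leaf∩core L x∉ a≢b a∈ b∈ a∈C b∈C) (tight L x∉)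

  module _ {z} (z∉ : z ∉ Core) (a∈z : a ∈ Λ⁺ L z) (b∈z : b ∈ Λ⁺ L z) where

    other-tight : ∀ {x} → x ∉ Core → x ∉ Λ L z → Tight es (Λ⁺ L x)
    other-tight {x} x∉ x∉z = tight-tail {es = es}
      (λ (a∈ , b∈) → x∉z (subst (x ∈_) (leaf-unique L z∉ x∉ a≢b a∈z b∈z a∈ b∈) (self L x∉))) (tight L x∉)

    core-tight : Tight ((a , b) ∷ es) Core → Tight es Core
    core-tight = tight-tail {es = es} λ (a∈C , b∈C) → leaf∩core L z∉ a≢b a∈z b∈z a∈C b∈C

    -- The core lies on the side of `η L z`. A vertex of `Q` off the core and off `Λ L z` would lie
    -- in a block that is still tight, so its hinge, which is not `v`, would be in `Q` as well.
    far-side : v ∉ Core → (∀ {x y} → x ∈ Core → x ∈ P → y ∈ Core → y ∉ Q) → η L z ∈ P → Q ⊆ Λ L z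
    far-side v∉C core-one-sided η∈P {y} y∈Q with y ∈? Core | y ∈? Λ L z
    ... | _ | yes y∈z = y∈z
    ... | yes y∈C | no _ = contradiction y∈Q (core-one-sided (η∈ L z∉) η∈P y∈C)
    ... | no y∉C | no y∉z = contradiction ηy∈Q (core-one-sided (η∈ L z∉) η∈P (η∈ L y∉C))
      where
      ηy∈Q : η L y ∈ Q
      ηy∈Q = tight⇒follows sparse (flip-sep sep) (other-tight y∉C y∉z) (∈-∪ˡ (self L y∉C)) y∈Q ∈-∪⁅⁆
        (λ eq → v∉C (subst (_∈ Core) eq (η∈ L y∉C)))

    -- For `k = s` this is a contradiction, as neither class of `K s t` is that small. A leaf with
    -- at least two vertices has a block of at least three, so `v` is in the leaf but not in `Q`; a
    -- smaller leaf has room for one vertex of `Q` at most.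
    ∣far-side∣ : ∀ {k} → 2 ≤ k → ∣ Λ L z ∣ ≤ k → v ∉ Core →
                 (∀ {x y} → x ∈ Core → x ∈ P → y ∈ Core → y ∉ Q) → η L z ∈ P → ∣ Q ∣ < k
    ∣far-side∣ {k} 2≤k Λ≤k v∉C core-one-sided η∈P with 2 ≤? ∣ Λ L z ∣
    ... | no 2≰ = <-≤-trans (≤-<-trans (p⊆q⇒∣p∣≤∣q∣ (far-side v∉C core-one-sided η∈P)) (≰⇒> 2≰)) 2≤k
    ... | yes 2≤ = <-≤-trans (p⊂q⇒∣p∣<∣q∣ (far-side v∉C core-one-sided η∈P , v , v∈z , sep .v∉Q)) Λ≤k
      where
      v∈z : v ∈ Λ L z
      v∈z with ∈-∪⁅⁆⁻ (tight⇒v∈ sparse sep cross a∈z b∈z (tight L z∉) (subst (3 ≤_) (sym (∣Λ⁺∣ L z∉)) (s≤s 2≤)))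
      ... | inj₁ v∈ = v∈
      ... | inj₂ refl = contradiction (η∈ L z∉) v∉C

    P-end : ∃[ x ] (x ∈ Λ⁺ L z × x ∈ P)
    P-end = let x , _ , x∈ , x∈P , _ = ends cross a∈z b∈z in x , x∈ , x∈P

    Q-end : ∃[ x ] (x ∈ Λ⁺ L z × x ∈ Q)
    Q-end = let _ , y , _ , _ , y∈ , y∈Q = ends cross a∈z b∈z in y , y∈ , y∈Q

    -- P is a union of leaves and of a nonempty proper part of the leaf of z: without a whole leaf it is too
    -- small, with one it is too large.
    P-off-core⇒⊥ : (∀ {x} → x ∉ Core → ∣ Λ L x ∣ ≡ ∣ P ∣) → v ∈ Core → η L z ≡ v → (∀ {x} → x ∈ P → x ∉ Core) → False
    P-off-core⇒⊥ size v∈C ηz≡v P-off = go (P ⊆? Λ L z)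
      where
      inΛ : ∀ {x} → x ∈ Λ⁺ L z → x ≢ v → x ∈ Λ L z
      inΛ x∈ x≢v with ∈-∪⁅⁆⁻ x∈
      ... | inj₁ h = h
      ... | inj₂ eq = contradiction (trans eq ηz≡v) x≢v
      go : Dec (P ⊆ Λ L z) → False
      go (yes P⊆) = let y , y∈ , y∈Q = Q-end in
        <-irrefl (sym (size z∉)) (p⊂q⇒∣p∣<∣q∣ (P⊆ , y , inΛ y∈ (≢v (flip-sep sep) y∈Q) , λ y∈P → sep .disjoint y∈P y∈Q))
      go (no P⊈) with nonempty? (P ─ Λ L z)
      ... | no empty = P⊈ λ {x} x∈P →
        decidable-stable (x ∈? Λ L z) λ x∉ → empty (x , x∈p∧x∉q⇒x∈p─q x∈P x∉)
      ... | yes (y , y∈) =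
        let y∈P , y∉z = x∈p─q⇒x∈p∧x∉q P (Λ L z) y∈
            y∉C = P-off y∈P
            x , x∈⁺ , x∈P = P-end
            x∈ = inΛ x∈⁺ (≢v sep x∈P) in
        <-irrefl (size y∉C) (p⊂q⇒∣p∣<∣q∣
          ( (λ w∈ → tight⇒follows sparse sep (other-tight y∉C y∉z) (∈-∪ˡ (self L y∉C)) y∈P (∈-∪ˡ w∈) (λ { refl → off L y∉C w∈ v∈C }))
          , x , x∈P , λ x∈y → y∉z (subst (y ∈_) (trans (sym (same L y∉C x∈y)) (same L z∉ x∈)) (self L y∉C))))

-- `Y` becomes a leaf with hinge `v`. Old hinges have to stay in the core, hence `η∉Y`. `es₀` may
-- have an edge more than `es`, since the core falls apart when an edge is deleted.
module AddLeaf {es₀ es : List (Edge n)} {Core Y : Subset n} {v y₀} (L : Leaves es₀ Core)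
  (es⊆ : ∀ {e} → e ∈ˡ es → e ∈ˡ es₀)
  (Y⊆C : Y ⊆ Core) (v∈C : v ∈ Core) (v∉Y : v ∉ Y) (y₀∈Y : y₀ ∈ Y)
  (η∉Y : ∀ {x} → x ∉ Core → η L x ∉ Y)
  (tight-old : ∀ {x} → x ∉ Core → Tight es (Λ⁺ L x))
  (tight-new : Tight es (Y ∪ ⁅ v ⁆))
  (covers-core : ∀ {a b} → (a , b) ∈ˡ es → a ∈ Core → b ∈ Core →
    (a ∈ Core ─ Y × b ∈ Core ─ Y) ⊎ (a ∈ Y ∪ ⁅ v ⁆ × b ∈ Y ∪ ⁅ v ⁆)) where

  leaf : ∀ x → Dec (x ∈ Y) → Subset n × Fin n
  leaf x (yes _) = Y , v
  leaf x (no _)  = Λ L x , η L x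

  new : Fin n → Subset n × Fin n
  new x = leaf x (x ∈? Y)

  new-in : ∀ {x} → x ∈ Y → new x ≡ (Y , v)
  new-in {x} x∈Y with x ∈? Y
  ... | yes _ = refl
  ... | no x∉Y = contradiction x∈Y x∉Y

  new-out : ∀ {x} → x ∉ Y → new x ≡ (Λ L x , η L x)
  new-out {x} x∉Y with x ∈? Y
  ... | yes x∈Y = contradiction x∈Y x∉Y
  ... | no _ = refl

  ∉─ : ∀ {x} → x ∉ Core ─ Y → x ∈ Y ⊎ (x ∉ Y × x ∉ Core)
  ∉─ {x} x∉ with x ∈? Y
  ... | yes x∈Y = inj₁ x∈Y
  ... | no x∉Y = inj₂ (x∉Y , λ x∈C → x∉ (x∈p∧x∉q⇒x∈p─q x∈C x∉Y))

  Y∉─ : ∀ {x} → x ∈ Y → x ∉ Core ─ Y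
  Y∉─ x∈Y x∈ = proj₂ (x∈p─q⇒x∈p∧x∉q Core Y x∈) x∈Y

  old∉Y : ∀ {x y} → x ∉ Core → y ∈ Λ L x → y ∉ Y
  old∉Y x∉ y∈ y∈Y = off L x∉ y∈ (Y⊆C y∈Y)

  leaves : Leaves es (Core ─ Y)
  leaves .Λ x = proj₁ (new x)
  leaves .η x = proj₂ (new x)
  leaves .self x∉ with ∉─ x∉
  ... | inj₁ x∈Y rewrite new-in x∈Y = x∈Y
  ... | inj₂ (x∉Y , x∉C) rewrite new-out x∉Y = self L x∉C
  leaves .off x∉ y∈ with ∉─ x∉
  ... | inj₁ x∈Y rewrite new-in x∈Y = Y∉─ y∈
  ... | inj₂ (x∉Y , x∉C) rewrite new-out x∉Y = off L x∉C y∈ ∘ p─q⊆p Core Y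
  leaves .same x∉ y∈ with ∉─ x∉
  ... | inj₁ x∈Y rewrite new-in x∈Y | new-in y∈ = refl
  ... | inj₂ (x∉Y , x∉C) rewrite new-out x∉Y | new-out (old∉Y x∉C y∈) = same L x∉C y∈
  leaves .η-same x∉ y∈ with ∉─ x∉
  ... | inj₁ x∈Y rewrite new-in x∈Y | new-in y∈ = refl
  ... | inj₂ (x∉Y , x∉C) rewrite new-out x∉Y | new-out (old∉Y x∉C y∈) = η-same L x∉C y∈
  leaves .η∈ x∉ with ∉─ x∉
  ... | inj₁ x∈Y rewrite new-in x∈Y = x∈p∧x∉q⇒x∈p─q v∈C v∉Y
  ... | inj₂ (x∉Y , x∉C) rewrite new-out x∉Y = x∈p∧x∉q⇒x∈p─q (η∈ L x∉C) (η∉Y x∉C)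
  leaves .tight x∉ with ∉─ x∉
  ... | inj₁ x∈Y rewrite new-in x∈Y = tight-new
  ... | inj₂ (x∉Y , x∉C) rewrite new-out x∉Y = tight-old x∉C
  leaves .covers e∈ with covers L (es⊆ e∈)
  ... | inj₂ (x , x∉C , a∈ , b∈) = inj₂ (x , x∉C ∘ p─q⊆p Core Y ,
    subst (λ (W , h) → _ ∈ W ∪ ⁅ h ⁆ × _ ∈ W ∪ ⁅ h ⁆) (sym (new-out (x∉C ∘ Y⊆C))) (a∈ , b∈))
  ... | inj₁ (a∈C , b∈C) with covers-core e∈ a∈C b∈C
  ... | inj₁ both = inj₁ both
  -- `y₀` serves as the representative of the new leaf.
  ... | inj₂ both = inj₂ (y₀ , Y∉─ y₀∈Y ,
    subst (λ (W , h) → _ ∈ W ∪ ⁅ h ⁆ × _ ∈ W ∪ ⁅ h ⁆) (sym (new-in y₀∈Y)) both)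

  leaves-all : (R : Subset n → Set) → R Y → (∀ {x} → x ∉ Core → R (Λ L x)) → ∀ {x} → x ∉ Core ─ Y → R (Λ leaves x)
  leaves-all R new′ old x∉ with ∉─ x∉
  ... | inj₁ x∈Y rewrite new-in x∈Y = new′
  ... | inj₂ (x∉Y , x∉C) rewrite new-out x∉Y = old x∉C

  η-in : ∀ {x} → x ∈ Y → η leaves x ≡ v
  η-in x∈Y rewrite new-in x∈Y = refl

retighten : ∀ {es₀ es : List (Edge n)} {Core} (L : Leaves es₀ Core) → (∀ {e} → e ∈ˡ es → e ∈ˡ es₀) →
            (∀ {x} → x ∉ Core → Tight es (Λ⁺ L x)) → Leaves es Core
retighten L es⊆ tight′ = record
  { Λ = Λ L ; η = η L ; self = self L ; off = off L ; same = same L ; η-same = η-same L ; η∈ = η∈ L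
  ; tight = tight′ ; covers = covers L ∘ es⊆ }

-- The three deadlocked shapes

record Step (s t : ℕ) (e : Edge n) (es : List (Edge n)) : Set where
  field
    v    : Fin n
    S T  : Subset n
    ∣S∣≡ : ∣ S ∣ ≡ s
    ∣T∣≡ : ∣ T ∣ ≡ t
    sep  : Separation v S T es
    cross : Crosses S T (proj₁ e) (proj₂ e)

module Deadlock {s t : ℕ} (2<s : 2 < s) (s<t : s < t) {n : ℕ} (n≡ : n ≡ suc (s + t)) where

  TwoHinges : ∀ {es Core} → Leaves {n} es Core → Set
  TwoHinges {Core = Core} L = ∃[ x ] ∃[ y ] (x ∉ Core × y ∉ Core × η L x ≢ η L y)

  -- Each constructor keeps what forbids the wrong deletions. In `core` the last argument makes the
  -- core too large for `S`, by itself or through the blocks hanging on it, so that only core edges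
  -- can go. In `star` the bound `s` forces `v` to be the common vertex `c`. In `stuck` no edge can
  -- go at all; `z` represents the only leaf at `p`.
  data State (es : List (Edge n)) : Set where
    core  : ∀ {Core} (L : Leaves es Core) → Tight es Core → (∀ {x} → x ∉ Core → ∣ Λ L x ∣ ≡ s) →
            suc s < ∣ Core ∣ ⊎ TwoHinges L → State es
    star  : ∀ {Core c} (L : Leaves es Core) → c ∈ Core → (∀ {x} → x ∈ Core → x ≡ c) →
            (∀ {x} → x ∉ Core → ∣ Λ L x ∣ ≤ s) → State es
    stuck : ∀ {Core p q z} (L : Leaves es Core) → p ∈ Core → q ∈ Core → (∀ {x} → x ∈ Core → x ≡ p ⊎ x ≡ q) → p ≢ q →
            (∀ {x y} → (x , y) ∈ˡ es → x ∈ Core → y ∉ Core) → (∀ {x} → x ∉ Core → ∣ Λ L x ∣ ≡ s) →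
            z ∉ Core → η L z ≡ p → (∀ {x} → x ∉ Core → η L x ≡ p → x ∈ Λ L z) → State es

  twoHinges? : ∀ {es Core} (L : Leaves es Core) → Dec (TwoHinges L)
  twoHinges? {Core = Core} L = any? λ x → any? λ y → ¬? (x ∈? Core) ×-dec ¬? (y ∈? Core) ×-dec ¬? (η L x ≟ η L y)

  1<s : 1 < s
  1<s = ≤-trans (n≤1+n 2) 2<s

  module _ {a b : Fin n} {es} (sparse : Sparse es) (step : Step s t (a , b) es) where
    open Step step

    private
      module LS {Core} (L : Leaves ((a , b) ∷ es) Core) = LeafStep sparse sep cross L
      module LT {Core} (L : Leaves ((a , b) ∷ es) Core) = LeafStep sparse (flip-sep sep) (swap cross) L

    S-small : ∀ {W} → suc s ≤ ∣ W ∣ → W ⊆ S → False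
    S-small s<W W⊆S = <-irrefl refl (≤-trans s<W (≤-trans (p⊆q⇒∣p∣≤∣q∣ W⊆S) (≤-reflexive ∣S∣≡)))

    -- A tight set avoiding `v` lies on one side, and this one is too large for `S`.
    tight-big⇒∉S : ∀ {W x} → Tight es W → suc s ≤ ∣ W ∣ → v ∉ W → x ∈ W → x ∉ S
    tight-big⇒∉S tightW s<W v∉W x∈W x∈S = S-small s<W λ y∈ →
      tight⇒follows sparse sep tightW x∈W x∈S y∈ λ { refl → v∉W y∈ }

    ∉S⇒∈T : ∀ {x} → x ≢ v → x ∉ S → x ∈ T
    ∉S⇒∈T x≢v x∉S with sep .cover x≢v
    ... | inj₁ x∈S = contradiction x∈S x∉S
    ... | inj₂ x∈T = x∈T

    leaf-size : ∀ {Core} (L : Leaves ((a , b) ∷ es) Core) → (∀ {x} → x ∉ Core → ∣ Λ L x ∣ ≡ s) →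
                ∀ {x} → x ∉ Core → suc s ≤ ∣ Λ⁺ L x ∣
    leaf-size L size x∉ = ≤-reflexive (sym (trans (∣Λ⁺∣ L x∉) (cong suc (size x∉))))

    v∉Λ⁺ : ∀ {Core} (L : Leaves ((a , b) ∷ es) Core) → v ∈ Core → ∀ {x} → x ∉ Core → η L x ≢ v → v ∉ Λ⁺ L x
    v∉Λ⁺ L v∈C x∉ ηx≢v v∈ with ∈-∪⁅⁆⁻ v∈
    ... | inj₁ v∈Λ = off L x∉ v∈Λ v∈C
    ... | inj₂ v≡η = ηx≢v (sym v≡η)

    module CoreStep {Core} (L : Leaves ((a , b) ∷ es) Core) (tightC : Tight ((a , b) ∷ es) Core)
      (size : ∀ {x} → x ∉ Core → ∣ Λ L x ∣ ≡ s) (a∈C : a ∈ Core) (b∈C : b ∈ Core) (3≤C : 3 ≤ ∣ Core ∣) where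

      v∈C : v ∈ Core
      v∈C = tight⇒v∈ sparse sep cross a∈C b∈C tightC 3≤C

      tightΛ : ∀ {x} → x ∉ Core → Tight es (Λ⁺ L x)
      tightΛ = LS.core-edge⇒tight L a∈C b∈C

      η∉S : ∀ {x} → x ∉ Core → η L x ∉ S
      η∉S x∉ η∈S = tight-big⇒∉S (tightΛ x∉) (leaf-size L size x∉) (v∉Λ⁺ L v∈C x∉ (≢v sep η∈S)) ∈-∪⁅⁆ η∈S

      S-end : ∃[ x ] (x ∈ Core × x ∈ S)
      S-end = let x , _ , x∈C , x∈S , _ = ends cross a∈C b∈C in x , x∈C , x∈S

      -- A leaf vertex in `S` would pull its hinge into `S`, against `η∉S`, or, if the hinge is `v`,
      -- its whole leaf. But the leaf has `s` vertices already, and `S` contains a core vertex too.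
      S⊆C : S ⊆ Core
      S⊆C {x} x∈S with x ∈? Core
      ... | yes x∈C = x∈C
      ... | no x∉C with η L x ≟ v
      ... | no ηx≢v = contradiction (tight⇒follows sparse sep (tightΛ x∉C) (∈-∪ˡ (self L x∉C)) x∈S ∈-∪⁅⁆ ηx≢v) (η∉S x∉C)
      ... | yes ηx≡v = let y , y∈C , y∈S = S-end in
        ⊥-elim (<-irrefl (trans (size x∉C) (sym ∣S∣≡)) (p⊂q⇒∣p∣<∣q∣
          ( (λ w∈ → tight⇒follows sparse sep (tightΛ x∉C) (∈-∪ˡ (self L x∉C)) x∈S (∈-∪ˡ w∈) λ { refl → off L x∉C w∈ v∈C })
          , y , y∈S , λ y∈Λ → off L x∉C y∈Λ y∈C)))

      S∪v≡ : S ∪ ⁅ v ⁆ ≡ part Core S v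
      S∪v≡ = ⊆-antisym (λ x∈ → [ (λ x∈S → part⁺ (S⊆C x∈S) (inj₁ x∈S)) , (λ { refl → part⁺ v∈C (inj₂ refl) }) ]′ (∈-∪⁅⁆⁻ x∈))
        (λ x∈ → proj₂ (x∈p∩q⁻ Core (S ∪ ⁅ v ⁆) x∈))

      C─S≡ : Core ─ S ≡ part Core T v
      C─S≡ = ⊆-antisym to from
        where
        to : Core ─ S ⊆ part Core T v
        to {x} x∈ with x∈p─q⇒x∈p∧x∉q Core S x∈ | x ≟ v
        ... | x∈C , x∉S | yes x≡v = part⁺ x∈C (inj₂ x≡v)
        ... | x∈C , x∉S | no x≢v = part⁺ x∈C (inj₁ (∉S⇒∈T x≢v x∉S))
        from : part Core T v ⊆ Core ─ S
        from x∈ with part⁻ {P = T} x∈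
        ... | x∈C , inj₁ x∈T = x∈p∧x∉q⇒x∈p─q x∈C (λ x∈S → sep .disjoint x∈S x∈T)
        ... | x∈C , inj₂ refl = x∈p∧x∉q⇒x∈p─q x∈C (sep .v∉P)

      tight-C─S : Tight es (Core ─ S)
      tight-C─S = subst (Tight es) (sym C─S≡) (tight-part sparse (flip-sep sep) (swap cross) a∈C b∈C tightC v∈C)

      covers-core : ∀ {x y} → (x , y) ∈ˡ es → x ∈ Core → y ∈ Core →
        (x ∈ Core ─ S × y ∈ Core ─ S) ⊎ (x ∈ S ∪ ⁅ v ⁆ × y ∈ S ∪ ⁅ v ⁆)
      covers-core {x} {y} e∈ x∈C y∈C with x ∈? S | y ∈? S
      ... | yes x∈S | yes y∈S = inj₂ (∈-∪ˡ x∈S , ∈-∪ˡ y∈S)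
      ... | no x∉S | no y∉S = inj₁ (x∈p∧x∉q⇒x∈p─q x∈C x∉S , x∈p∧x∉q⇒x∈p─q y∈C y∉S)
      ... | yes x∈S | no y∉S with y ≟ v
      ... | yes refl = inj₂ (∈-∪ˡ x∈S , ∈-∪⁅⁆)
      ... | no y≢v = contradiction (inj₁ (x∈S , ∉S⇒∈T y≢v y∉S)) (sep .free e∈)
      covers-core {x} {y} e∈ x∈C y∈C | no x∉S | yes y∈S with x ≟ v
      ... | yes refl = inj₂ (∈-∪⁅⁆ , ∈-∪ˡ y∈S)
      ... | no x≢v = contradiction (inj₂ (∉S⇒∈T x≢v x∉S , y∈S)) (sep .free e∈)

      module Add = AddLeaf L there S⊆C v∈C (sep .v∉P) (proj₂ (proj₂ S-end)) η∉S tightΛ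
        (subst (Tight es) (sym S∪v≡) (tight-part sparse sep cross a∈C b∈C tightC v∈C)) covers-core

      L′ : Leaves es (Core ─ S)
      L′ = Add.leaves

      size′ : ∀ {x} → x ∉ Core ─ S → ∣ Λ L′ x ∣ ≡ s
      size′ = Add.leaves-all (λ W → ∣ W ∣ ≡ s) ∣S∣≡ size

      -- Once all leaves hang at v and the core is small, the core is one more leaf at v.
      toStar : ¬ TwoHinges L′ → ∣ Core ─ S ∣ ≤ suc s → State es
      toStar ¬two small = star Star.leaves (x∈p∧x∉q⇒x∈p─q v∈C′ v∉Y) ∈C′─Y⇒≡v
        (Star.leaves-all (λ W → ∣ W ∣ ≤ s)
          (s≤s⁻¹ (subst (_≤ suc s) (trans (cong ∣_∣ (sym Y∪v≡)) (∣p∪⁅x⁆∣≡1+∣p∣ v∉Y)) small)) (≤-reflexive ∘ size′))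
        where
        C′ Y : Subset n
        C′ = Core ─ S
        Y  = C′ ─ ⁅ v ⁆
        v∈C′ : v ∈ C′
        v∈C′ = x∈p∧x∉q⇒x∈p─q v∈C (sep .v∉P)
        v∉Y : v ∉ Y
        v∉Y v∈Y = proj₂ (x∈p─q⇒x∈p∧x∉q C′ ⁅ v ⁆ v∈Y) (x∈⁅x⁆ v)
        C′⊆ : C′ ⊆ Y ∪ ⁅ v ⁆
        C′⊆ {x} x∈ with x ≟ v
        ... | yes refl = ∈-∪⁅⁆
        ... | no x≢v = ∈-∪ˡ (x∈p∧x∉q⇒x∈p─q x∈ (x≢y⇒x∉⁅y⁆ x≢v))
        Y∪v≡ : Y ∪ ⁅ v ⁆ ≡ C′
        Y∪v≡ = ⊆-antisym (λ x∈ → [ p─q⊆p C′ ⁅ v ⁆ , (λ { refl → v∈C′ }) ]′ (∈-∪⁅⁆⁻ x∈)) C′⊆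
        ∈C′─Y⇒≡v : ∀ {x} → x ∈ C′ ─ Y → x ≡ v
        ∈C′─Y⇒≡v x∈ = let x∈C′ , x∉Y = x∈p─q⇒x∈p∧x∉q C′ Y x∈ in
          [ (λ x∈Y → contradiction x∈Y x∉Y) , id ]′ (∈-∪⁅⁆⁻ (C′⊆ x∈C′))
        -- The new leaf `S` hangs at `v`, so any other hinge would make two.
        η≡v : ∀ {x} → x ∉ C′ → η L′ x ≡ v
        η≡v {x} x∉ = decidable-stable (η L′ x ≟ v) λ ≢v → let y , _ , y∈S = S-end in
          ¬two (x , y , x∉ , Add.Y∉─ y∈S , λ eq → ≢v (trans eq (Add.η-in y∈S)))
        y∈ : ∃[ y ] (y ∈ C′ × y ≢ v)
        y∈ = 2≤∣p∣⇒other C′ v (proj₁ tight-C─S)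
        module Star = AddLeaf {y₀ = proj₁ y∈} L′ id (p─q⊆p C′ ⁅ v ⁆) v∈C′ v∉Y
          (x∈p∧x∉q⇒x∈p─q (proj₁ (proj₂ y∈)) (x≢y⇒x∉⁅y⁆ (proj₂ (proj₂ y∈))))
          (λ x∉ η∈Y → v∉Y (subst (_∈ Y) (η≡v x∉) η∈Y))
          (tight L′)
          (subst (Tight es) (sym Y∪v≡) tight-C─S)
          (λ _ x∈ y∈ → inj₂ (C′⊆ x∈ , C′⊆ y∈))

      toCore : State es
      toCore with twoHinges? L′ | suc s <? ∣ Core ─ S ∣
      ... | yes two | _ = core L′ tight-C─S size′ (inj₂ two)
      ... | no _ | yes big = core L′ tight-C─S size′ (inj₁ big)
      ... | no ¬two | no small = toStar ¬two (≮⇒≥ small)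

    -- If `v` is off the core, `∣far-side∣` makes one class too small. If `v` is in the core, it is
    -- the hinge of the leaf, `big` keeps the core off `S`, and `P-off-core⇒⊥` applies.
    coreLeaf⇒⊥ : ∀ {Core z} (L : Leaves ((a , b) ∷ es) Core) → Tight ((a , b) ∷ es) Core →
                 (∀ {x} → x ∉ Core → ∣ Λ L x ∣ ≡ s) →
                 suc s < ∣ Core ∣ ⊎ TwoHinges L → z ∉ Core → a ∈ Λ⁺ L z → b ∈ Λ⁺ L z → False
    coreLeaf⇒⊥ {Core} {z} L tightC size big z∉ a∈ b∈ with v ∈? Core
    ... | no v∉C with sep .cover {η L z} (λ { refl → v∉C (η∈ L z∉) })
    ... | inj₁ η∈S = <-asym s<t (subst (_< s) ∣T∣≡
      (LS.∣far-side∣ L z∉ a∈ b∈ 1<s (≤-reflexive (size z∉)) v∉C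
        (tight⇒one-sided sparse sep (LS.core-tight L z∉ a∈ b∈ tightC)) η∈S))
    ... | inj₂ η∈T = <-irrefl ∣S∣≡
      (LT.∣far-side∣ L z∉ a∈ b∈ 1<s (≤-reflexive (size z∉)) v∉C
        (tight⇒one-sided sparse (flip-sep sep) (LS.core-tight L z∉ a∈ b∈ tightC)) η∈T)
    coreLeaf⇒⊥ {Core} {z} L tightC size big z∉ a∈ b∈ | yes v∈C =
      LS.P-off-core⇒⊥ L z∉ a∈ b∈ (λ x∉ → trans (size x∉) (sym ∣S∣≡)) v∈C ηz≡v (S-off big)
      where
      tightC′ : Tight es Core
      tightC′ = LS.core-tight L z∉ a∈ b∈ tightC
      ηz≡v : η L z ≡ v
      ηz≡v with ∈-∪⁅⁆⁻ (tight⇒v∈ sparse sep cross a∈ b∈ (tight L z∉) (≤-trans (m≤n⇒m≤1+n 2<s) (leaf-size L size z∉)))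
      ... | inj₁ v∈Λ = contradiction v∈C (off L z∉ v∈Λ)
      ... | inj₂ v≡η = sym v≡η
      C∖v : Subset n
      C∖v = Core ─ ⁅ v ⁆
      C⊆ : Core ⊆ C∖v ∪ ⁅ v ⁆
      C⊆ {x} x∈ with x ≟ v
      ... | yes refl = ∈-∪⁅⁆
      ... | no x≢v = ∈-∪ˡ (x∈p∧x∉q⇒x∈p─q x∈ (x≢y⇒x∉⁅y⁆ x≢v))
      -- A block hanging elsewhere than at `v` keeps its hinge, and with it the tight core, out of
      -- `S`.
      hinged : ∀ {y c} → y ∉ Core → η L y ≢ v → c ∈ Core → c ∉ S
      hinged {y} y∉ ηy≢v c∈C c∈S = tight-big⇒∉S
        (LS.other-tight L z∉ a∈ b∈ y∉ (λ y∈Λz → ηy≢v (trans (η-same L z∉ y∈Λz) ηz≡v)))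
        (leaf-size L size y∉) (v∉Λ⁺ L v∈C y∉ ηy≢v) ∈-∪⁅⁆
        (tight⇒follows sparse sep tightC′ c∈C c∈S (η∈ L y∉) ηy≢v)
      S-off : suc s < ∣ Core ∣ ⊎ TwoHinges L → ∀ {c} → c ∈ S → c ∉ Core
      -- Without `v` the core still has more than `s` vertices, all on one side.
      S-off (inj₁ s<C) {c} c∈S c∈C = S-small {C∖v}
        (s≤s⁻¹ (≤-trans s<C (≤-trans (p⊆q⇒∣p∣≤∣q∣ C⊆) (≤-reflexive (∣p∪⁅x⁆∣≡1+∣p∣ v∉))))) sub
        where
        v∉ : v ∉ C∖v
        v∉ v∈ = proj₂ (x∈p─q⇒x∈p∧x∉q Core ⁅ v ⁆ v∈) (x∈⁅x⁆ v)
        sub : C∖v ⊆ S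
        sub x∈ = let x∈C , x∉v = x∈p─q⇒x∈p∧x∉q Core ⁅ v ⁆ x∈ in
          tight⇒follows sparse sep tightC′ c∈C c∈S x∈C (x∉⁅y⁆⇒x≢y x∉v)
      S-off (inj₂ (x , y , x∉ , y∉ , η≢)) c∈S c∈C with η L x ≟ v
      ... | no ηx≢v = hinged x∉ ηx≢v c∈C c∈S
      ... | yes ηx≡v = hinged y∉ (λ ηy≡v → η≢ (trans ηx≡v (sym ηy≡v))) c∈C c∈S

    -- The core is the edge from `p ∈ S` to `q ∈ T`, so different hinges mean that there is a leaf
    -- at `p`. A block at `p` that avoids `v` would be too large for `S`; hence every leaf at `p`
    -- contains `v`, and there is only one.
    coreSplit : ∀ {Core} (L : Leaves ((a , b) ∷ es) Core) → (∀ {x} → x ∉ Core → ∣ Λ L x ∣ ≡ s) → TwoHinges L →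
                a ∈ Core → b ∈ Core → ¬ (3 ≤ ∣ Core ∣) → State es
    coreSplit {Core} L size (x , y , x∉ , y∉ , η≢) a∈C b∈C 3≰C with ends cross a∈C b∈C
    ... | p , q , p∈C , p∈S , q∈C , q∈T =
      let z , z∉ , ηz≡p = p-leaf in
      stuck (retighten L there tightΛ) p∈C q∈C C⊆pq p≢q no-edge size z∉ ηz≡p λ w∉ ηw≡p →
        subst (_ ∈_) (trans (sym (same L w∉ (v∈Λ w∉ ηw≡p))) (same L z∉ (v∈Λ z∉ ηz≡p))) (self L w∉)
      where
      tightΛ : ∀ {x} → x ∉ Core → Tight es (Λ⁺ L x)
      tightΛ = LS.core-edge⇒tight L a∈C b∈C
      p≢q : p ≢ q
      p≢q refl = sep .disjoint p∈S q∈T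
      C⊆pq : ∀ {x} → x ∈ Core → x ≡ p ⊎ x ≡ q
      C⊆pq {x} x∈C with x ≟ p | x ≟ q
      ... | yes x≡p | _ = inj₁ x≡p
      ... | no _ | yes x≡q = inj₂ x≡q
      ... | no x≢p | no x≢q = contradiction (≤-trans (s≤s 2≤pq) (p⊂q⇒∣p∣<∣q∣ (pq⊆C , x , x∈C , x∉pq))) 3≰C
        where
        pq⊆C : ⁅ p ⁆ ∪ ⁅ q ⁆ ⊆ Core
        pq⊆C w∈ = [ (λ w∈p → subst (_∈ Core) (sym (x∈⁅y⁆⇒x≡y p w∈p)) p∈C) , (λ { refl → q∈C }) ]′ (∈-∪⁅⁆⁻ w∈)
        x∉pq : x ∉ ⁅ p ⁆ ∪ ⁅ q ⁆
        x∉pq x∈ = [ x≢p ∘ x∈⁅y⁆⇒x≡y p , x≢q ]′ (∈-∪⁅⁆⁻ x∈)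
        2≤pq : 2 ≤ ∣ ⁅ p ⁆ ∪ ⁅ q ⁆ ∣
        2≤pq = distinct⇒2≤∣p∣ (∈-∪ˡ (x∈⁅x⁆ p)) (∈-∪⁅⁆ {p = ⁅ p ⁆}) p≢q
      no-edge : ∀ {x y} → (x , y) ∈ˡ es → x ∈ Core → y ∉ Core
      no-edge e∈ x∈C y∈C with C⊆pq x∈C | C⊆pq y∈C
      ... | inj₁ refl | inj₁ refl = sparse⇒no-loop sparse e∈ refl
      ... | inj₂ refl | inj₂ refl = sparse⇒no-loop sparse e∈ refl
      ... | inj₁ refl | inj₂ refl = sep .free e∈ (inj₁ (p∈S , q∈T))
      ... | inj₂ refl | inj₁ refl = sep .free e∈ (inj₂ (q∈T , p∈S))
      p-leaf : ∃[ z ] (z ∉ Core × η L z ≡ p)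
      p-leaf with C⊆pq (η∈ L x∉) | C⊆pq (η∈ L y∉)
      ... | inj₁ ηx≡p | _ = x , x∉ , ηx≡p
      ... | inj₂ _ | inj₁ ηy≡p = y , y∉ , ηy≡p
      ... | inj₂ ηx≡q | inj₂ ηy≡q = contradiction (trans ηx≡q (sym ηy≡q)) η≢
      v∉C : v ∉ Core
      v∉C v∈C = [ (λ { refl → sep .v∉P p∈S }) , (λ { refl → sep .v∉Q q∈T }) ]′ (C⊆pq v∈C)
      v∈Λ : ∀ {w} → w ∉ Core → η L w ≡ p → v ∈ Λ L w
      v∈Λ {w} w∉ refl with v ∈? Λ L w
      ... | yes v∈ = v∈
      ... | no v∉ = contradiction p∈S (tight-big⇒∉S (tightΛ w∉) (leaf-size L size w∉)
        (λ v∈ → [ v∉ , (λ { refl → v∉C p∈C }) ]′ (∈-∪⁅⁆⁻ v∈)) ∈-∪⁅⁆)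

  module StarSide {v : Fin n} {P Q a b Core es} (sparse : Sparse es) (sep : Separation v P Q es) (cross : Crosses P Q a b)
    (L : Leaves ((a , b) ∷ es) Core) (v∈C : v ∈ Core) (C⊆v : ∀ {x} → x ∈ Core → x ≡ v) where

    -- A block containing the deleted edge falls apart at its hinge `v` by `tight-part`; any other
    -- block is still tight, and its leaf lies on one side.
    tight-side : ∀ {x} → x ∉ Core → x ∈ P → Tight es ((Λ L x ∩ P) ∪ ⁅ η L x ⁆)
    tight-side {x} x∉ x∈P with inside? (Λ⁺ L x) (a , b)
    ... | yes (a∈ , b∈) = subst (Tight es) (⊆-antisym to from)
      (tight-part sparse sep cross a∈ b∈ (tight L x∉) v∈Λ⁺)
      where
      ηx≡v : η L x ≡ v
      ηx≡v = C⊆v (η∈ L x∉)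
      v∈Λ⁺ : v ∈ Λ⁺ L x
      v∈Λ⁺ = subst (_∈ Λ⁺ L x) ηx≡v ∈-∪⁅⁆
      to : part (Λ⁺ L x) P v ⊆ (Λ L x ∩ P) ∪ ⁅ η L x ⁆
      to y∈ with part⁻ {P = P} y∈
      ... | _ , inj₂ refl = subst (λ w → v ∈ (Λ L x ∩ P) ∪ ⁅ w ⁆) (sym ηx≡v) ∈-∪⁅⁆
      ... | y∈Λ⁺ , inj₁ y∈P with ∈-∪⁅⁆⁻ y∈Λ⁺
      ... | inj₁ y∈Λ = ∈-∪ˡ (x∈p∩q⁺ (y∈Λ , y∈P))
      ... | inj₂ refl = ∈-∪⁅⁆
      from : (Λ L x ∩ P) ∪ ⁅ η L x ⁆ ⊆ part (Λ⁺ L x) P v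
      from y∈ with ∈-∪⁅⁆⁻ y∈
      ... | inj₁ y∈∩ = let y∈Λ , y∈P = x∈p∩q⁻ (Λ L x) P y∈∩ in part⁺ (∈-∪ˡ y∈Λ) (inj₁ y∈P)
      ... | inj₂ refl = part⁺ ∈-∪⁅⁆ (inj₂ ηx≡v)
    ... | no ¬in = subst (λ W → Tight es (W ∪ ⁅ η L x ⁆)) (⊆-antisym
        (λ y∈ → x∈p∩q⁺ (y∈ , tight⇒follows sparse sep tightΛ (∈-∪ˡ (self L x∉)) x∈P (∈-∪ˡ y∈) λ { refl → off L x∉ y∈ v∈C }))
        (p∩q⊆p (Λ L x) P)) tightΛ
      where
      tightΛ : Tight es (Λ⁺ L x)
      tightΛ = tight-tail {es = es} ¬in (tight L x∉)

  module _ {a b : Fin n} {es} (sparse : Sparse es) (step : Step s t (a , b) es) where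
    open Step step

    -- Every leaf is replaced by its traces on `S` and `T`, with the same hinge; leaves only shrink,
    -- so the bound `s` persists.
    module StarStep {Core} (L : Leaves ((a , b) ∷ es) Core) (v∈C : v ∈ Core) (C⊆v : ∀ {x} → x ∈ Core → x ≡ v)
      (size : ∀ {x} → x ∉ Core → ∣ Λ L x ∣ ≤ s) where

      pick : ∀ {x} → Dec (x ∈ S) → Subset n
      pick (yes _) = S
      pick (no _)  = T

      side : Fin n → Subset n
      side x = pick (x ∈? S)

      side-S : ∀ {x} → x ∈ S → side x ≡ S
      side-S {x} x∈S with x ∈? S
      ... | yes _ = refl
      ... | no x∉S = contradiction x∈S x∉S

      side-T : ∀ {x} → x ∈ T → side x ≡ T
      side-T {x} x∈T with x ∈? S
      ... | yes x∈S = contradiction x∈T (sep .disjoint x∈S)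
      ... | no _ = refl

      which : ∀ {x} → x ∉ Core → x ∈ S ⊎ x ∈ T
      which x∉ = sep .cover λ { refl → x∉ v∈C }

      side-same : ∀ {x y} → x ∉ Core → y ∈ side x → side y ≡ side x
      side-same x∉ y∈ with which x∉
      ... | inj₁ x∈S rewrite side-S x∈S = side-S y∈
      ... | inj₂ x∈T rewrite side-T x∈T = side-T y∈

      ∈side : ∀ {x} → x ∉ Core → x ∈ side x
      ∈side x∉ with which x∉
      ... | inj₁ x∈S = subst (_ ∈_) (sym (side-S x∈S)) x∈S
      ... | inj₂ x∈T = subst (_ ∈_) (sym (side-T x∈T)) x∈T

      uncrossed : ∀ {x y} → x ∉ Core → y ∉ Core → ¬ Crosses S T x y → y ∈ side x
      uncrossed x∉ y∉ ¬cross with which x∉ | which y∉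
      ... | inj₁ x∈S | inj₁ y∈S = subst (_ ∈_) (sym (side-S x∈S)) y∈S
      ... | inj₂ x∈T | inj₂ y∈T = subst (_ ∈_) (sym (side-T x∈T)) y∈T
      ... | inj₁ x∈S | inj₂ y∈T = contradiction (inj₁ (x∈S , y∈T)) ¬cross
      ... | inj₂ x∈T | inj₁ y∈S = contradiction (inj₂ (x∈T , y∈S)) ¬cross

      block : ∀ {x y} → x ∉ Core → y ∈ Λ⁺ L x → ¬ Crosses S T x y → y ∈ (Λ L x ∩ side x) ∪ ⁅ η L x ⁆
      block x∉ y∈ ¬cross with ∈-∪⁅⁆⁻ y∈
      ... | inj₂ refl = ∈-∪⁅⁆
      ... | inj₁ y∈Λ = ∈-∪ˡ (x∈p∩q⁺ (y∈Λ , uncrossed x∉ (off L x∉ y∈Λ) ¬cross))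

      leaf⁺ : ∀ {z x y} → z ∉ Core → x ∉ Core → x ∈ Λ⁺ L z → y ∈ Λ⁺ L z → y ∈ Λ⁺ L x
      leaf⁺ z∉ x∉ x∈ y∈ with ∈-∪⁅⁆⁻ x∈
      ... | inj₂ refl = contradiction (η∈ L z∉) x∉
      ... | inj₁ x∈Λ = subst₂ (λ W h → _ ∈ W ∪ ⁅ h ⁆) (sym (same L z∉ x∈Λ)) (sym (η-same L z∉ x∈Λ)) y∈

      L′ : Leaves es Core
      L′ .Λ x = Λ L x ∩ side x
      L′ .η = η L
      L′ .self x∉ = x∈p∩q⁺ (self L x∉ , ∈side x∉)
      L′ .off {x} x∉ y∈ = off L x∉ (p∩q⊆p (Λ L x) (side x) y∈)
      L′ .same {x} x∉ y∈ = let y∈Λ , y∈side = x∈p∩q⁻ (Λ L x) (side x) y∈ in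
        cong₂ _∩_ (same L x∉ y∈Λ) (side-same x∉ y∈side)
      L′ .η-same {x} x∉ y∈ = η-same L x∉ (p∩q⊆p (Λ L x) (side x) y∈)
      L′ .η∈ = η∈ L
      L′ .tight {x} x∉ with which x∉
      ... | inj₁ x∈S = subst (λ W → Tight es ((Λ L x ∩ W) ∪ ⁅ η L x ⁆)) (sym (side-S x∈S))
        (StarSide.tight-side sparse sep cross L v∈C C⊆v x∉ x∈S)
      ... | inj₂ x∈T = subst (λ W → Tight es ((Λ L x ∩ W) ∪ ⁅ η L x ⁆)) (sym (side-T x∈T))
        (StarSide.tight-side sparse (flip-sep sep) (swap cross) L v∈C C⊆v x∉ x∈T)
      L′ .covers {x} {y} e∈ with covers L (there e∈)
      ... | inj₁ both = inj₁ both
      ... | inj₂ (z , z∉ , x∈ , y∈) with x ∈? Core | y ∈? Core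
      ... | yes x∈C | yes y∈C = inj₁ (x∈C , y∈C)
      ... | no x∉C | _ = inj₂ (x , x∉C , block x∉C (∈-∪ˡ (self L x∉C)) (λ c → crosses⇒≢ sep c refl) ,
                                        block x∉C (leaf⁺ z∉ x∉C x∈ y∈) (sep .free e∈))
      ... | yes _ | no y∉C = inj₂ (y , y∉C , block y∉C (leaf⁺ z∉ y∉C y∈ x∈) (sep .free e∈ ∘ swap-crosses) ,
                                            block y∉C (∈-∪ˡ (self L y∉C)) (λ c → crosses⇒≢ sep c refl))

      starState : State es
      starState = star L′ v∈C C⊆v (λ {x} x∉ → ≤-trans (p⊆q⇒∣p∣≤∣q∣ (p∩q⊆p (Λ L x) (side x))) (size x∉))

    -- A core of one vertex is trivially on one side, so for `v` off the core `∣far-side∣` makes one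
    -- class too small.
    starStep : ∀ {Core c} (L : Leaves ((a , b) ∷ es) Core) → c ∈ Core → (∀ {x} → x ∈ Core → x ≡ c) →
               (∀ {x} → x ∉ Core → ∣ Λ L x ∣ ≤ s) → State es
    starStep {Core} {c} L c∈C C⊆c size with covers L (here refl)
    ... | inj₁ (a∈C , b∈C) = contradiction (trans (C⊆c a∈C) (sym (C⊆c b∈C))) (crosses⇒≢ sep cross)
    ... | inj₂ (z , z∉ , a∈ , b∈) with v ∈? Core
    ... | yes v∈C = StarStep.starState L v∈C (λ x∈C → trans (C⊆c x∈C) (sym (C⊆c v∈C))) size
    ... | no v∉C with sep .cover {η L z} (λ { refl → v∉C (η∈ L z∉) })
    ... | inj₁ η∈S = ⊥-elim (<-asym s<t (subst (_< s) ∣T∣≡ (LeafStep.∣far-side∣ sparse sep cross L z∉ a∈ b∈ 1<s (size z∉) v∉C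
      (λ x∈C x∈S y∈C y∈T → sep .disjoint x∈S (subst (_∈ T) (trans (C⊆c y∈C) (sym (C⊆c x∈C))) y∈T)) η∈S)))
    ... | inj₂ η∈T = ⊥-elim (<-irrefl ∣S∣≡ (LeafStep.∣far-side∣ sparse (flip-sep sep) (swap cross) L z∉ a∈ b∈ 1<s (size z∉) v∉C
      (λ x∈C x∈T y∈C y∈S → sep .disjoint (subst (_∈ S) (trans (C⊆c y∈C) (sym (C⊆c x∈C))) y∈S) x∈T) η∈T))

  module StuckSide {v : Fin n} {P Q a b Core es p q y} (sparse : Sparse es) (sep : Separation v P Q es)
    (cross : Crosses P Q a b) (L : Leaves ((a , b) ∷ es) Core) (C⊆pq : ∀ {x} → x ∈ Core → x ≡ p ⊎ x ≡ q)
    (size : ∀ {x} → x ∉ Core → ∣ Λ L x ∣ ≡ s) (y∉ : y ∉ Core) (ηy≡p : η L y ≡ p)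
    (unique : ∀ {x} → x ∉ Core → η L x ≡ p → x ∈ Λ L y) (a∈ : a ∈ Λ⁺ L y) (b∈ : b ∈ Λ⁺ L y) where

    -- All `t` vertices outside the block of `y` go to the side of `q`: they are `q` and the leaves
    -- at `q`, as `p` carries no other leaf. The deleted edge puts one more vertex, from the block
    -- itself, on that side.
    t<∣P∣ : q ∈ P → t < ∣ P ∣
    t<∣P∣ q∈P = ≤-<-trans (≤-reflexive t≡) (p⊂q⇒∣p∣<∣q∣
      (∁⊆P , proj₁ P-end , proj₂ (proj₂ P-end) , x∈p⇒x∉∁p (proj₁ (proj₂ P-end))))
      where
      P-end = LeafStep.P-end sparse sep cross L y∉ a∈ b∈
      ∣Λ⁺y∣ : ∣ Λ⁺ L y ∣ ≡ suc s
      ∣Λ⁺y∣ = trans (∣Λ⁺∣ L y∉) (cong suc (size y∉))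
      t≡ : t ≡ ∣ ∁ (Λ⁺ L y) ∣
      t≡ = sym (trans (∣∁p∣≡n∸∣p∣ (Λ⁺ L y)) (trans (cong₂ _∸_ n≡ ∣Λ⁺y∣) (m+n∸m≡n s t)))
      v∈Λ⁺ : v ∈ Λ⁺ L y
      v∈Λ⁺ = tight⇒v∈ sparse sep cross a∈ b∈ (tight L y∉) (subst (3 ≤_) (sym ∣Λ⁺y∣) (m≤n⇒m≤1+n 2<s))
      ∁⊆P : ∁ (Λ⁺ L y) ⊆ P
      ∁⊆P {x} x∈∁ with x∈∁p⇒x∉p x∈∁ | x ∈? Core
      ... | x∉ | yes x∈C with C⊆pq x∈C
      ... | inj₁ refl = contradiction (subst (_∈ Λ⁺ L y) ηy≡p ∈-∪⁅⁆) x∉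
      ... | inj₂ refl = q∈P
      ∁⊆P {x} x∈∁ | x∉ | no x∉C with C⊆pq (η∈ L x∉C)
      ... | inj₁ ηx≡p = contradiction (∈-∪ˡ (unique x∉C ηx≡p)) x∉
      ... | inj₂ ηx≡q = tight⇒follows sparse sep (LeafStep.other-tight sparse sep cross L y∉ a∈ b∈ x∉C (x∉ ∘ ∈-∪ˡ))
        ∈-∪⁅⁆ (subst (_∈ P) (sym ηx≡q) q∈P) (∈-∪ˡ (self L x∉C)) λ { refl → x∉ v∈Λ⁺ }

  module _ {a b : Fin n} {es} (sparse : Sparse es) (step : Step s t (a , b) es) where
    open Step step

    -- An edge in the block at `p` would give a class with more than `t` vertices. For an edge in a
    -- block at `q`, the block of `z` is intact and avoids `v`, so it keeps `p` out of `S`; it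
    -- remains to see where `v` and `q` lie.
    stuckStep : ∀ {Core p q z} (L : Leaves ((a , b) ∷ es) Core) → p ∈ Core → q ∈ Core → (∀ {x} → x ∈ Core → x ≡ p ⊎ x ≡ q) → p ≢ q →
      (∀ {x y} → (x , y) ∈ˡ (a , b) ∷ es → x ∈ Core → y ∉ Core) → (∀ {x} → x ∉ Core → ∣ Λ L x ∣ ≡ s) →
      z ∉ Core → η L z ≡ p → (∀ {x} → x ∉ Core → η L x ≡ p → x ∈ Λ L z) → False
    stuckStep {Core} {p} {q} {z} L p∈C q∈C C⊆pq p≢q no-edge size z∉ ηz≡p unique with covers L (here refl)
    ... | inj₁ (a∈C , b∈C) = no-edge (here refl) a∈C b∈C
    ... | inj₂ (y , y∉ , a∈ , b∈) with C⊆pq (η∈ L y∉)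
    ... | inj₁ ηy≡p =
      [ (λ q∈S → <-asym s<t (subst (t <_) ∣S∣≡
          (StuckSide.t<∣P∣ sparse sep cross L C⊆pq size y∉ ηy≡p unique′ a∈ b∈ q∈S)))
      , (λ q∈T → <-irrefl (sym ∣T∣≡)
          (StuckSide.t<∣P∣ sparse (flip-sep sep) (swap cross) L C⊆pq size y∉ ηy≡p unique′ a∈ b∈ q∈T)) ]′
      (sep .cover q≢v)
      where
      unique′ : ∀ {x} → x ∉ Core → η L x ≡ p → x ∈ Λ L y
      unique′ x∉ ηx≡p = subst (_ ∈_) (sym (same L z∉ (unique y∉ ηy≡p))) (unique x∉ ηx≡p)
      v∈ : v ∈ Λ⁺ L y
      v∈ = tight⇒v∈ sparse sep cross a∈ b∈ (tight L y∉) (≤-trans (m≤n⇒m≤1+n 2<s) (leaf-size sparse step L size y∉))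
      q≢v : q ≢ v
      q≢v refl = [ (λ v∈Λ → off L y∉ v∈Λ q∈C) , (λ q≡η → p≢q (trans (sym ηy≡p) (sym q≡η))) ]′ (∈-∪⁅⁆⁻ v∈)
    stuckStep {Core} {p} {q} {z} L p∈C q∈C C⊆pq p≢q no-edge size z∉ ηz≡p unique | inj₂ (y , y∉ , a∈ , b∈) | inj₂ ηy≡q = go (v ∈? Core)
      where
      ηz≢ηy : η L z ≢ η L y
      ηz≢ηy eq = p≢q (trans (sym ηz≡p) (trans eq ηy≡q))
      v∈Λ⁺ : v ∈ Λ⁺ L y
      v∈Λ⁺ = tight⇒v∈ sparse sep cross a∈ b∈ (tight L y∉) (≤-trans (m≤n⇒m≤1+n 2<s) (leaf-size sparse step L size y∉))
      other : ∀ {x} → x ∉ Core → x ∉ Λ L y → Tight es (Λ⁺ L x)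
      other = LeafStep.other-tight sparse sep cross L y∉ a∈ b∈
      v∉other : ∀ {x} → x ∉ Core → x ∉ Λ L y → η L x ≢ η L y ⊎ v ∉ Core → v ∉ Λ⁺ L x
      v∉other x∉ x∉y h v∈x with ∈-∪⁅⁆⁻ v∈Λ⁺
      ... | inj₁ v∈Λy = x∉y (subst (_ ∈_) (meet L y∉ x∉ v∈Λy v∈x) (self L x∉))
      ... | inj₂ v≡ηy with ∈-∪⁅⁆⁻ v∈x
      ... | inj₁ v∈Λx = off L x∉ v∈Λx (subst (_∈ Core) (sym v≡ηy) (η∈ L y∉))
      ... | inj₂ v≡ηx = [ (λ ≢ → ≢ (trans (sym v≡ηx) v≡ηy)) , (λ v∉C → v∉C (subst (_∈ Core) (sym v≡ηy) (η∈ L y∉))) ]′ h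
      z∉Λy : z ∉ Λ L y
      z∉Λy z∈ = ηz≢ηy (η-same L y∉ z∈)
      v∉z : v ∉ Λ⁺ L z
      v∉z = v∉other z∉ z∉Λy (inj₁ ηz≢ηy)
      p∈z : p ∈ Λ⁺ L z
      p∈z = subst (_∈ Λ⁺ L z) ηz≡p ∈-∪⁅⁆
      p∉S : p ∉ S
      p∉S = tight-big⇒∉S sparse step (other z∉ z∉Λy) (leaf-size sparse step L size z∉) v∉z p∈z
      go : Dec (v ∈ Core) → False
      -- Here `v` is `q`, so `S` avoids the core.
      go (yes v∈C) = LeafStep.P-off-core⇒⊥ sparse sep cross L y∉ a∈ b∈ (λ x∉ → trans (size x∉) (sym ∣S∣≡)) v∈C ηy≡v S-off
        where
        ηy≡v : η L y ≡ v
        ηy≡v = [ (λ v∈Λ → contradiction v∈C (off L y∉ v∈Λ)) , sym ]′ (∈-∪⁅⁆⁻ v∈Λ⁺)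
        S-off : ∀ {x} → x ∈ S → x ∉ Core
        S-off x∈S x∈C with C⊆pq x∈C
        ... | inj₁ refl = p∉S x∈S
        ... | inj₂ refl = sep .v∉P (subst (_∈ S) (trans (sym ηy≡q) ηy≡v) x∈S)
      go (no v∉C) with sep .cover {η L y} (λ { refl → v∉C (η∈ L y∉) })
      -- The core avoids `S`, which therefore would have to fit into the leaf of `y`.
      ... | inj₂ η∈T = <-irrefl ∣S∣≡ (LeafStep.∣far-side∣ sparse (flip-sep sep) (swap cross) L y∉ a∈ b∈ 1<s
        (≤-reflexive (size y∉)) v∉C C⊆T η∈T)
        where
        C⊆T : ∀ {x w} → x ∈ Core → x ∈ T → w ∈ Core → w ∉ S
        C⊆T _ _ w∈C w∈S with C⊆pq w∈C
        ... | inj₁ refl = p∉S w∈S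
        ... | inj₂ refl = sep .disjoint w∈S (subst (_∈ T) ηy≡q η∈T)
      -- Blocks other than that of `y` avoid `v` and are too large for `S`. So `S` and `v` fit into
      -- the block of `y`, which has only `s + 1` vertices, one of them in `T`.
      ... | inj₁ η∈S = <-irrefl (trans (cong suc ∣S∣≡) (trans (cong suc (sym (size y∉))) (sym (∣Λ⁺∣ L y∉))))
        (subst (_< ∣ Λ⁺ L y ∣) (∣p∪⁅x⁆∣≡1+∣p∣ (sep .v∉P)) (p⊂q⇒∣p∣<∣q∣ (Sv⊆ , w , w∈ , w∉)))
        where
        T-end = LeafStep.Q-end sparse sep cross L y∉ a∈ b∈
        w = proj₁ T-end
        w∈ : w ∈ Λ⁺ L y
        w∈ = proj₁ (proj₂ T-end)
        w∉ : w ∉ S ∪ ⁅ v ⁆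
        w∉ w∈Sv = [ (λ w∈S → sep .disjoint w∈S (proj₂ (proj₂ T-end))) , ≢v (flip-sep sep) (proj₂ (proj₂ T-end)) ]′ (∈-∪⁅⁆⁻ w∈Sv)
        S⊆ : S ⊆ Λ⁺ L y
        S⊆ {x} x∈S with x ∈? Core | x ∈? Λ L y
        ... | _ | yes x∈y = ∈-∪ˡ x∈y
        ... | yes x∈C | no _ = [ (λ { refl → contradiction x∈S p∉S }) , (λ { refl → subst (_∈ Λ⁺ L y) ηy≡q ∈-∪⁅⁆ }) ]′ (C⊆pq x∈C)
        ... | no x∉C | no x∉y = contradiction x∈S (tight-big⇒∉S sparse step (other x∉C x∉y) (leaf-size sparse step L size x∉C)
          (v∉other x∉C x∉y (inj₂ v∉C)) (∈-∪ˡ (self L x∉C)))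
        Sv⊆ : S ∪ ⁅ v ⁆ ⊆ Λ⁺ L y
        Sv⊆ x∈ = [ S⊆ , (λ { refl → v∈Λ⁺ }) ]′ (∈-∪⁅⁆⁻ x∈)

    state-step : State ((a , b) ∷ es) → State es
    state-step (stuck L p∈ q∈ C⊆ p≢q no-edge size z∉ ηz unique) =
      ⊥-elim (stuckStep L p∈ q∈ C⊆ p≢q no-edge size z∉ ηz unique)
    state-step (star L c∈ C⊆ size) = starStep sparse step L c∈ C⊆ size
    state-step (core {Core} L tightC size big) with covers L (here refl)
    ... | inj₂ (z , z∉ , a∈ , b∈) = ⊥-elim (coreLeaf⇒⊥ sparse step L tightC size big z∉ a∈ b∈)
    ... | inj₁ (a∈C , b∈C) with 3 ≤? ∣ Core ∣
    ... | yes 3≤C = CoreStep.toCore sparse step L tightC size a∈C b∈C 3≤C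
    ... | no 3≰C = coreSplit sparse step L size
      ([ (λ s<C → contradiction (≤-trans 2<s (≤-trans (n≤1+n _) (<⇒≤ s<C))) 3≰C) , id ]′ big) a∈C b∈C 3≰C

  -- Every state contains a tight set, in the star the block of some vertex other than `c`, and a
  -- tight set spans an edge.
  ¬state-[] : ¬ State []
  ¬state-[] = λ
    { (core {Core} L tightC _ _) → ¬tight-[] Core tightC
    ; (stuck {z = z} L _ _ _ _ _ _ z∉ _ _) → ¬tight-[] (Λ⁺ L z) (tight L z∉)
    ; (star {c = c} L _ C⊆c _) → let x , _ , x≢c = 2≤∣p∣⇒other ⊤ c 2≤n in ¬tight-[] (Λ⁺ L x) (tight L {x} (x≢c ∘ C⊆c)) }
    where
    ¬tight-[] : ∀ W → ¬ Tight {n} [] W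
    ¬tight-[] W (2≤ , eq) = <-irrefl eq (*-monoʳ-≤ 2 2≤)
    2≤n : 2 ≤ ∣ ⊤ {n} ∣
    2≤n = subst (2 ≤_) (sym (trans (∣⊤∣≡n n) n≡)) (m≤n⇒m≤1+n (≤-trans 1<s (m≤m+n s t)))

-- Dismantlings and the upper bound on their length

Dismantling : (s t : ℕ) → List (Edge n) → Set
Dismantling s t []       = Unit
Dismantling s t (e ∷ es) = Step s t e es × Dismantling s t es

dismantling⇒sparse : ∀ {s t} {es : List (Edge n)} → Dismantling s t es → Sparse es
dismantling⇒sparse {es = []} _ = Sparse-[]
dismantling⇒sparse {es = _ ∷ _} (step , d) = Sparse-∷ (dismantling⇒sparse d) (Step.sep step) (Step.cross step)

e[⊤]≡length : ∀ (es : List (Edge n)) → e[ ⊤ ] es ≡ length es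
e[⊤]≡length [] = refl
e[⊤]≡length (x ∷ es) = trans (e-in es ∈⊤ ∈⊤) (cong suc (e[⊤]≡length es))

-- Laman's condition for the whole vertex set gives `3 + length es ≤ 2 * n`. Equality would make it
-- a `core` without leaves, and a `State` survives until no edge is left.
dismantling-bound : ∀ {s t n} → 2 < s → s < t → n ≡ suc (s + t) → (es : List (Edge n)) → Dismantling s t es →
                    4 + length es ≤ 2 * n
dismantling-bound {s} {t} {n} 2<s s<t n≡ es d = ≤∧≢⇒< bound (no-state d ∘ initial)
  where
  open Deadlock 2<s s<t n≡
  n≡∣⊤∣ : n ≡ ∣ ⊤ {n} ∣
  n≡∣⊤∣ = sym (∣⊤∣≡n n)
  s+2≤n : suc s < n
  s+2≤n = subst (suc s <_) (sym n≡) (s≤s (m<m+n s (≤-trans (s≤s z≤n) s<t)))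
  bound : 3 + length es ≤ 2 * n
  bound = subst₂ (λ k m → 3 + k ≤ 2 * m) (e[⊤]≡length es) (∣⊤∣≡n n)
    (proj₂ (dismantling⇒sparse d ⊤) (subst (2 ≤_) n≡∣⊤∣ (≤-trans (s≤s (≤-trans (s≤s z≤n) 2<s)) (<⇒≤ s+2≤n))))
  initial : 3 + length es ≡ 2 * n → State es
  initial eq = core record
    -- No vertex lies off the core `⊤`, so these values are arbitrary.
    { Λ = λ x → ⊤ ; η = id ; self = λ x∉ → ⊥-elim (x∉ ∈⊤) ; off = λ x∉ → ⊥-elim (x∉ ∈⊤) ; same = λ x∉ → ⊥-elim (x∉ ∈⊤)
    ; η-same = λ x∉ → ⊥-elim (x∉ ∈⊤) ; η∈ = λ x∉ → ⊥-elim (x∉ ∈⊤) ; tight = λ x∉ → ⊥-elim (x∉ ∈⊤)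
    ; covers = λ _ → inj₁ (∈⊤ , ∈⊤) }
    ( subst (2 ≤_) n≡∣⊤∣ (≤-trans (s≤s (≤-trans (s≤s z≤n) 2<s)) (<⇒≤ s+2≤n))
    , subst₂ (λ k m → 3 + k ≡ 2 * m) (sym (e[⊤]≡length es)) n≡∣⊤∣ eq)
    (λ x∉ → ⊥-elim (x∉ ∈⊤)) (inj₁ (subst (suc s <_) n≡∣⊤∣ s+2≤n))
  no-state : ∀ {es} → Dismantling s t es → ¬ State es
  no-state {[]} _ = ¬state-[]
  no-state {_ ∷ _} (step , d) = no-state d ∘ state-step (dismantling⇒sparse d) step

-- Construction of dismantlable graphs

segment : ∀ n → ℕ → ℕ → Subset n
segment zero    _       _       = []
segment (suc n) zero    zero    = outside ∷ segment n zero zero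
segment (suc n) zero    (suc k) = inside ∷ segment n zero k
segment (suc n) (suc a) k       = outside ∷ segment n a k

InSegment : ℕ → ℕ → ℕ → Set
InSegment a k i = a ≤ i × i < a + k

∈segment⁺ : ∀ {n a k} {x : Fin n} → InSegment a k (toℕ x) → x ∈ segment n a k
∈segment⁺ {suc n} {zero}  {suc k} {zero}  (_ , _)           = here
∈segment⁺ {suc n} {zero}  {suc k} {suc x} (_ , s≤s x<)      = there (∈segment⁺ (z≤n , x<))
∈segment⁺ {suc n} {suc a} {k}     {suc x} (s≤s a≤ , s≤s x<) = there (∈segment⁺ (a≤ , x<))

∈segment⁻ : ∀ {n a k} {x : Fin n} → x ∈ segment n a k → InSegment a k (toℕ x)
∈segment⁻ {suc n} {zero}  {zero}  (there x∈) with () ← proj₂ (∈segment⁻ x∈)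
∈segment⁻ {suc n} {zero}  {suc k} here       = z≤n , s≤s z≤n
∈segment⁻ {suc n} {zero}  {suc k} (there x∈) = z≤n , s≤s (proj₂ (∈segment⁻ x∈))
∈segment⁻ {suc n} {suc a} {k}     (there x∈) = let a≤ , x< = ∈segment⁻ x∈ in s≤s a≤ , s≤s x<

∣segment∣ : ∀ n a k → a + k ≤ n → ∣ segment n a k ∣ ≡ k
∣segment∣ zero    zero    zero    _         = refl
∣segment∣ (suc n) zero    zero    _         = ∣segment∣ n zero zero z≤n
∣segment∣ (suc n) zero    (suc k) (s≤s k≤)  = cong suc (∣segment∣ n zero k k≤)
∣segment∣ (suc n) (suc a) k       (s≤s ak≤) = ∣segment∣ n a k ak≤

-- Two intervals suffice for each `S` of the construction: cyclic intervals of the path, and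
-- intervals with one vertex added or removed. Either interval may be empty.
record Segments (s n : ℕ) : Set where
  constructor segs
  field
    a k b l : ℕ
    ordered : a + k ≤ b
    fits    : b + l ≤ n
    total   : k + l ≡ s

module _ {s n} (U : Segments s n) where
  open Segments U

  In : ℕ → Set
  In i = InSegment a k i ⊎ InSegment b l i

  In? : ∀ i → Dec (In i)
  In? i = (a ≤? i ×-dec i <? a + k) ⊎-dec (b ≤? i ×-dec i <? b + l)

  toSubset : Subset n
  toSubset = segment n a k ∪ segment n b l

  ∈toSubset⁺ : ∀ {x} → In (toℕ x) → x ∈ toSubset
  ∈toSubset⁺ (inj₁ h) = x∈p∪q⁺ (inj₁ (∈segment⁺ h))
  ∈toSubset⁺ (inj₂ h) = x∈p∪q⁺ {p = segment n a k} (inj₂ (∈segment⁺ h))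

  ∈toSubset⁻ : ∀ {x} → x ∈ toSubset → In (toℕ x)
  ∈toSubset⁻ x∈ = Data.Sum.map ∈segment⁻ ∈segment⁻ (x∈p∪q⁻ (segment n a k) (segment n b l) x∈)

  ∣toSubset∣ : ∣ toSubset ∣ ≡ s
  ∣toSubset∣ = trans (∣p⊎q∣≡∣p∣+∣q∣ (segment n a k) (segment n b l) λ x∈ x∈′ →
      <⇒≱ (proj₂ (∈segment⁻ {a = a} {k} x∈)) (≤-trans ordered (proj₁ (∈segment⁻ {a = b} {l} x∈′))))
    (trans (cong₂ _+_ (∣segment∣ n a k (≤-trans ordered (≤-trans (m≤m+n b l) fits))) (∣segment∣ n b l fits)) total)

  outside-segments : ∀ {i} → i < a ⊎ a + k ≤ i → i < b ⊎ b + l ≤ i → ¬ In i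
  outside-segments h₁ h₂ (inj₁ (a≤ , i<)) = [ (λ i<a → <⇒≱ i<a a≤) , <⇒≱ i< ]′ h₁
  outside-segments h₁ h₂ (inj₂ (b≤ , i<)) = [ (λ i<b → <⇒≱ i<b b≤) , <⇒≱ i< ]′ h₂

  -- A path edge `{i - 1 , i}` can leave or enter `U` only at such an `i`.
  Boundary : ℕ → Set
  Boundary i = i ≡ a ⊎ i ≡ a + k ⊎ i ≡ b ⊎ i ≡ b + l

  Uniform : ℕ → ℕ → Set
  Uniform i j = In i × In j ⊎ ¬ In i × ¬ In j

  uniform : ∀ {i} → ¬ Boundary (suc i) → Uniform i (suc i)
  uniform {i} ¬boundary with In? i | In? (suc i)
  ... | yes p | yes q = inj₁ (p , q)
  ... | no p | no q = inj₂ (p , q)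
  ... | yes (inj₁ (a≤ , i<)) | no q = contradiction (inj₁ (m≤n⇒m≤1+n a≤ , ≤∧≢⇒< i< (¬boundary ∘ inj₂ ∘ inj₁))) q
  ... | yes (inj₂ (b≤ , i<)) | no q = contradiction (inj₂ (m≤n⇒m≤1+n b≤ , ≤∧≢⇒< i< (¬boundary ∘ inj₂ ∘ inj₂ ∘ inj₂))) q
  ... | no p | yes (inj₁ (a≤ , i<)) = contradiction (inj₁ (s≤s⁻¹ (≤∧≢⇒< a≤ (¬boundary ∘ inj₁ ∘ sym)) , <⇒≤ i<)) p
  ... | no p | yes (inj₂ (b≤ , i<)) = contradiction (inj₂ (s≤s⁻¹ (≤∧≢⇒< b≤ (¬boundary ∘ inj₂ ∘ inj₂ ∘ inj₁ ∘ sym)) , <⇒≤ i<)) p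

shift : ∀ {s m} r {n} → r + m ≤ n → Segments s m → Segments s n
shift r r+m≤n (segs a k b l ordered fits total) = segs (r + a) k (r + b) l
  (≤-trans (≤-reflexive (+-assoc r a k)) (+-monoʳ-≤ r ordered))
  (≤-trans (≤-reflexive (+-assoc r b l)) (≤-trans (+-monoʳ-≤ r fits) r+m≤n)) total

module _ {s m} r {n} (r+m≤n : r + m ≤ n) (U : Segments s m) where
  open Segments U

  In-shift⁺ : ∀ {i} → In U i → In (shift r r+m≤n U) (r + i)
  In-shift⁺ = Data.Sum.map
    (λ (a≤ , i<) → +-monoʳ-≤ r a≤ , ≤-trans (+-monoʳ-< r i<) (≤-reflexive (sym (+-assoc r a k))))
    (λ (b≤ , i<) → +-monoʳ-≤ r b≤ , ≤-trans (+-monoʳ-< r i<) (≤-reflexive (sym (+-assoc r b l))))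

  In-shift⁻ : ∀ {i} → In (shift r r+m≤n U) (r + i) → In U i
  In-shift⁻ {i} = Data.Sum.map
    (λ (a≤ , i<) → +-cancelˡ-≤ r _ _ a≤ , +-cancelˡ-< r i _ (≤-trans i< (≤-reflexive (+-assoc r a k))))
    (λ (b≤ , i<) → +-cancelˡ-≤ r _ _ b≤ , +-cancelˡ-< r i _ (≤-trans i< (≤-reflexive (+-assoc r b l))))

  In-shift-bounds : ∀ {i} → In (shift r r+m≤n U) i → r ≤ i × i < r + m
  In-shift-bounds (inj₁ (a≤ , i<)) = ≤-trans (m≤m+n r a) a≤ ,
    ≤-trans i< (≤-trans (≤-reflexive (+-assoc r a k)) (+-monoʳ-≤ r (≤-trans ordered (≤-trans (m≤m+n b l) fits))))
  In-shift-bounds (inj₂ (b≤ , i<)) = ≤-trans (m≤m+n r b) b≤ ,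
    ≤-trans i< (≤-trans (≤-reflexive (+-assoc r b l)) (+-monoʳ-≤ r fits))

-- Dismantlings with vertices labelled by natural numbers

Edgeℕ : Set
Edgeℕ = ℕ × ℕ

module Labels (s t : ℕ) where

  N : ℕ
  N = suc (s + t)

  -- Reduction modulo `N` only makes the labelling total; the labels in use are below `N`.
  ⟨_⟩ : ℕ → Fin N
  ⟨ i ⟩ = i mod N

  toℕ⟨_⟩ : ∀ {i} → i < N → toℕ ⟨ i ⟩ ≡ i
  toℕ⟨ i<N ⟩ = trans (toℕ-fromℕ< _) (m<n⇒m%n≡m i<N)

  ⟨⟩-injective : ∀ {i j} → i < N → j < N → ⟨ i ⟩ ≡ ⟨ j ⟩ → i ≡ j
  ⟨⟩-injective i< j< eq = trans (sym toℕ⟨ i< ⟩) (trans (cong toℕ eq) toℕ⟨ j< ⟩)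

  edge : Edgeℕ → Edge N
  edge (i , j) = ⟨ i ⟩ , ⟨ j ⟩

  edges : List Edgeℕ → List (Edge N)
  edges = map edge

  Uncrossed : ℕ → Segments s N → Edgeℕ → Set
  Uncrossed v U (i , j) = (i < N × j < N) × (i ≡ v ⊎ j ≡ v ⊎ Uniform U i j)

  -- The class with `t` vertices is not stored: it is everything outside `U` and `v`, so its size
  -- follows from that of `U`.
  record Stepℕ (e : Edgeℕ) (es : List Edgeℕ) : Set where
    field
      v      : ℕ
      U      : Segments s N
      v<N    : v < N
      v∉U    : ¬ In U v
      bounds : proj₁ e < N × proj₂ e < N
      avoids : proj₁ e ≢ v × proj₂ e ≢ v
      crosses : In U (proj₁ e) × ¬ In U (proj₂ e) ⊎ ¬ In U (proj₁ e) × In U (proj₂ e)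
      uncrossed : All (Uncrossed v U) es

  toStep : ∀ {e es} → Stepℕ e es → Step s t (edge e) (edges es)
  toStep {i , j} {es} step = record
    { v = ⟨ v ⟩ ; S = S ; T = ∁ S⁺ ; ∣S∣≡ = ∣toSubset∣ U ; ∣T∣≡ = ∣T∣
    ; sep = record
      { v∉P = v∉S ; v∉Q = x∈p⇒x∉∁p ∈-∪⁅⁆ ; disjoint = λ x∈S x∈T → x∈∁p⇒x∉p x∈T (∈-∪ˡ x∈S)
      ; cover = cover′ ; free = free′ ∘ ∈-map⁻ edge }
    ; cross = Data.Sum.map (λ (i∈ , j∉) → ∈S (proj₁ bounds) i∈ , ∈T (proj₂ bounds) (proj₂ avoids) j∉)
                           (λ (i∉ , j∈) → ∈T (proj₁ bounds) (proj₁ avoids) i∉ , ∈S (proj₂ bounds) j∈) crosses }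
    where
    open Stepℕ step
    S S⁺ : Subset N
    S = toSubset U
    S⁺ = S ∪ ⁅ ⟨ v ⟩ ⁆
    ∈S : ∀ {i} → i < N → In U i → ⟨ i ⟩ ∈ S
    ∈S i< h = ∈toSubset⁺ U (subst (In U) (sym toℕ⟨ i< ⟩) h)
    ∈S⁻ : ∀ {i} → i < N → ⟨ i ⟩ ∈ S → In U i
    ∈S⁻ i< h = subst (In U) toℕ⟨ i< ⟩ (∈toSubset⁻ U h)
    v∉S : ⟨ v ⟩ ∉ S
    v∉S = v∉U ∘ ∈S⁻ v<N
    ∈T : ∀ {i} → i < N → i ≢ v → ¬ In U i → ⟨ i ⟩ ∈ ∁ S⁺
    ∈T i< i≢v i∉ = x∉p⇒x∈∁p λ i∈ → [ i∉ ∘ ∈S⁻ i< , i≢v ∘ ⟨⟩-injective i< v<N ]′ (∈-∪⁅⁆⁻ i∈)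
    ∣T∣ : ∣ ∁ S⁺ ∣ ≡ t
    ∣T∣ = trans (∣∁p∣≡n∸∣p∣ S⁺) (trans (cong (N ∸_) (trans (∣p∪⁅x⁆∣≡1+∣p∣ v∉S) (cong suc (∣toSubset∣ U)))) (m+n∸m≡n s t))
    cover′ : ∀ {x} → x ≢ ⟨ v ⟩ → x ∈ S ⊎ x ∈ ∁ S⁺
    cover′ {x} x≢v with x ∈? S
    ... | yes x∈S = inj₁ x∈S
    ... | no x∉S = inj₂ (x∉p⇒x∈∁p λ x∈ → [ x∉S , x≢v ]′ (∈-∪⁅⁆⁻ x∈))
    free′ : ∀ {x y} → ∃[ e ] (e ∈ˡ es × (x , y) ≡ edge e) → ¬ (x ∈ S × y ∈ ∁ S⁺ ⊎ x ∈ ∁ S⁺ × y ∈ S)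
    free′ ((i , j) , e∈ , refl) c with lookup uncrossed e∈
    ... | _ , inj₁ refl = [ v∉S ∘ proj₁ , (λ (v∈ , _) → x∈∁p⇒x∉p v∈ ∈-∪⁅⁆) ]′ c
    ... | _ , inj₂ (inj₁ refl) = [ (λ (_ , v∈) → x∈∁p⇒x∉p v∈ ∈-∪⁅⁆) , v∉S ∘ proj₂ ]′ c
    ... | (i< , j<) , inj₂ (inj₂ (inj₁ (i∈ , j∈))) =
      [ (λ (_ , j∈T) → x∈∁p⇒x∉p j∈T (∈-∪ˡ (∈S j< j∈))) , (λ (i∈T , _) → x∈∁p⇒x∉p i∈T (∈-∪ˡ (∈S i< i∈))) ]′ c
    ... | (i< , j<) , inj₂ (inj₂ (inj₂ (i∉ , j∉))) = [ i∉ ∘ ∈S⁻ i< ∘ proj₁ , j∉ ∘ ∈S⁻ j< ∘ proj₂ ]′ c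

  Dismantlingℕ : List Edgeℕ → Set
  Dismantlingℕ []       = Unit
  Dismantlingℕ (e ∷ es) = Stepℕ e es × Dismantlingℕ es

  toDismantling : ∀ {es} → Dismantlingℕ es → Dismantling s t (edges es)
  toDismantling {[]} _ = tt
  toDismantling {_ ∷ _} (step , d) = toStep step , toDismantling d


-- j stands for the edge {j , j + 1} of the path 0 , … , t - 1, and js are the edges to be deleted later.
-- The s vertices off the path, which are not cut yet, go to the side of the complement of U.
record Cut (s t j : ℕ) (js : List ℕ) : Set where
  field
    U       : Segments s t
    crosses : In U j × ¬ In U (suc j) ⊎ ¬ In U j × In U (suc j)
    rest    : All (λ i → ¬ Boundary U (suc i)) js

Schedule : ℕ → ℕ → List ℕ → Set
Schedule s t []       = Unit
Schedule s t (j ∷ js) = suc j < t × Cut s t j js × Schedule s t js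

module Construction (r t : ℕ) (s<t : suc (suc r) < t) where

  s : ℕ
  s = suc (suc r)

  open Labels s t

  -- The vertices below s are joined to 0 and 1 (zeros, ones); s , … , s + t - 1 is the path and s + t the hub.
  zeros ones stars : ℕ → List Edgeℕ
  zeros zero    = []
  zeros (suc i) = (0 , suc i) ∷ zeros i
  ones zero     = zeros (suc r)
  ones (suc i)  = (1 , suc (suc i)) ∷ ones i
  stars zero    = ones r
  stars (suc i) = (s + i , s + t) ∷ stars i

  paths : List ℕ → List Edgeℕ
  paths []       = stars t
  paths (j ∷ js) = (s + j , s + suc j) ∷ paths js

  graph : List ℕ → List Edgeℕ
  graph js = (0 , s) ∷ (0 , suc s) ∷ paths js

  -- Each list ends with the lists to be deleted later, so it comprises all edges left at its stage.
  module _ (P : Edgeℕ → Set) where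

    all-zeros : ∀ k → (∀ i → i < k → P (0 , suc i)) → All P (zeros k)
    all-zeros zero    h = []
    all-zeros (suc k) h = h k ≤-refl ∷ all-zeros k λ i i<k → h i (m≤n⇒m≤1+n i<k)

    all-ones : (∀ i → i < suc r → P (0 , suc i)) → ∀ k → (∀ i → i < k → P (1 , suc (suc i))) → All P (ones k)
    all-ones z zero    h = all-zeros (suc r) z
    all-ones z (suc k) h = h k ≤-refl ∷ all-ones z k λ i i<k → h i (m≤n⇒m≤1+n i<k)

    all-stars : (∀ i → i < suc r → P (0 , suc i)) → (∀ i → i < r → P (1 , suc (suc i))) →
                ∀ k → (∀ i → i < k → P (s + i , s + t)) → All P (stars k)
    all-stars z o zero    h = all-ones z r o
    all-stars z o (suc k) h = h k ≤-refl ∷ all-stars z o k λ i i<k → h i (m≤n⇒m≤1+n i<k)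

    all-paths : (∀ i → i < suc r → P (0 , suc i)) → (∀ i → i < r → P (1 , suc (suc i))) →
                (∀ i → i < t → P (s + i , s + t)) →
                ∀ {js} → All (λ j → P (s + j , s + suc j)) js → All P (paths js)
    all-paths z o st []       = all-stars z o t st
    all-paths z o st (h ∷ hs) = h ∷ all-paths z o st hs

  ≤s<N : ∀ {i} → i ≤ s → i < N
  ≤s<N i≤s = s≤s (≤-trans i≤s (m≤m+n s t))

  s+<N : ∀ {i} → i ≤ t → s + i < N
  s+<N i≤t = s≤s (+-monoʳ-≤ s i≤t)

  0<t : 0 < t
  0<t = ≤-trans (s≤s z≤n) s<t

  <s : ∀ {i} → i < suc r → suc i < s
  <s = s≤s

  zero-step : ∀ i → i < suc r → Stepℕ (0 , suc i) (zeros i)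
  zero-step i i<r = record
    { v = s + t ; U = U ; v<N = ≤-refl
    ; v∉U = outside-segments U (inj₂ (≤-trans ord (m≤m+n s t))) (inj₂ (+-monoʳ-≤ s (<⇒≤ (<-trans ≤-refl s<t))))
    ; bounds = s≤s z≤n , ≤s<N (<⇒≤ (<s i<r))
    ; avoids = (λ ()) , <⇒≢ (≤-trans (<s i<r) (m≤m+n s t))
    ; crosses = inj₂ (outside-segments U (inj₁ (s≤s z≤n)) (inj₁ (s≤s z≤n)) , inj₁ (≤-refl , m<m+n (suc i) (s≤s z≤n)))
    ; uncrossed = all-zeros _ i λ j j<i → (s≤s z≤n , ≤s<N (<⇒≤ (<s (<-trans j<i i<r)))) ,
        inj₂ (inj₂ (inj₂ (outside-segments U (inj₁ (s≤s z≤n)) (inj₁ (s≤s z≤n)) ,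
                          outside-segments U (inj₁ (s≤s j<i)) (inj₁ (<s (<-trans j<i i<r)))))) }
    where
    ord : suc i + 1 ≤ s
    ord = ≤-trans (≤-reflexive (+-comm (suc i) 1)) (<s i<r)
    -- The vertex `suc i` and `suc r` path vertices, which are isolated by now.
    U : Segments s N
    U = segs (suc i) 1 s (suc r) ord (≤-trans (+-monoʳ-≤ s (<⇒≤ (<-trans ≤-refl s<t))) (n≤1+n _)) refl

  one-step : ∀ i → i < r → Stepℕ (1 , suc (suc i)) (ones i)
  one-step i i<r = record
    -- With `v = 0` the edges at 0 do not matter.
    { v = 0 ; U = U ; v<N = s≤s z≤n
    ; v∉U = outside-segments U (inj₁ (s≤s z≤n)) (inj₁ (s≤s z≤n))
    ; bounds = ≤s<N (s≤s z≤n) , ≤s<N (s≤s (s≤s (<⇒≤ i<r)))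
    ; avoids = (λ ()) , (λ ())
    ; crosses = inj₂ (1∉ , inj₁ (≤-refl , m<m+n (suc (suc i)) (s≤s z≤n)))
    ; uncrossed = all-ones _
        (λ j j<r → (s≤s z≤n , ≤s<N (<⇒≤ (<s j<r))) , inj₁ refl) i
        (λ j j<i → (≤s<N (s≤s z≤n) , ≤s<N (s≤s (s≤s (<⇒≤ (<-trans j<i i<r))))) ,
          inj₂ (inj₂ (inj₂ (1∉ , outside-segments U (inj₁ (s≤s (s≤s j<i))) (inj₁ (s≤s (s≤s (<-trans j<i i<r)))))))) }
    where
    ord : suc (suc i) + 1 ≤ s
    ord = ≤-trans (≤-reflexive (+-comm (suc (suc i)) 1)) (s≤s (s≤s i<r))
    U : Segments s N
    U = segs (suc (suc i)) 1 s (suc r) ord (≤-trans (+-monoʳ-≤ s (<⇒≤ (<-trans ≤-refl s<t))) (n≤1+n _)) refl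
    1∉ : ¬ In U 1
    1∉ = outside-segments U (inj₁ (s≤s (s≤s z≤n))) (inj₁ (s≤s (s≤s z≤n)))

  star-step : ∀ i → i < t → Stepℕ (s + i , s + t) (stars i)
  star-step i i<t = record
    { v = 0 ; U = U ; v<N = s≤s z≤n
    ; v∉U = outside-segments U (inj₁ (s≤s z≤n)) (inj₁ (s≤s z≤n))
    ; bounds = s+<N (<⇒≤ i<t) , ≤-refl
    ; avoids = (λ ()) , (λ ())
    ; crosses = inj₁ (inj₂ (≤-refl , m<m+n (s + i) (s≤s z≤n)) , h∉)
    ; uncrossed = all-stars _
        (λ j j<r → (s≤s z≤n , ≤s<N (<⇒≤ (<s j<r))) , inj₁ refl)
        (λ j j<r → (≤s<N (s≤s z≤n) , ≤s<N (s≤s (s≤s (<⇒≤ j<r)))) ,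
          inj₂ (inj₂ (inj₁ (inj₁ (≤-refl , s≤s (s≤s z≤n)) , inj₁ (s≤s z≤n , s≤s (s≤s j<r)))))) i
        (λ j j<i → (s+<N (<⇒≤ (<-trans j<i i<t)) , ≤-refl) ,
          inj₂ (inj₂ (inj₂ (outside-segments U (inj₂ (m≤m+n s j)) (inj₁ (+-monoʳ-< s j<i)) , h∉)))) }
    where
    -- All base vertices other than `v = 0`, and the end of the spoke: the edges at 1 that avoid 0
    -- stay inside.
    U : Segments s N
    U = segs 1 (suc r) (s + i) 1 (m≤m+n s i) (≤-trans (≤-reflexive (+-comm (s + i) 1)) (s+<N (<⇒≤ i<t))) (+-comm (suc r) 1)
    h∉ : ¬ In U (s + t)
    h∉ = outside-segments U (inj₂ (m≤m+n s t)) (inj₂ (≤-trans (≤-reflexive (+-comm (s + i) 1)) (+-monoʳ-< s i<t)))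

  -- The hub is `v`, so the spokes do not matter; the vertices below `s` stay outside `U` and have
  -- no edges to the path any more.
  path-step : ∀ {j js} → suc j < t → All (λ j → suc j < t) js → Cut s t j js → Stepℕ (s + j , s + suc j) (paths js)
  path-step {j} {js} j<t js<t cut = record
    { v = s + t ; U = U⁺ ; v<N = ≤-refl
    ; v∉U = λ h → <-irrefl refl (proj₂ (In-shift-bounds s (n≤1+n _) U h))
    ; bounds = s+<N (<⇒≤ (<⇒≤ j<t)) , s+<N (<⇒≤ j<t)
    ; avoids = <⇒≢ (+-monoʳ-< s (<⇒≤ j<t)) , <⇒≢ (+-monoʳ-< s j<t)
    ; crosses = Data.Sum.map (λ (p , q) → shift⁺ p , q ∘ shift⁻) (λ (p , q) → p ∘ shift⁻ , shift⁺ q) (Cut.crosses cut)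
    ; uncrossed = all-paths _
        (λ i i<r → (s≤s z≤n , ≤s<N (<⇒≤ (<s i<r))) , inj₂ (inj₂ (inj₂ (low (s≤s z≤n) , low (<s i<r)))))
        (λ i i<r → (≤s<N (s≤s z≤n) , ≤s<N (s≤s (s≤s (<⇒≤ i<r)))) , inj₂ (inj₂ (inj₂ (low (s≤s (s≤s z≤n)) , low (s≤s (s≤s i<r))))))
        (λ i i<t → (s+<N (<⇒≤ i<t) , ≤-refl) , inj₂ (inj₁ refl))
        (All.zipWith (λ (i<t , ¬b) → (s+<N (<⇒≤ (<⇒≤ i<t)) , s+<N (<⇒≤ i<t)) , inj₂ (inj₂ (uniform⁺ (uniform U ¬b)))) (js<t , Cut.rest cut)) }
    where
    U : Segments s t
    U = Cut.U cut
    U⁺ : Segments s N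
    U⁺ = shift s (n≤1+n _) U
    shift⁺ : ∀ {i} → In U i → In U⁺ (s + i)
    shift⁺ = In-shift⁺ s (n≤1+n _) U
    shift⁻ : ∀ {i} → In U⁺ (s + i) → In U i
    shift⁻ = In-shift⁻ s (n≤1+n _) U
    low : ∀ {i} → i < s → ¬ In U⁺ i
    low i<s h = <⇒≱ i<s (proj₁ (In-shift-bounds s (n≤1+n _) U h))
    uniform⁺ : ∀ {i} → Uniform U i (suc i) → Uniform U⁺ (s + i) (s + suc i)
    uniform⁺ (inj₁ (p , q)) = inj₁ (shift⁺ p , shift⁺ q)
    uniform⁺ (inj₂ (p , q)) = inj₂ (p ∘ shift⁻ , q ∘ shift⁻)

  bases : Segments s N
  bases = segs 0 s s 0 ≤-refl (≤-trans (+-monoʳ-≤ s (z≤n {suc t})) (≤-reflexive (+-suc s t))) (+-identityʳ s)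

  ≥s∉bases : ∀ {i} → s ≤ i → ¬ In bases i
  ≥s∉bases s≤i = outside-segments bases (inj₂ s≤i) (inj₂ (≤-trans (≤-reflexive (+-identityʳ s)) s≤i))

  <s∈bases : ∀ {i} → i < s → In bases i
  <s∈bases i<s = inj₁ (z≤n , i<s)

  base-uncrossed : ∀ v {js} → All (λ j → suc j < t) js → All (Uncrossed v bases) (paths js)
  base-uncrossed v js<t = all-paths _
    (λ i i<r → (s≤s z≤n , ≤s<N (<⇒≤ (<s i<r))) , inj₂ (inj₂ (inj₁ (<s∈bases (s≤s z≤n) , <s∈bases (<s i<r)))))
    (λ i i<r → (≤s<N (s≤s z≤n) , ≤s<N (s≤s (s≤s (<⇒≤ i<r)))) ,
      inj₂ (inj₂ (inj₁ (<s∈bases (s≤s (s≤s z≤n)) , <s∈bases (s≤s (s≤s i<r))))))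
    (λ i i<t → (s+<N (<⇒≤ i<t) , ≤-refl) , inj₂ (inj₂ (inj₂ (≥s∉bases (m≤m+n s i) , ≥s∉bases (m≤m+n s t)))))
    (All.map (λ i<t → (s+<N (<⇒≤ (<⇒≤ i<t)) , s+<N (<⇒≤ i<t)) ,
      inj₂ (inj₂ (inj₂ (≥s∉bases (m≤m+n s _) , ≥s∉bases (m≤m+n s _))))) js<t)

  ss<N : suc s < N
  ss<N = s≤s (m<m+n s 0<t)

  zeros-dismantling : ∀ k → k ≤ suc r → Dismantlingℕ (zeros k)
  zeros-dismantling zero    _ = tt
  zeros-dismantling (suc k) h = zero-step k h , zeros-dismantling k (<⇒≤ h)

  ones-dismantling : ∀ k → k ≤ r → Dismantlingℕ (ones k)
  ones-dismantling zero    _ = zeros-dismantling (suc r) ≤-refl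
  ones-dismantling (suc k) h = one-step k h , ones-dismantling k (<⇒≤ h)

  stars-dismantling : ∀ k → k ≤ t → Dismantlingℕ (stars k)
  stars-dismantling zero    _ = ones-dismantling r ≤-refl
  stars-dismantling (suc k) h = star-step k h , stars-dismantling k (<⇒≤ h)

  schedule-bounds : ∀ js → Schedule s t js → All (λ j → suc j < t) js
  schedule-bounds []       _              = []
  schedule-bounds (j ∷ js) (j<t , _ , sc) = j<t ∷ schedule-bounds js sc

  paths-dismantling : ∀ js → Schedule s t js → Dismantlingℕ (paths js)
  paths-dismantling []       _                = stars-dismantling t ≤-refl
  paths-dismantling (j ∷ js) (j<t , cut , sc) = path-step j<t (schedule-bounds js sc) cut , paths-dismantling js sc

  -- The vertices below `s` form one class. For the first joining edge, `v` is the end of the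
  -- second; when the second is the only one left, `s` can be `v` instead.
  graph-dismantling : ∀ js → Schedule s t js → Dismantlingℕ (graph js)
  graph-dismantling js sc =
    record
      { v = suc s ; U = bases ; v<N = ss<N ; v∉U = ≥s∉bases (n≤1+n s)
      ; bounds = s≤s z≤n , ≤s<N ≤-refl ; avoids = (λ ()) , <⇒≢ ≤-refl
      ; crosses = inj₁ (<s∈bases (s≤s z≤n) , ≥s∉bases ≤-refl)
      ; uncrossed = ((s≤s z≤n , ss<N) , inj₂ (inj₁ refl)) ∷ base-uncrossed (suc s) (schedule-bounds js sc) } ,
    record
      { v = s ; U = bases ; v<N = ≤s<N ≤-refl ; v∉U = ≥s∉bases ≤-refl
      ; bounds = s≤s z≤n , ss<N ; avoids = (λ ()) , ≢-sym (<⇒≢ ≤-refl)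
      ; crosses = inj₁ (<s∈bases (s≤s z≤n) , ≥s∉bases (n≤1+n s))
      ; uncrossed = base-uncrossed s (schedule-bounds js sc) } ,
    paths-dismantling js sc

  length-zeros : ∀ k → length (zeros k) ≡ k
  length-zeros zero    = refl
  length-zeros (suc k) = cong suc (length-zeros k)

  length-ones : ∀ k → length (ones k) ≡ k + suc r
  length-ones zero    = length-zeros (suc r)
  length-ones (suc k) = cong suc (length-ones k)

  length-stars : ∀ k → length (stars k) ≡ k + (r + suc r)
  length-stars zero    = length-ones r
  length-stars (suc k) = cong suc (length-stars k)

  length-paths : ∀ js → length (paths js) ≡ length js + (t + (r + suc r))
  length-paths []       = length-stars t
  length-paths (j ∷ js) = cong suc (length-paths js)

  -- `2 * s ∸ 1` counts the `2 s - 3` edges among the bases and the two joining edges, `t` the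
  -- spokes.
  length-graph : ∀ js → length (graph js) ≡ length js + (t + (2 * s ∸ 1))
  length-graph js = trans (cong (2 +_) (length-paths js)) (arith (length js) t r)
    where
    arith : ∀ k t r → 2 + (k + (t + (r + suc r))) ≡ k + (t + (suc r + (suc (suc r) + 0)))
    arith = solve-∀


  -- Orders for cutting the path

  down : ℕ → List ℕ
  down zero    = []
  down (suc i) = suc i ∷ down i

  -- Leaves out the edge {0 , 1}: the vertex 0 is available for completing segments to s vertices.
  up : ℕ → ℕ → List ℕ
  up k zero    = down r
  up k (suc m) = suc r + k ∷ up (suc k) m

  all-down : ∀ (P : ℕ → Set) k → (∀ i → i < k → P (suc i)) → All P (down k)
  all-down P zero    h = []
  all-down P (suc k) h = h k ≤-refl ∷ all-down P k λ i i<k → h i (m≤n⇒m≤1+n i<k)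

  all-up : ∀ (P : ℕ → Set) → (∀ i → i < r → P (suc i)) → ∀ k m → (∀ i → k ≤ i → i < k + m → P (suc r + i)) → All P (up k m)
  all-up P d k zero    h = all-down P r d
  all-up P d k (suc m) h = h k ≤-refl (m<m+n k (s≤s z≤n)) ∷
    all-up P d (suc k) m λ i k<i i< → h i (<⇒≤ k<i) (subst (i <_) (sym (+-suc k m)) i<)

  down-cut : ∀ i → i < r → Cut s t (suc i) (down i)
  down-cut i i<r = record
    { U = U
    ; crosses = inj₁ (inj₁ (z≤n , ≤-refl) , outside-segments U (inj₂ ≤-refl) (inj₁ ≤-refl))
    ; rest = all-down _ i λ j j<i →
        [ (λ ()) , [ <⇒≢ (s≤s (s≤s j<i)) , [ <⇒≢ (s≤s (s≤s (m≤n⇒m≤1+n j<i))) ,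
          <⇒≢ (s≤s (s≤s (≤-trans (m≤n⇒m≤1+n j<i) (m≤m+n (suc i) (r ∸ i))))) ]′ ]′ ]′ }
    where
    end : suc (suc (suc i)) + (r ∸ i) ≡ suc s
    end = cong (3 +_) (m+[n∸m]≡n (<⇒≤ i<r))
    -- `{0 , … , s}` without `suc (suc i)`. The boundaries other than `suc (suc i)` were cut before
    -- or are ends of the path.
    U : Segments s t
    U = segs 0 (suc (suc i)) (suc (suc (suc i))) (r ∸ i) (n≤1+n _) (≤-trans (≤-reflexive end) s<t) (suc-injective end)

  up-cut : ∀ k m → s + k + suc m ≡ t → Cut s t (suc r + k) (up (suc k) m)
  up-cut zero m eq = record
    { U = U
    ; crosses = inj₁ (inj₁ (z≤n , s≤s (≤-reflexive (+-identityʳ (suc r)))) ,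
        outside-segments U (inj₂ (≤-reflexive (sym (+-identityʳ s)))) (inj₁ (≤-trans (s≤s (≤-reflexive (+-identityʳ s))) s<t)))
    ; rest = all-up _
        (λ i i<r → [ (λ ()) , [ <⇒≢ (s≤s (s≤s i<r)) , [ <⇒≢ (<-trans (s≤s (s≤s i<r)) s<t) ,
          <⇒≢ (≤-trans (<-trans (s≤s (s≤s i<r)) s<t) (m≤m+n t 0)) ]′ ]′ ]′) 1 m
        (λ i 1≤i i< → [ (λ ()) , [ (λ eq′ → <⇒≢ 1≤i (sym (+-cancelˡ-≡ s i 0 (trans eq′ (sym (+-identityʳ s)))))) ,
          [ <⇒≢ (bound i<) , <⇒≢ (≤-trans (bound i<) (m≤m+n t 0)) ]′ ]′ ]′) }
    where
    U : Segments s t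
    U = segs 0 s t 0 (<⇒≤ s<t) (≤-reflexive (+-identityʳ t)) (+-identityʳ s)
    bound : ∀ {i} → i < 1 + m → s + i < t
    bound i< = ≤-trans (+-monoʳ-< s i<) (≤-reflexive (trans (cong (_+ suc m) (sym (+-identityʳ s))) eq))
  up-cut (suc k) m eq = record
    { U = U
    ; crosses = inj₁ (inj₂ (≤-refl , m<m+n (suc r + suc k) (s≤s z≤n)) ,
        outside-segments U (inj₂ (m≤m+n s (suc k))) (inj₂ (≤-reflexive (+-comm (suc r + suc k) 1))))
    ; rest = all-up _
        (λ i i<r → [ (λ ()) , [ <⇒≢ (s≤s (s≤s i<r)) , [ <⇒≢ (lo i<r) , <⇒≢ (≤-trans (lo i<r) (m≤m+n _ 1)) ]′ ]′ ]′) (suc (suc k)) m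
        (λ i k<i i< → [ (λ ()) , [ ≢-sym (<⇒≢ (m<m+n s (≤-trans (s≤s z≤n) k<i))) ,
          [ ≢-sym (<⇒≢ (s≤s (+-monoʳ-≤ (suc r) (<⇒≤ k<i)))) ,
            ≢-sym (<⇒≢ (≤-trans (s≤s (≤-reflexive (+-comm (suc r + suc k) 1))) (+-monoʳ-< s k<i))) ]′ ]′ ]′) }
    where
    lo : ∀ {i} → i < r → suc (suc i) < suc r + suc k
    lo i<r = ≤-trans (s≤s (s≤s i<r)) (≤-trans (m≤m+n s k) (≤-reflexive (sym (+-suc (suc r) k))))
    -- The interval from 1 to `suc r` begins at the missing edge `{0 , 1}` and ends at the edge cut
    -- first; the single vertex `suc r + suc k` follows the edge cut just before.
    U : Segments s t
    U = segs 1 (suc r) (suc r + suc k) 1 (≤-trans (m≤m+n s k) (≤-reflexive (sym (+-suc (suc r) k))))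
      (≤-trans (≤-reflexive (+-comm (suc r + suc k) 1)) (≤-trans (m≤m+n (s + suc k) (suc m)) (≤-reflexive eq))) (+-comm (suc r) 1)

  down-schedule : ∀ k → k ≤ r → Schedule s t (down k)
  down-schedule zero    _ = tt
  down-schedule (suc k) k<r = <-trans (s≤s (s≤s k<r)) s<t , down-cut k k<r , down-schedule k (<⇒≤ k<r)

  up-schedule : ∀ k m → s + k + m ≡ t → Schedule s t (up k m)
  up-schedule k zero    eq = down-schedule r ≤-refl
  up-schedule k (suc m) eq = ≤-trans (m<m+n (s + k) (s≤s z≤n)) (≤-reflexive eq) , up-cut k m eq ,
    up-schedule (suc k) m (trans (cong (_+ m) (+-suc s k)) (trans (sym (+-suc (s + k) m)) eq))

  length-down : ∀ k → length (down k) ≡ k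
  length-down zero    = refl
  length-down (suc k) = cong suc (length-down k)

  length-up : ∀ k m → length (up k m) ≡ m + r
  length-up k zero    = length-down r
  length-up k (suc m) = cong suc (length-up (suc k) m)

  -- The cut positions are the multiples of s modulo t: the cyclic interval of length s that ends at the
  -- current position starts at the previous one, where the path has been cut already.
  next : ∀ x → Dec (x + s < t) → ℕ
  next x (yes _) = x + s
  next x (no _)  = x + s ∸ t

  position : ℕ → ℕ
  position zero    = 0
  position (suc k) = next (position k) (position k + s <? t)

  next<t : ∀ x d → x < t → next x d < t
  next<t x (yes x+s<t) _   = x+s<t
  next<t x (no  _)     x<t = ≤-<-trans (≤-trans (∸-monoʳ-≤ (x + s) (<⇒≤ s<t)) (≤-reflexive (m+n∸n≡m x s))) x<t

  position<t : ∀ k → position k < t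
  position<t zero    = 0<t
  position<t (suc k) = next<t (position k) (position k + s <? t) (position<t k)

  next-mod : ∀ x d → ∃[ q ] next x d + q * t ≡ s + x
  next-mod x (yes _)    = 0 , trans (+-identityʳ _) (+-comm x s)
  next-mod x (no x+s≮t) = 1 , trans (cong (next x (no x+s≮t) +_) (+-identityʳ t)) (trans (m∸n+n≡m (≮⇒≥ x+s≮t)) (+-comm x s))

  position-mod : ∀ k → ∃[ q ] position k + q * t ≡ k * s
  position-mod zero    = 0 , refl
  position-mod (suc k) with position-mod k | next-mod (position k) (position k + s <? t)
  ... | q , eq | q′ , eq′ = q′ + q , (begin
    position (suc k) + (q′ + q) * t        ≡⟨ arith (position (suc k)) q′ q t ⟩
    position (suc k) + q′ * t + q * t      ≡⟨ cong (_+ q * t) eq′ ⟩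
    s + position k + q * t                 ≡⟨ +-assoc s _ _ ⟩
    s + (position k + q * t)               ≡⟨ cong (s +_) eq ⟩
    s + k * s                              ∎)
    where
    open ≡-Reasoning
    arith : ∀ x a b t → x + (a + b) * t ≡ x + a * t + b * t
    arith = solve-∀

  module _ (coprime : Coprime t s) where

    -- Equal positions give `t ∣ (m ∸ k) * s`, hence `t ∣ m ∸ k` by coprimality, but `m ∸ k` is
    -- positive and below `t`.
    position-injective : ∀ {k m} → k < m → m < t → position m ≢ position k
    position-injective {k} {m} k<m m<t pm≡pk = <⇒≱ (≤-<-trans (m∸n≤m m k) m<t)
      (∣⇒≤ {{>-nonZero (m<n⇒0<n∸m k<m)}} (coprime-divisor coprime (subst (t ∣_) (*-comm (m ∸ k) s) (divides (q′ ∸ q) (begin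
        (m ∸ k) * s                                       ≡⟨ *-distribʳ-∸ s m k ⟩
        m * s ∸ k * s                                     ≡⟨ cong₂ _∸_ eq′ eq ⟨
        (position m + q′ * t) ∸ (position k + q * t)      ≡⟨ cong (λ x → (x + q′ * t) ∸ (position k + q * t)) pm≡pk ⟩
        (position k + q′ * t) ∸ (position k + q * t)      ≡⟨ [m+n]∸[m+o]≡n∸o (position k) _ _ ⟩
        q′ * t ∸ q * t                                    ≡⟨ *-distribʳ-∸ t q′ q ⟨
        (q′ ∸ q) * t                                      ∎)))))
      where
      open ≡-Reasoning
      q = proj₁ (position-mod k)
      eq = proj₂ (position-mod k)
      q′ = proj₁ (position-mod m)
      eq′ = proj₂ (position-mod m)

    -- A position `p` means cutting before the vertex `p`, that is, at the edge `{p - 1 , p}`. The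
    -- schedules start at index 1 or later, since position 0 is the beginning of the path.
    cyclic : ℕ → ℕ → List ℕ
    cyclic k zero    = []
    cyclic k (suc m) = pred (position k) ∷ cyclic (suc k) m

    suc-pred-position : ∀ {k} → 0 < k → k < t → suc (pred (position k)) ≡ position k
    suc-pred-position {k} 0<k k<t with position k | position-injective 0<k k<t
    ... | zero  | ≢0 = contradiction refl ≢0
    ... | suc _ | _  = refl

    all-cyclic : ∀ (P : ℕ → Set) k m → 0 < k → k + m ≤ t → (∀ i → k ≤ i → i < t → P (position i)) → All (P ∘ suc) (cyclic k m)
    all-cyclic P k zero    _   _  h = []
    all-cyclic P k (suc m) 0<k k+m≤t h =
      subst P (sym (suc-pred-position 0<k k<t)) (h k ≤-refl k<t) ∷
      all-cyclic P (suc k) m (s≤s z≤n) (≤-trans (≤-reflexive (sym (+-suc k m))) k+m≤t) λ i k<i → h i (<⇒≤ k<i)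
      where
      k<t : k < t
      k<t = ≤-trans (m<m+n k (s≤s z≤n)) k+m≤t

    cyclic-cut : ∀ x d j js → x < t → suc j ≡ next x d → suc j ≢ x →
                 All (λ i → suc i ≢ x × suc i ≢ next x d × suc i < t) js → Cut s t j js
    cyclic-cut x (yes x+s<t) j js x<t eq ≢x rest = record
      { U = U
      ; crosses = inj₁ (inj₁ (s≤s⁻¹ (≤-trans (m<m+n x (s≤s z≤n)) (≤-reflexive (sym eq))) , ≤-reflexive eq) ,
                        outside-segments U (inj₂ (≤-reflexive (sym eq))) (inj₁ (≤-<-trans (≤-reflexive eq) x+s<t)))
      ; rest = All.map (λ (≢x , ≢c , <t) → [ ≢x , [ ≢c , [ <⇒≢ <t , <⇒≢ (≤-trans <t (m≤m+n t 0)) ]′ ]′ ]′) rest }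
      where
      -- The empty second interval sits at `t`, past the last vertex of the path.
      U : Segments s t
      U = segs x s t 0 (<⇒≤ x+s<t) (≤-reflexive (+-identityʳ t)) (+-identityʳ s)
    cyclic-cut x (no x+s≮t) j js x<t eq ≢x rest = record
      { U = U
      ; crosses = inj₁ (inj₁ (z≤n , ≤-reflexive eq) ,
                        outside-segments U (inj₂ (≤-reflexive (sym eq))) (inj₁ (≤∧≢⇒< (≤-trans (≤-reflexive eq) ord) ≢x)))
      ; rest = All.map (λ (≢x , ≢c , <t) → [ (λ ()) , [ ≢c , [ ≢x , <⇒≢ (≤-trans <t (≤-reflexive (sym end))) ]′ ]′ ]′) rest }
      where
      ord : x + s ∸ t ≤ x
      ord = ≤-trans (∸-monoʳ-≤ (x + s) (<⇒≤ s<t)) (≤-reflexive (m+n∸n≡m x s))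
      end : x + (t ∸ x) ≡ t
      end = m+[n∸m]≡n (<⇒≤ x<t)
      total : x + s ∸ t + (t ∸ x) ≡ s
      total = +-cancelˡ-≡ x _ _ (trans (arith x (x + s ∸ t) (t ∸ x)) (trans (cong (x + s ∸ t +_) end) (m∸n+n≡m (≮⇒≥ x+s≮t))))
        where
        arith : ∀ a b c → a + (b + c) ≡ b + (a + c)
        arith = solve-∀
      -- Wrapped around: from `x` to the end of the path, and the vertices still missing from its
      -- beginning.
      U : Segments s t
      U = segs 0 (x + s ∸ t) x (t ∸ x) ord (≤-reflexive end) total

    cyclic-schedule : ∀ k m → suc k + m ≡ t → Schedule s t (cyclic (suc k) m)
    cyclic-schedule k zero    eq = tt
    cyclic-schedule k (suc m) eq =
      ≤-<-trans (≤-reflexive sp) (position<t (suc k)) ,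
      cyclic-cut (position k) (position k + s <? t) _ _ (position<t k) sp (position-injective ≤-refl k<t ∘ trans (sym sp))
        (all-cyclic (λ i → i ≢ position k × i ≢ position (suc k) × i < t) (suc (suc k)) m (s≤s z≤n) (≤-reflexive eq′)
          λ i k<i i<t → position-injective (<⇒≤ k<i) i<t , position-injective k<i i<t , position<t i) ,
      cyclic-schedule (suc k) m eq′
      where
      k<t : suc k < t
      k<t = ≤-trans (m<m+n (suc k) (s≤s z≤n)) (≤-reflexive eq)
      sp : suc (pred (position (suc k))) ≡ position (suc k)
      sp = suc-pred-position (s≤s z≤n) k<t
      eq′ : suc (suc k) + m ≡ t
      eq′ = trans (sym (+-suc (suc k) m)) eq

    length-cyclic : ∀ k m → length (cyclic k m) ≡ m
    length-cyclic k zero    = refl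
    length-cyclic k (suc m) = cong suc (length-cyclic (suc k) m)

-- Dismantlings of the required lengths

Dismantlable : (s t k : ℕ) → Set
Dismantlable s t k = Σ (List (Edge (suc (s + t)))) λ es → Dismantling s t es × length es ≡ k

dismantlable : ∀ {s t} → 2 < s → s < t → Dismantlable s t (2 * s + 2 * t ∸ 3)
dismantlable {suc zero} (s≤s ())
dismantlable {suc (suc r)} {t} 2<s s<t = edges (graph (up 0 (t ∸ s))) ,
  toDismantling (graph-dismantling _ (up-schedule 0 (t ∸ s) (trans (cong (_+ (t ∸ s)) (+-identityʳ s)) (m+[n∸m]≡n (<⇒≤ s<t))))) ,
  (begin
    length (edges (graph js))                 ≡⟨ length-map edge (graph js) ⟩
    length (graph js)                         ≡⟨ length-graph js ⟩
    length js + (t + (2 * s ∸ 1))             ≡⟨ cong (_+ (t + (2 * s ∸ 1))) (length-up 0 (t ∸ s)) ⟩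
    t ∸ s + r + (t + (2 * s ∸ 1))             ≡⟨ cong (λ u → t ∸ s + r + (u + (2 * s ∸ 1))) (m∸n+n≡m (<⇒≤ s<t)) ⟨
    t ∸ s + r + (t ∸ s + s + (2 * s ∸ 1))     ≡⟨ arith (t ∸ s) r ⟩
    2 * s + 2 * (t ∸ s + s) ∸ 3               ≡⟨ cong (λ u → 2 * s + 2 * u ∸ 3) (m∸n+n≡m (<⇒≤ s<t)) ⟩
    2 * s + 2 * t ∸ 3                         ∎)
  where
  open Construction r t s<t
  open Labels s t using (edges; edge; toDismantling)
  open ≡-Reasoning
  -- All path edges but `{0 , 1}`, hence `t - 2` of them.
  js = up 0 (t ∸ s)
  arith : ∀ d r → d + r + (d + suc (suc r) + (suc r + (suc (suc r) + 0))) ≡ 2 * (2 + r) + 2 * (d + (2 + r)) ∸ 3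
  arith d r = trans (lem d r) (sym (cong (_∸ 3) (lem′ d r)))
    where
    lem : ∀ d r → d + r + (d + suc (suc r) + (suc r + (suc (suc r) + 0))) ≡ 5 + (4 * r + 2 * d)
    lem = solve-∀
    lem′ : ∀ d r → 2 * (2 + r) + 2 * (d + (2 + r)) ≡ 8 + (4 * r + 2 * d)
    lem′ = solve-∀

dismantlable-coprime : ∀ {s t} → 2 < s → s < t → gcd s t ≡ 1 → Dismantlable s t (2 * s + 2 * t ∸ 2)
dismantlable-coprime {suc zero} (s≤s ())
dismantlable-coprime {suc (suc r)} {suc u} 2<s s<t gcd≡1 = edges (graph js) ,
  toDismantling (graph-dismantling _ (cyclic-schedule coprime 0 u refl)) ,
  (begin
    length (edges (graph js))                 ≡⟨ length-map edge (graph js) ⟩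
    length (graph js)                         ≡⟨ length-graph js ⟩
    length js + (suc u + (2 * s ∸ 1))         ≡⟨ cong (_+ (suc u + (2 * s ∸ 1))) (length-cyclic coprime 1 u) ⟩
    u + (suc u + (2 * s ∸ 1))                 ≡⟨ trans (lem u r) (sym (cong (_∸ 2) (lem′ u r))) ⟩
    2 * s + 2 * suc u ∸ 2                     ∎)
  where
  open Construction r (suc u) s<t
  open Labels s (suc u) using (edges; edge; toDismantling)
  open ≡-Reasoning
  coprime : Coprime (suc u) s
  coprime = coprime-sym (gcd≡1⇒coprime gcd≡1)
  js = cyclic coprime 1 u
  lem : ∀ u r → u + (suc u + (suc r + (suc (suc r) + 0))) ≡ 4 + (2 * r + 2 * u)
  lem = solve-∀
  lem′ : ∀ u r → 2 * (2 + r) + 2 * suc u ≡ 6 + (2 * r + 2 * u)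
  lem′ = solve-∀

-- Deciding dismantlability

Crosses? : ∀ (P Q : Subset n) a b → Dec (Crosses P Q a b)
Crosses? P Q a b = (a ∈? P ×-dec b ∈? Q) ⊎-dec (a ∈? Q ×-dec b ∈? P)

Separation? : ∀ v (P Q : Subset n) es → Dec (Separation v P Q es)
Separation? {n} v P Q es = map′ to
  (λ sep → sep .v∉P , sep .v∉Q , (λ _ (x∈P , x∈Q) → sep .disjoint x∈P x∈Q) , classify sep , tabulateᴬ (sep .free))
  (¬? (v ∈? P) ×-dec ¬? (v ∈? Q) ×-dec all? (λ x → ¬? (x ∈? P ×-dec x ∈? Q)) ×-dec
   all? (λ x → x ≟ v ⊎-dec x ∈? P ⊎-dec x ∈? Q) ×-dec All.all? (λ (x , y) → ¬? (Crosses? P Q x y)) es)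

  where
  to : v ∉ P × v ∉ Q × (∀ x → ¬ (x ∈ P × x ∈ Q)) × (∀ x → x ≡ v ⊎ x ∈ P ⊎ x ∈ Q) ×
       All (λ (x , y) → ¬ Crosses P Q x y) es → Separation v P Q es
  to (v∉P , v∉Q , disj , cov , fr) = record
    { v∉P = v∉P ; v∉Q = v∉Q ; disjoint = λ x∈P x∈Q → disj _ (x∈P , x∈Q)
    ; cover = λ {x} x≢v → [ (λ x≡v → contradiction x≡v x≢v) , id ]′ (cov x) ; free = lookup fr }

Step? : ∀ s t (e : Edge n) es → Dec (Step s t e es)
Step? s t (a , b) es = map′
  (λ (v , S , T , ∣S∣ , ∣T∣ , sep , cross) → record { v = v ; S = S ; T = T ; ∣S∣≡ = ∣S∣ ; ∣T∣≡ = ∣T∣ ; sep = sep ; cross = cross })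
  (λ st → Step.v st , Step.S st , Step.T st , Step.∣S∣≡ st , Step.∣T∣≡ st , Step.sep st , Step.cross st)
  (any? λ v → anySubset? λ S → anySubset? λ T →
    (∣ S ∣ ≟ⁿ s) ×-dec (∣ T ∣ ≟ⁿ t) ×-dec Separation? v S T es ×-dec Crosses? S T a b)

Dismantling? : ∀ s t (es : List (Edge n)) → Dec (Dismantling s t es)
Dismantling? s t []       = yes tt
Dismantling? s t (e ∷ es) = Step? s t e es ×-dec Dismantling? s t es

any-of-length? : ∀ k {P : List (Edge n) → Set} → Decidable P → Dec (∃[ es ] (P es × length es ≡ k))
any-of-length? zero P? = map′ (λ p → [] , p , refl) (λ { ([] , p , _) → p }) (P? [])
any-of-length? (suc k) P? = map′
  (λ (a , b , es , p , eq) → (a , b) ∷ es , p , cong suc eq)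
  (λ { ((a , b) ∷ es , p , eq) → a , b , es , p , cong pred eq })
  (any? λ a → any? λ b → any-of-length? k λ es → P? ((a , b) ∷ es))

-- If `s` and `t` have a common divisor, two values of the weak saturation number remain; this
-- finite search selects the right one constructively.
Dismantlable? : ∀ s t k → Dec (Dismantlable s t k)
Dismantlable? s t k = any-of-length? k (Dismantling? s t)

-- Copies of K s t and dismantling steps

image : ∀ {k} → (Fin k → Fin n) → Subset n
image {k = zero}  f = ⊥
image {k = suc k} f = image (f ∘ suc) ∪ ⁅ f zero ⁆

∈image⁺ : ∀ {k} (f : Fin k → Fin n) i → f i ∈ image f
∈image⁺ f zero    = ∈-∪⁅⁆
∈image⁺ f (suc i) = ∈-∪ˡ (∈image⁺ (f ∘ suc) i)

∈image⁻ : ∀ {k} (f : Fin k → Fin n) {x} → x ∈ image f → ∃[ i ] f i ≡ x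
∈image⁻ {k = zero}  f x∈ = ⊥-elim (∉⊥ x∈)
∈image⁻ {k = suc k} f x∈ with ∈-∪⁅⁆⁻ x∈
... | inj₁ x∈′ = let i , eq = ∈image⁻ (f ∘ suc) x∈′ in suc i , eq
... | inj₂ x≡ = zero , sym x≡

∣image∣ : ∀ {k} (f : Fin k → Fin n) → Injective _≡_ _≡_ f → ∣ image f ∣ ≡ k
∣image∣ {n = n} {k = zero} f inj = ∣⊥∣≡0 n
∣image∣ {k = suc k} f inj = trans (∣p∪⁅x⁆∣≡1+∣p∣ λ f0∈ → let i , eq = ∈image⁻ (f ∘ suc) f0∈ in contradiction (inj eq) λ ())
  (cong suc (∣image∣ (f ∘ suc) (fsuc-injective ∘ inj)))

record Enumeration (p : Subset n) (k : ℕ) : Set where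
  field
    at         : Fin k → Fin n
    injective  : Injective _≡_ _≡_ at
    at∈        : ∀ i → at i ∈ p
    index      : ∀ {x} → x ∈ p → ∃[ i ] at i ≡ x
open Enumeration

enumerate : (p : Subset n) → Enumeration p ∣ p ∣
enumerate [] = record { at = λ () ; injective = λ {} ; at∈ = λ () ; index = λ () }
enumerate (outside ∷ p) = record
  { at = suc ∘ at E ; injective = injective E ∘ fsuc-injective ; at∈ = λ i → there (at∈ E i)
  ; index = λ { (there x∈) → let i , eq = index E x∈ in i , cong suc eq } }
  where E = enumerate p
enumerate {suc n} (inside ∷ p) = record
  { at = f ; injective = inj ; at∈ = λ { zero → here ; (suc i) → there (at∈ E i) }
  ; index = λ { here → zero , refl ; (there x∈) → let i , eq = index E x∈ in suc i , cong suc eq } }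
  where
  E = enumerate p
  f : Fin (suc ∣ p ∣) → Fin (suc n)
  f zero    = zero
  f (suc i) = suc (at E i)
  inj : Injective _≡_ _≡_ f
  inj {zero}  {zero}  _  = refl
  inj {suc i} {suc j} eq = cong suc (injective E (fsuc-injective eq))

<ᵇ-left : ∀ s t (i : Fin s) → (toℕ (i ↑ˡ t) <ᵇ s) ≡ true
<ᵇ-left s t i = T-true (<⇒<ᵇ (subst (_< s) (sym (toℕ-↑ˡ i t)) (toℕ<n i)))
  where
  T-true : ∀ {x} → IsTrue x → x ≡ true
  T-true {true} _ = refl

<ᵇ-right : ∀ s {t} (j : Fin t) → (toℕ (s ↑ʳ j) <ᵇ s) ≡ false
<ᵇ-right s j with toℕ (s ↑ʳ j) <ᵇ s in eq
... | false = refl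
... | true = ⊥-elim (m+n≮m s (toℕ j) (subst (_< s) (toℕ-↑ʳ s j) (<ᵇ⇒< _ _ (subst IsTrue (sym eq) tt))))

data Adjacent (s t : ℕ) : Fin (s + t) → Fin (s + t) → Set where
  left-right : ∀ i j → Adjacent s t (i ↑ˡ t) (s ↑ʳ j)
  right-left : ∀ i j → Adjacent s t (s ↑ʳ j) (i ↑ˡ t)

data Side′ (s t : ℕ) : Fin (s + t) → Set where
  left  : ∀ i → Side′ s t (i ↑ˡ t)
  right : ∀ j → Side′ s t (s ↑ʳ j)

side′ : ∀ s t u → Side′ s t u
side′ s t u with splitAt s u | join-splitAt s t u
... | inj₁ i | refl = left i
... | inj₂ j | refl = right j

K⇒adjacent : ∀ s t u w → K s t u w ≡ true → Adjacent s t u w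
K⇒adjacent s t u w eq with side′ s t u | side′ s t w
... | left i  | right j = left-right i j
... | right j | left i  = right-left i j
... | left i  | left j rewrite <ᵇ-left s t i | <ᵇ-left s t j with () ← eq
... | right i | right j rewrite <ᵇ-right s i | <ᵇ-right s j with () ← eq

K-left-right : ∀ s t i j → K s t (i ↑ˡ t) (s ↑ʳ j) ≡ true
K-left-right s t i j rewrite <ᵇ-left s t i | <ᵇ-right s j = refl

K-right-left : ∀ s t i j → K s t (s ↑ʳ j) (i ↑ˡ t) ≡ true
K-right-left s t i j rewrite <ᵇ-left s t i | <ᵇ-right s j = refl

↑ˡ≢↑ʳ : ∀ {s t} (i : Fin s) (j : Fin t) → i ↑ˡ t ≢ s ↑ʳ j
↑ˡ≢↑ʳ {s} {t} i j eq with trans (sym (splitAt-↑ˡ s i t)) (trans (cong (splitAt s) eq) (splitAt-↑ʳ s t j))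
... | ()

NonEdges : Graph n → List (Edge n) → Set
NonEdges G es = All (λ (x , y) → G x y ≡ false × G y x ≡ false) es

-- As `n` is `s + t + 1`, a copy of `K s t` misses exactly one vertex, which becomes `v`. No listed
-- non-edge can join the two classes.
module FromEmbedding (s t : ℕ) {n : ℕ} (n≡ : n ≡ suc (s + t)) {G : Graph n} {es} (non : NonEdges G es)
  (φ : Fin (s + t) → Fin n) (inj : Injective _≡_ _≡_ φ) (pres : ∀ u w → K s t u w ≡ true → G (φ u) (φ w) ≡ true) where

  φˡ : Fin s → Fin n
  φˡ i = φ (i ↑ˡ t)

  φʳ : Fin t → Fin n
  φʳ j = φ (s ↑ʳ j)

  S′ T′ : Subset n
  S′ = image φˡ
  T′ = image φʳ

  ∣S′∣ : ∣ S′ ∣ ≡ s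
  ∣S′∣ = ∣image∣ φˡ (↑ˡ-injective t _ _ ∘ inj)

  ∣T′∣ : ∣ T′ ∣ ≡ t
  ∣T′∣ = ∣image∣ φʳ (↑ʳ-injective s _ _ ∘ inj)

  disjoint′ : ∀ {x} → x ∈ S′ → x ∉ T′
  disjoint′ x∈S x∈T = let i , eq = ∈image⁻ φˡ x∈S ; j , eq′ = ∈image⁻ φʳ x∈T in ↑ˡ≢↑ʳ i j (inj (trans eq (sym eq′)))

  ∣∁∣ : ∣ ∁ (S′ ∪ T′) ∣ ≡ 1
  ∣∁∣ = trans (∣∁p∣≡n∸∣p∣ (S′ ∪ T′)) (trans (cong₂ _∸_ (trans n≡ (+-comm 1 (s + t)))
    (trans (∣p⊎q∣≡∣p∣+∣q∣ S′ T′ disjoint′) (cong₂ _+_ ∣S′∣ ∣T′∣))) (m+n∸m≡n (s + t) 1))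

  missed : ∃[ v ] v ∈ ∁ (S′ ∪ T′)
  missed with nonempty? (∁ (S′ ∪ T′))
  ... | yes ne = ne
  ... | no empty = contradiction (trans (sym ∣∁∣) (trans (cong ∣_∣ (Empty-unique empty)) (∣⊥∣≡0 n))) λ ()

  v′ : Fin n
  v′ = proj₁ missed

  joined : ∀ {x y} → x ∈ S′ → y ∈ T′ → G x y ≡ true × G y x ≡ true
  joined x∈S y∈T with ∈image⁻ φˡ x∈S | ∈image⁻ φʳ y∈T
  ... | i , refl | j , refl = pres _ _ (K-left-right s t i j) , pres _ _ (K-right-left s t i j)

  separation : Separation v′ S′ T′ es
  separation .v∉P v∈ = x∈∁p⇒x∉p (proj₂ missed) (∈-∪ˡ v∈)
  separation .v∉Q v∈ = x∈∁p⇒x∉p (proj₂ missed) (x∈p∪q⁺ {p = S′} (inj₂ v∈))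
  separation .disjoint = disjoint′
  separation .cover {x} x≢v with x ∈? S′ | x ∈? T′
  ... | yes x∈S | _ = inj₁ x∈S
  ... | no _ | yes x∈T = inj₂ x∈T
  ... | no x∉S | no x∉T = contradiction
    (subst (2 ≤_) ∣∁∣ (distinct⇒2≤∣p∣ (x∉p⇒x∈∁p λ x∈ → [ x∉S , x∉T ]′ (x∈p∪q⁻ S′ T′ x∈)) (proj₂ missed) x≢v)) λ { (s≤s ()) }
  separation .free e∈ c with lookup non e∈
  ... | Gxy , _ = [ (λ (x∈S , y∈T) → true≢false (trans (sym (proj₁ (joined x∈S y∈T))) Gxy))
                    , (λ (x∈T , y∈S) → true≢false (trans (sym (proj₂ (joined y∈S x∈T))) Gxy)) ]′ c
    where
    true≢false : true ≢ false
    true≢false ()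

  crosses′ : ∀ {u w} → K s t u w ≡ true → Crosses S′ T′ (φ u) (φ w)
  crosses′ {u} {w} eq with K⇒adjacent s t u w eq
  ... | left-right i j = inj₁ (∈image⁺ φˡ i , ∈image⁺ φʳ j)
  ... | right-left i j = inj₂ (∈image⁺ φʳ j , ∈image⁺ φˡ i)

  embedding⇒step : ∀ {a b} → Crosses S′ T′ a b → Step s t (a , b) es
  embedding⇒step c = record { v = v′ ; S = S′ ; T = T′ ; ∣S∣≡ = ∣S′∣ ; ∣T∣≡ = ∣T′∣ ; sep = separation ; cross = c }


-- Saturating sequences and dismantlings

module _ {a b : Fin n} {G : Graph n} where

  addEdge-true : ∀ {x y} → G x y ≡ true ⊎ (x ≡ a × y ≡ b) ⊎ (x ≡ b × y ≡ a) → addEdge a b G x y ≡ true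
  addEdge-true (inj₁ eq) rewrite eq = refl
  addEdge-true (inj₂ (inj₁ (refl , refl)))
    rewrite dec-true (a ≟ a) refl | dec-true (b ≟ b) refl = ∨-zeroʳ (G a b)
  addEdge-true {x} {y} (inj₂ (inj₂ (refl , refl)))
    rewrite dec-true (b ≟ b) refl | dec-true (a ≟ a) refl
          | ∨-zeroʳ (does (b ≟ a) ∧ does (a ≟ b)) = ∨-zeroʳ (G b a)

  addEdge-false : ∀ {x y} → G x y ≡ false → ¬ (x ≡ a × y ≡ b) → ¬ (x ≡ b × y ≡ a) → addEdge a b G x y ≡ false
  addEdge-false {x} {y} eq ≢ab ≢ba
    rewrite eq | dec-false (x ≟ a ×-dec y ≟ b) ≢ab | dec-false (x ≟ b ×-dec y ≟ a) ≢ba = refl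

Ordered : List (Edge n) → Set
Ordered = All λ (a , b) → toℕ a < toℕ b

-- The copy that uses the new edge has it between its classes, and it lies in a graph that still
-- lacks the pairs of `es`: this is a step.
saturating⇒dismantling : ∀ {s t} → n ≡ suc (s + t) → ∀ {G : Graph n} es → NonEdges G es → Unique es → Ordered es →
                         SaturatingSeq (K s t) G es → Dismantling s t es
saturating⇒dismantling n≡ [] _ _ _ _ = tt
saturating⇒dismantling {s = s} {t} n≡ {G} ((a , b) ∷ es) (_ ∷ non) (≢e ∷ unique) (a<b ∷ ordered)
  ((φ , inj , pres , u , w , Kuw , refl , refl) , sat) =
  embedding⇒step (crosses′ Kuw) , saturating⇒dismantling n≡ es non′ unique ordered sat
  where
  non′ : NonEdges (addEdge a b G) es
  -- Uniqueness and orientation keep the later pairs apart from `(a , b)` and `(b , a)`.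
  non′ = tabulateᴬ λ {(x , y)} e∈ → let Gxy , Gyx = lookup non e∈ in
    let ≢ab = λ { (refl , refl) → lookup ≢e e∈ refl }
        ≢ba = λ { (refl , refl) → <-asym a<b (lookup ordered e∈) } in
    addEdge-false {G = G} Gxy ≢ab ≢ba , addEdge-false {G = G} Gyx (λ (p , q) → ≢ba (q , p)) (λ (p , q) → ≢ab (q , p))
  open FromEmbedding s t n≡ non′ φ inj pres

module FromStep {s t n} {a b : Fin n} {es} (step : Step s t (a , b) es) where
  open Step step
  private
    ES : Enumeration S s
    ES = subst (Enumeration S) ∣S∣≡ (enumerate S)
    ET : Enumeration T t
    ET = subst (Enumeration T) ∣T∣≡ (enumerate T)

  φ′ : Fin s ⊎ Fin t → Fin n
  φ′ = [ at ES , at ET ]′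

  φ : Fin (s + t) → Fin n
  φ = φ′ ∘ splitAt s

  φ-left : ∀ i → φ (i ↑ˡ t) ≡ at ES i
  φ-left i = cong φ′ (splitAt-↑ˡ s i t)

  φ-right : ∀ j → φ (s ↑ʳ j) ≡ at ET j
  φ-right j = cong φ′ (splitAt-↑ʳ s t j)

  φ-injective : Injective _≡_ _≡_ φ
  φ-injective {u} {w} eq with side′ s t u | side′ s t w
  ... | left i | left j = cong (_↑ˡ t) (injective ES (trans (sym (φ-left i)) (trans eq (φ-left j))))
  ... | right i | right j = cong (s ↑ʳ_) (injective ET (trans (sym (φ-right i)) (trans eq (φ-right j))))
  ... | left i | right j = contradiction (at∈ ET j) (sep .disjoint (subst (_∈ S) (trans (sym (φ-left i)) (trans eq (φ-right j))) (at∈ ES i)))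
  ... | right j | left i = contradiction (at∈ ET j) (sep .disjoint (subst (_∈ S) (trans (sym (φ-left i)) (trans (sym eq) (φ-right j))) (at∈ ES i)))

  φ-crosses : ∀ {u w} → Adjacent s t u w → Crosses S T (φ u) (φ w)
  φ-crosses (left-right i j) = inj₁ (subst (_∈ S) (sym (φ-left i)) (at∈ ES i) , subst (_∈ T) (sym (φ-right j)) (at∈ ET j))
  φ-crosses (right-left i j) = inj₂ (subst (_∈ T) (sym (φ-right j)) (at∈ ET j) , subst (_∈ S) (sym (φ-left i)) (at∈ ES i))

  φ-onto : ∀ {x y} → Crosses S T x y → ∃[ u ] ∃[ w ] (K s t u w ≡ true × φ u ≡ x × φ w ≡ y)
  φ-onto (inj₁ (x∈S , y∈T)) = let i , eq = index ES x∈S ; j , eq′ = index ET y∈T in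
    i ↑ˡ t , s ↑ʳ j , K-left-right s t i j , trans (φ-left i) eq , trans (φ-right j) eq′
  φ-onto (inj₂ (x∈T , y∈S)) = let i , eq = index ES y∈S ; j , eq′ = index ET x∈T in
    s ↑ʳ j , i ↑ˡ t , K-right-left s t i j , trans (φ-right j) eq′ , trans (φ-left i) eq

CoComplete : Graph n → List (Edge n) → Set
CoComplete G es = ∀ {x y} → x ≢ y → (x , y) ∉ˡ es → (y , x) ∉ˡ es → G x y ≡ true

-- By `free` no pair between `S` and `T` is left in `es`, so co-completeness, which persists when
-- the edge is added, supplies a full copy of `K s t`.
dismantling⇒saturating : ∀ {s t} {G : Graph n} es → CoComplete G es → Dismantling s t es → SaturatingSeq (K s t) G es
dismantling⇒saturating [] _ _ = tt
dismantling⇒saturating {s = s} {t} {G} ((a , b) ∷ es) co (step , d) =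
  (φ , φ-injective , (λ u w eq → let c = φ-crosses (K⇒adjacent s t u w eq) in
     co′ (crosses⇒≢ sep c) (λ e∈ → sep .free e∈ c) (λ e∈ → sep .free e∈ (swap-crosses c)))
  , φ-onto cross) ,
  dismantling⇒saturating es co′ d
  where
  open Step step using (sep; cross)
  open FromStep step
  co′ : CoComplete (addEdge a b G) es
  co′ {x} {y} x≢y xy∉ yx∉ with (x ≟ a) ×-dec (y ≟ b) | (x ≟ b) ×-dec (y ≟ a)
  ... | yes ab | _ = addEdge-true {G = G} (inj₂ (inj₁ ab))
  ... | no _ | yes ba = addEdge-true {G = G} (inj₂ (inj₂ ba))
  ... | no ≢ab | no ≢ba = addEdge-true {G = G} (inj₁ (co x≢y
    (λ { (here refl) → ≢ab (refl , refl) ; (there e∈) → xy∉ e∈ })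
    (λ { (here refl) → ≢ba (refl , refl) ; (there e∈) → yx∉ e∈ })))

-- Orienting the pairs, and the complement graph

module Orient {n : ℕ} where

  orient : ∀ a b → Dec (toℕ a < toℕ b) → Edge n
  orient a b (yes _) = a , b
  orient a b (no _)  = b , a

  normal : Edge n → Edge n
  normal (a , b) = orient a b (toℕ a <? toℕ b)

  normal-cases : ∀ e → normal e ≡ e ⊎ normal e ≡ (proj₂ e , proj₁ e)
  normal-cases (a , b) with toℕ a <? toℕ b
  ... | yes _ = inj₁ refl
  ... | no _ = inj₂ refl

  normal-ordered : ∀ {a b} → a ≢ b → toℕ (proj₁ (normal (a , b))) < toℕ (proj₂ (normal (a , b)))
  normal-ordered {a} {b} a≢b with toℕ a <? toℕ b
  ... | yes a<b = a<b
  ... | no a≮b = ≤∧≢⇒< (≮⇒≥ a≮b) (a≢b ∘ sym ∘ toℕ-injective)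

  normal-crosses : ∀ {P Q : Subset n} {a b} → Crosses P Q a b → Crosses P Q (proj₁ (normal (a , b))) (proj₂ (normal (a , b)))
  normal-crosses {a = a} {b} c with toℕ a <? toℕ b
  ... | yes _ = c
  ... | no _ = swap-crosses c

  -- Crossing is symmetric in the ends of an edge, so a dismantling can be oriented as
  -- `EnumeratesNonEdges` demands.
  normal-dismantling : ∀ {s t} es → Dismantling s t es → Dismantling s t (map normal es)
  normal-dismantling [] _ = tt
  normal-dismantling (e ∷ es) (step , d) = record
    { v = v ; S = S ; T = T ; ∣S∣≡ = ∣S∣≡ ; ∣T∣≡ = ∣T∣≡ ; cross = normal-crosses cross
    ; sep = record { v∉P = sep .v∉P ; v∉Q = sep .v∉Q ; disjoint = sep .disjoint ; cover = sep .cover ; free = free′ } } ,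
    normal-dismantling es d
    where
    open Step step
    free′ : ∀ {x y} → (x , y) ∈ˡ map normal es → ¬ Crosses S T x y
    free′ e∈ c with ∈-map⁻ normal e∈
    ... | (a , b) , ab∈ , eq with normal-cases (a , b)
    ... | inj₁ eq′ with refl ← trans eq eq′ = sep .free ab∈ c
    ... | inj₂ eq′ with refl ← trans eq eq′ = sep .free ab∈ (swap-crosses c)

  normal-all-ordered : ∀ {s t} es → Dismantling s t es → Ordered (map normal es)
  normal-all-ordered [] _ = []
  normal-all-ordered (e ∷ es) (step , d) = normal-ordered (crosses⇒≢ (Step.sep step) (Step.cross step)) ∷ normal-all-ordered es d

-- The deleted edge crosses its separation, and no later one does.
dismantling⇒unique : ∀ {s t} (es : List (Edge n)) → Dismantling s t es → Unique es
dismantling⇒unique [] _ = []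
dismantling⇒unique (e ∷ es) (step , d) =
  tabulateᴬ (λ { e∈ refl → Step.sep step .free e∈ (Step.cross step) }) ∷ dismantling⇒unique es d

module Complement {n : ℕ} (es : List (Edge n)) where
  open import Data.List.Membership.DecPropositional (≡-dec (_≟_ {n}) (_≟_ {n})) using () renaming (_∈?_ to _∈ˡ?_)

  Missing : Fin n → Fin n → Set
  Missing x y = x ≡ y ⊎ (x , y) ∈ˡ es ⊎ (y , x) ∈ˡ es

  missing? : ∀ x y → Dec (Missing x y)
  missing? x y = (x ≟ y) ⊎-dec ((x , y) ∈ˡ? es) ⊎-dec ((y , x) ∈ˡ? es)

  complement : Graph n
  complement x y = not (does (missing? x y))

  missing⇒false : ∀ {x y} → Missing x y → complement x y ≡ false
  missing⇒false {x} {y} m = cong not (dec-true (missing? x y) m)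

  ¬missing⇒true : ∀ {x y} → ¬ Missing x y → complement x y ≡ true
  ¬missing⇒true {x} {y} ¬m = cong not (dec-false (missing? x y) ¬m)

  false⇒missing : ∀ {x y} → complement x y ≡ false → Missing x y
  false⇒missing {x} {y} eq = decidable-stable (missing? x y) λ ¬m → contradiction (trans (sym (¬missing⇒true ¬m)) eq) λ ()

  sym-missing : ∀ {x y} → Missing x y → Missing y x
  sym-missing (inj₁ eq) = inj₁ (sym eq)
  sym-missing (inj₂ h)  = inj₂ (swap h)

  simple : IsSimple complement
  simple = (λ x y → cong not (does-⇔ (mk⇔ sym-missing sym-missing) (missing? x y) (missing? y x))) ,
           λ x → missing⇒false {x} (inj₁ refl)

  cocomplete : CoComplete complement es
  cocomplete x≢y xy∉ yx∉ = ¬missing⇒true [ x≢y , [ xy∉ , yx∉ ]′ ]′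

  nonEdges : NonEdges complement es
  nonEdges = tabulateᴬ λ e∈ → missing⇒false (inj₂ (inj₁ e∈)) , missing⇒false (inj₂ (inj₂ e∈))

  enumerates : Unique es → Ordered es → EnumeratesNonEdges complement es
  enumerates unique ordered = unique , ordered , λ a b a<b → mk⇔
    (λ eq → [ (λ { refl → ⊥-elim (<-irrefl refl a<b) }) ,
      [ id , (λ e∈ → ⊥-elim (<-asym a<b (lookup ordered e∈))) ]′ ]′ (false⇒missing eq))
    (λ e∈ → missing⇒false (inj₂ (inj₁ e∈)))


-- Counting edges

-- Unfolds to the sums in `edgeCount`.
∑ : (Fin n → ℕ) → ℕ
∑ {n} f = sum (map f (allFin n))

∑-suc : ∀ (f : Fin (suc n) → ℕ) → ∑ f ≡ f zero + ∑ (f ∘ suc)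
∑-suc {n} f = cong (λ xs → f zero + sum xs) (trans (map-tabulate suc f) (sym (map-tabulate id (f ∘ suc))))

∑-cong : ∀ {f g : Fin n → ℕ} → (∀ x → f x ≡ g x) → ∑ f ≡ ∑ g
∑-cong {n} {f} {g} f≡g = go (allFin n)
  where
  go : ∀ xs → sum (map f xs) ≡ sum (map g xs)
  go []       = refl
  go (x ∷ xs) = cong₂ _+_ (f≡g x) (go xs)

∑-+ : ∀ (f g : Fin n → ℕ) → ∑ (λ x → f x + g x) ≡ ∑ f + ∑ g
∑-+ {n} f g = go (allFin n)
  where
  arith : ∀ a b c d → a + b + (c + d) ≡ a + c + (b + d)
  arith = solve-∀
  go : ∀ xs → sum (map (λ x → f x + g x) xs) ≡ sum (map f xs) + sum (map g xs)
  go []       = refl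
  go (x ∷ xs) = trans (cong (f x + g x +_) (go xs)) (arith (f x) (g x) _ _)

∑-0 : ∀ n → ∑ {n} (λ _ → 0) ≡ 0
∑-0 n = go (allFin n)
  where
  go : ∀ (xs : List (Fin n)) → sum (map (λ _ → 0) xs) ≡ 0
  go []       = refl
  go (x ∷ xs) = go xs

∑-1 : ∀ n → ∑ {n} (λ _ → 1) ≡ n
∑-1 zero    = refl
∑-1 (suc n) = trans (∑-suc {n} (λ _ → 1)) (cong suc (∑-1 n))

∑-δ : ∀ (a : Fin n) (f : Fin n → ℕ) → (∀ {x} → x ≢ a → f x ≡ 0) → ∑ f ≡ f a
∑-δ {suc n} zero f f≡0 = trans (∑-suc f) (trans (cong (f zero +_) (trans (∑-cong (λ x → f≡0 {suc x} λ ())) (∑-0 n))) (+-identityʳ _))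
∑-δ {suc n} (suc a) f f≡0 = trans (∑-suc f) (trans (cong (_+ ∑ (f ∘ suc)) (f≡0 {zero} λ ()))
  (∑-δ a (f ∘ suc) λ x≢a → f≡0 (x≢a ∘ fsuc-injective)))

-- Vertex 0 is below `n` others, and the remaining pairs are the case of `n` vertices: Pascal's
-- rule.
pairs : ∀ n → ∑ {n} (λ x → ∑ {n} (λ y → if toℕ x <ᵇ toℕ y then 1 else 0)) ≡ n C 2
pairs zero    = refl
pairs (suc n) = begin
  ∑ {suc n} (λ x → ∑ {suc n} (λ y → lt x y))
    ≡⟨ ∑-suc {n} (λ x → ∑ {suc n} (λ y → lt x y)) ⟩
  ∑ {suc n} (lt {suc n} {suc n} zero) + ∑ {n} (λ x → ∑ {suc n} (lt {suc n} {suc n} (suc x)))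
    ≡⟨ cong₂ _+_ (trans (∑-suc {n} (lt {suc n} zero)) (∑-1 n)) (∑-cong {n} λ x → ∑-suc {n} (lt {suc n} (suc x))) ⟩
  n + ∑ {n} (λ x → ∑ {n} (λ y → lt x y))
    ≡⟨ cong₂ _+_ (sym (nC1≡n n)) (pairs n) ⟩
  n C 1 + n C 2
    ≡⟨ nCk+nC[k+1]≡[n+1]C[k+1] n 1 ⟩
  suc n C 2 ∎
  where
  open ≡-Reasoning
  lt : ∀ {m k} → Fin m → Fin k → ℕ
  lt x y = if toℕ x <ᵇ toℕ y then 1 else 0

module _ {n : ℕ} where

  _≟ᵉ_ : (e e′ : Edge n) → Dec (e ≡ e′)
  _≟ᵉ_ = ≡-dec _≟_ _≟_

  multiplicity : List (Edge n) → Fin n → Fin n → ℕ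
  multiplicity []       x y = 0
  multiplicity (e ∷ es) x y = # ((x , y) ≟ᵉ e) + multiplicity es x y

  #-yes : ∀ {A : Set} (d : Dec A) → A → # d ≡ 1
  #-yes (yes _) _ = refl
  #-yes (no ¬a) a = contradiction a ¬a

  #-no : ∀ {A : Set} (d : Dec A) → ¬ A → # d ≡ 0
  #-no (yes a) ¬a = contradiction a ¬a
  #-no (no _) _ = refl

  multiplicity-∉ : ∀ es {x y} → (x , y) ∉ˡ es → multiplicity es x y ≡ 0
  multiplicity-∉ []       _  = refl
  multiplicity-∉ (e ∷ es) e∉ = cong₂ _+_ (#-no (_ ≟ᵉ e) (e∉ ∘ here)) (multiplicity-∉ es (e∉ ∘ there))

  multiplicity-∈ : ∀ {es} → Unique es → ∀ {x y} → (x , y) ∈ˡ es → multiplicity es x y ≡ 1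
  multiplicity-∈ {e ∷ es} (e≢ ∷ _) (here refl) =
    cong₂ _+_ (#-yes (e ≟ᵉ e) refl) (multiplicity-∉ es λ e∈ → lookup e≢ e∈ refl)
  multiplicity-∈ {e ∷ es} (e≢ ∷ unique) (there e∈) =
    cong₂ _+_ (#-no (_ ≟ᵉ e) λ { refl → lookup e≢ e∈ refl }) (multiplicity-∈ unique e∈)

  ∑∑-# : ∀ e → ∑ (λ x → ∑ (λ y → # ((x , y) ≟ᵉ e))) ≡ 1
  ∑∑-# (a , b) = trans
    (∑-δ a (λ x → ∑ (λ y → # ((x , y) ≟ᵉ (a , b)))) λ {x} x≢a →
      trans (∑-cong {n} λ y → #-no ((x , y) ≟ᵉ (a , b)) (x≢a ∘ cong proj₁)) (∑-0 n))
    (trans (∑-δ b (λ y → # ((a , y) ≟ᵉ (a , b))) λ {y} y≢b → #-no ((a , y) ≟ᵉ (a , b)) (y≢b ∘ cong proj₂))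
      (#-yes ((a , b) ≟ᵉ (a , b)) refl))

  ∑∑-multiplicity : ∀ es → ∑ (λ x → ∑ (multiplicity es x)) ≡ length es
  ∑∑-multiplicity []       = trans (∑-cong {n} λ _ → ∑-0 n) (∑-0 n)
  ∑∑-multiplicity (e ∷ es) = trans
    (trans (∑-cong λ x → ∑-+ (λ y → # ((x , y) ≟ᵉ e)) (multiplicity es x))
           (∑-+ (λ x → ∑ (λ y → # ((x , y) ≟ᵉ e))) (λ x → ∑ (multiplicity es x))))
    (cong₂ _+_ (∑∑-# e) (∑∑-multiplicity es))

  -- Each increasing pair contributes exactly one, as an edge of `G` or as an entry of `es`, where
  -- it occurs once; other pairs contribute to neither.
  edgeCount+length : ∀ {G : Graph n} {es} → EnumeratesNonEdges G es → edgeCount G + length es ≡ n C 2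
  edgeCount+length {G} {es} (unique , ordered , iff) = begin
    edgeCount G + length es                                            ≡⟨ cong (edgeCount G +_) (∑∑-multiplicity es) ⟨
    ∑ (λ x → ∑ (weight x)) + ∑ (λ x → ∑ (multiplicity es x))            ≡⟨ ∑-+ (λ x → ∑ (weight x)) (λ x → ∑ (multiplicity es x)) ⟨
    ∑ (λ x → ∑ (weight x) + ∑ (multiplicity es x))                      ≡⟨ ∑-cong (λ x → ∑-+ (weight x) (multiplicity es x)) ⟨
    ∑ (λ x → ∑ (λ y → weight x y + multiplicity es x y))                ≡⟨ ∑-cong (λ x → ∑-cong (pointwise x)) ⟩
    ∑ {n} (λ x → ∑ {n} (λ y → if toℕ x <ᵇ toℕ y then 1 else 0))         ≡⟨ pairs n ⟩
    n C 2                                                              ∎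
    where
    open ≡-Reasoning
    weight : Fin n → Fin n → ℕ
    weight x y = if (toℕ x <ᵇ toℕ y) ∧ G x y then 1 else 0
    pointwise : ∀ x y → weight x y + multiplicity es x y ≡ (if toℕ x <ᵇ toℕ y then 1 else 0)
    pointwise x y with toℕ x <ᵇ toℕ y in lt
    ... | false = multiplicity-∉ es λ e∈ → subst IsTrue lt (<⇒<ᵇ (lookup ordered e∈))
    ... | true with G x y in Gxy
    ... | false = multiplicity-∈ unique (Equivalence.to (iff x y (<ᵇ⇒< _ _ (subst IsTrue (sym lt) tt))) Gxy)
    ... | true = cong suc (multiplicity-∉ es λ e∈ →
      contradiction (trans (sym Gxy) (Equivalence.from (iff x y (lookup ordered e∈)) e∈)) λ ())

enumerates⇒nonEdges : ∀ {G : Graph n} {es} → IsSimple G → EnumeratesNonEdges G es → NonEdges G es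
enumerates⇒nonEdges (symmetric , _) (_ , ordered , iff) = tabulateᴬ λ {(x , y)} e∈ →
  let Gxy = Equivalence.from (iff x y (lookup ordered e∈)) e∈ in Gxy , trans (symmetric y x) Gxy

-- The weak saturation number

module _ {s t : ℕ} (2<s : 2 < s) (s<t : s < t) where

  dismantling-length : ∀ es → Dismantling {suc (s + t)} s t es → length es ≤ 2 * s + 2 * t ∸ 2
  dismantling-length es d = m+n≤o⇒m≤o∸n (length es) (+-cancelʳ-≤ 2 _ _ (begin
    length es + 2 + 2           ≡⟨ trans (+-assoc (length es) 2 2) (+-comm (length es) 4) ⟩
    4 + length es               ≤⟨ dismantling-bound 2<s s<t refl es d ⟩
    2 * suc (s + t)             ≡⟨ arith s t ⟩
    2 * s + 2 * t + 2           ∎))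
    where
    open ≤-Reasoning
    arith : ∀ s t → 2 * suc (s + t) ≡ 2 * s + 2 * t + 2
    arith = solve-∀

  -- The complement of a longest dismantling is weakly saturated, and any weakly saturated graph has
  -- at most `k` non-edges, as its sequence is a dismantling. The bound on `k` makes the truncated
  -- difference a true one.
  maximal⇒wsat : ∀ {k} → Dismantlable s t k → (∀ es → Dismantling {suc (s + t)} s t es → length es ≤ k) →
                 IsWsat (suc (s + t)) (K s t) (suc (s + t) C 2 ∸ k) × k ≤ suc (s + t) C 2
  maximal⇒wsat {k} (es₀ , d₀ , refl) maximal =
    ((complement , (simple , ¬contains , es , enumerates′ , dismantling⇒saturating es cocomplete d) , count) , minimal) ,
    subst (k ≤_) total (m≤n+m k (edgeCount complement))
    where
    open Orient
    es : List (Edge (suc (s + t)))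
    es = map normal es₀
    d : Dismantling s t es
    d = normal-dismantling es₀ d₀
    open Complement es
    enumerates′ : EnumeratesNonEdges complement es
    enumerates′ = enumerates (dismantling⇒unique es d) (normal-all-ordered es₀ d₀)
    total : edgeCount complement + k ≡ suc (s + t) C 2
    total = trans (cong (edgeCount complement +_) (sym (length-map normal es₀))) (edgeCount+length enumerates′)
    count : edgeCount complement ≡ suc (s + t) C 2 ∸ k
    count = trans (sym (m+n∸n≡m (edgeCount complement) k)) (cong (_∸ k) total)
    -- Any edge between the two classes of a copy of K s t could be dismantled before all of es.
    ¬contains : ¬ Contains (K s t) complement
    ¬contains (φ , inj , pres) = <-irrefl refl (subst (_< length es₀) (length-map normal es₀) (maximal (_ ∷ es)
      (embedding⇒step (crosses′ (K-left-right s t i j)) , d)))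
      where
      open FromEmbedding s t refl nonEdges φ inj pres
      i : Fin s
      i = fromℕ< (≤-trans (s≤s z≤n) 2<s)
      j : Fin t
      j = fromℕ< (≤-trans (s≤s z≤n) s<t)
    minimal : ∀ G → WeaklySaturated (suc (s + t)) (K s t) G → suc (s + t) C 2 ∸ k ≤ edgeCount G
    minimal G (simple-G , _ , es′ , enum@(unique , ordered , _) , sat) = ≤-trans
      (∸-monoʳ-≤ (suc (s + t) C 2) (maximal es′ (saturating⇒dismantling refl es′ (enumerates⇒nonEdges simple-G enum) unique ordered sat)))
      (≤-reflexive (trans (cong (_∸ length es′) (sym (edgeCount+length enum))) (m+n∸n≡m (edgeCount G) (length es′))))

  2s+2t∸3≤2s+2t∸2 : 2 * s + 2 * t ∸ 3 ≤ 2 * s + 2 * t ∸ 2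
  2s+2t∸3≤2s+2t∸2 = ∸-monoʳ-≤ (2 * s + 2 * t) (n≤1+n 2)

  coprime-wsat : gcd s t ≡ 1 → IsWsat (suc (s + t)) (K s t) (suc (s + t) C 2 ∸ (2 * s + 2 * t ∸ 2))
  coprime-wsat gcd≡1 = proj₁ (maximal⇒wsat (dismantlable-coprime 2<s s<t gcd≡1) dismantling-length)

  wsat-bounds : ∃[ w ] (IsWsat (suc (s + t)) (K s t) w × 2 * s + 2 * t ∸ 3 ≤ suc (s + t) C 2 ∸ w
                        × suc (s + t) C 2 ∸ w ≤ 2 * s + 2 * t ∸ 2)
  wsat-bounds = let k , lo , hi , wsat , k≤ = optimum ; eq = sym (m∸[m∸n]≡n k≤) in
    suc (s + t) C 2 ∸ k , wsat , subst (2 * s + 2 * t ∸ 3 ≤_) eq lo , subst (_≤ 2 * s + 2 * t ∸ 2) eq hi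
    where
    optimum : ∃[ k ] (2 * s + 2 * t ∸ 3 ≤ k × k ≤ 2 * s + 2 * t ∸ 2 ×
                      IsWsat (suc (s + t)) (K s t) (suc (s + t) C 2 ∸ k) × k ≤ suc (s + t) C 2)
    -- If the upper bound is not attained, the maximum is one less, and `dismantlable` attains that.
    optimum with Dismantlable? s t (2 * s + 2 * t ∸ 2)
    ... | yes d = _ , 2s+2t∸3≤2s+2t∸2 , ≤-refl , maximal⇒wsat d dismantling-length
    ... | no ¬d = _ , ≤-refl , 2s+2t∸3≤2s+2t∸2 , maximal⇒wsat (dismantlable 2<s s<t) λ es d →
      ≤-trans (<⇒≤pred (≤∧≢⇒< (dismantling-length es d) λ eq → ¬d (es , d , eq))) (≤-reflexive (pred[m∸n]≡m∸[1+n] (2 * s + 2 * t) 2))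

theorem2 : (s t : ℕ) → 2 < s → s < t →
    ((gcd s t ≡ 1) → IsWsat (s + t + 1) (K s t) (((s + t + 1) C 2) ∸ (2 * s + 2 * t ∸ 2)))
    × ((1 < gcd s t) → ∃[ w ] (IsWsat (s + t + 1) (K s t) w
    × (2 * s + 2 * t ∸ 3 ≤ ((s + t + 1) C 2) ∸ w)
    × (((s + t + 1) C 2) ∸ w ≤ 2 * s + 2 * t ∸ 2)))
theorem2 s t 2<s s<t rewrite +-comm (s + t) 1 = coprime-wsat 2<s s<t , λ _ → wsat-bounds 2<s s<t
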